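{- Let $K$ be any real cubic number field. For $(i,j),(k,l)\in Ind$, let $\theta(i,j)$ denote the unique element of $\{0,1,2\}\setminus\{i,j\}$. If $(k,l)\neq(i,\theta(i,j))$ and $(k,l)\neq(\theta(i,j),i)$, then there exists $(\alpha,\beta)\in\Delta_K$ such that $\varepsilon_K(\alpha,\beta)=(i,j)$ and $\varepsilon_K(T_K(\alpha,\beta))=(k,l)$.
   Context: Let $K\subset\mathbb{R}$ be a real cubic number field, $N=N_{K/\mathbb{Q}}$ its norm. Fix $r=p/q$ with $p,q$ positive coprime integers and $3\nmid p$. Let $\Delta_K=\{(\alpha,\beta)\in K^2:\ 1,\alpha,\beta \text{ linearly independent over }\mathbb{Q},\ \alpha,\beta>0,\ \alpha+\beta<1\}$ and $Ind=\{(i,j): i,j\in\{0,1,2\},\ i\neq j\}$. Let $\Delta=\{(x,y)\in\mathbb{R}^2: x,y\ge 0,\ x+y\le 1\}$ and $\triangle(1,2)=\{(x,y)\in\Delta: x\ge y\}$, $\triangle(2,1)=\{x\le y\}$, $\triangle(0,1)=\{2x+y-1\le 0\}$, $\triangle(1,0)=\{2x+y-1\ge 0\}$, $\triangle(0,2)=\{x+2y-1\le0\}$, $\triangle(2,0)=\{x+2y-1\ge 0\}$ (all subsets of $\Delta$). Maps $T_{(i,j)}:\triangle(i,j)\to\Delta$: $T_{(1,2)}(x,y)=(\frac{x-y}{1-y},\frac{y}{1-y})$, $T_{(2,1)}(x,y)=(\frac{x}{1-x},\frac{y-x}{1-x})$, $T_{(0,1)}(x,y)=(\frac{x}{1-x},\frac{y}{1-x})$,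 $T_{(1,0)}(x,y)=(\frac{2x+y-1}{x+y},\frac{y}{x+y})$, $T_{(0,2)}(x,y)=(\frac{x}{1-y},\frac{y}{1-y})$, $T_{(2,0)}(x,y)=(\frac{x}{x+y},\frac{x+2y-1}{x+y})$. For $(\alpha,\beta)\in\Delta_K$ put $\gamma=1-\alpha-\beta$ and $v_{\{1,2\}}=\frac{\alpha^r\beta^r}{|N(\alpha)N(\beta)|}$, $v_{\{0,1\}}=\frac{\alpha^r\gamma^r}{|N(\alpha)N(\gamma)|}$, $v_{\{0,2\}}=\frac{\beta^r\gamma^r}{|N(\beta)N(\gamma)|}$; the maximum is attained at a unique pair $\{i_0,j_0\}$. $\varepsilon_K(\alpha,\beta)$ is the ordered pair $(i,j)\in Ind$ with $\{i,j\}=\{i_0,j_0\}$ and $(\alpha,\beta)\in\triangle(i,j)$, and $T_K(\alpha,\beta)=T_{\varepsilon_K(\alpha,\beta)}(\alpha,\beta)$ (a map $\Delta_K\to\Delta_K$). -}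

module Defs where

open import Level using (Level; _⊔_; suc)
open import Algebra.Apartness.Bundles using (HeytingField; HeytingCommutativeRing)
open import Algebra.Bundles using (CommutativeRing)
open import Algebra.Morphism.Structures using (IsRingHomomorphism)
open import Data.Fin.Base using (Fin)
open import Data.Fin.Patterns using (0F; 1F; 2F)
open import Data.Maybe.Base using (Maybe; just; nothing)
open import Data.Nat.Base as ℕ using (ℕ; NonZero)
open import Data.Product.Base using (∃; ∃-syntax; _×_; _,_; proj₁; proj₂)
open import Data.Rational.Base as ℚ using (ℚ; 0ℚ; 1ℚ)
import Data.Rational.Properties as ℚ
open import Data.Sum.Base using (_⊎_; inj₁; inj₂)
open import Data.Vec.Functional using (Vector; []; _∷_)
open import Relation.Binary.Core using (Rel)
open import Relation.Binary.Definitions using (Cotransitive; tri<; tri≈; tri>)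
open import Relation.Binary.PropositionalEquality as ≡ using (_≡_; _≢_)
open import Relation.Binary.Structures using (IsStrictPartialOrder)
open import Relation.Nullary using (¬_; Dec; yes; no; contradiction)
open import Relation.Unary using (Pred)

import Algebra.Properties.CommutativeMonoid.Sum as Summation
import Algebra.Properties.Semiring.Exp as Powers
import Algebra.Solver.Ring
import Algebra.Solver.Ring.AlmostCommutativeRing as ACR
import Algebra.Apartness.Properties.HeytingCommutativeRing as HCR

private variable
  c ℓ₁ ℓ₂ ℓ₃ : Level

-- The field of real numbers, characterised (uniquely up to isomorphism) as a
-- Dedekind-complete ordered field in which ℚ is dense.  The axioms are phrased
-- constructively: `<` is cotransitive instead of trichotomous, and only
-- located cuts (of any two rationals a < b, a is in L or b is in U) are required to be
-- filled; classically L and U then exhaust ℚ up to at most one point.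
record RealNumbers c ℓ₁ ℓ₂ : Set (suc (c ⊔ ℓ₁ ⊔ ℓ₂)) where
  infix 4 _<_ _≤_
  field
    heytingField : HeytingField c ℓ₁ ℓ₂
  open HeytingField heytingField public
  open HeytingCommutativeRing heytingCommutativeRing public using (commutativeRing)
  open CommutativeRing commutativeRing public
    using (rawRing; semiring; +-commutativeMonoid)

  field
    _<_                  : Rel Carrier ℓ₂
    isStrictPartialOrder : IsStrictPartialOrder _≈_ _<_
    <-cotrans            : Cotransitive _<_
    #⇒<⊎>                : ∀ {x y} → x # y → x < y ⊎ y < x
    <⇒#                  : ∀ {x y} → x < y → x # y
    +-monoˡ-<            : ∀ z {x y} → x < y → x + z < y + z
    *-pos                : ∀ {x y} → 0# < x → 0# < y → 0# < x * y

  -- An ordered field admits exactly one such embedding of ℚ, so this is no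
  -- extra structure.
  field
    ι                    : ℚ → Carrier
    ι-isRingHomomorphism : IsRingHomomorphism ℚ.+-*-rawRing rawRing ι
    ι-mono-<             : ∀ {a b} → a ℚ.< b → ι a < ι b
    ι-dense              : ∀ {x y} → x < y → ∃[ a ] x < ι a × ι a < y

  _≤_ : Rel Carrier ℓ₂
  x ≤ y = ¬ (y < x)

  field
    complete : (L U : Pred ℚ ℓ₂) → ∃ L → ∃ U →
               (∀ {a b} → L a → U b → a ℚ.≤ b) →
               (∀ {a b} → a ℚ.< b → L a ⊎ U b) →
               ∃[ x ] (∀ {a} → L a → ι a ≤ x) × (∀ {b} → U b → x ≤ ι b)

  open IsStrictPartialOrder isStrictPartialOrder public
    using (<-respˡ-≈; <-respʳ-≈)
    renaming (trans to <-trans; irrefl to <-irrefl; asym to <-asym)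

module Real (ℝ : RealNumbers c ℓ₁ ℓ₂) where
  open RealNumbers ℝ public
  open Powers semiring public using (_^_)
  open Summation +-commutativeMonoid public using (sum)
  module ι = IsRingHomomorphism ι-isRingHomomorphism
  open HCR heytingCommutativeRing using (invertibleˡ⇒#; x-0≈x)

  private
    morphism : ACR._-Raw-AlmostCommutative⟶_ ℚ.+-*-rawRing
                 (ACR.fromCommutativeRing commutativeRing)
    morphism = record
      { ⟦_⟧ = ι ; +-homo = ι.+-homo ; *-homo = ι.*-homo ; -‿homo = ι.-‿homo
      ; 0-homo = ι.0#-homo ; 1-homo = ι.1#-homo }

    ι-≟ : ∀ a b → Maybe (ι a ≈ ι b)
    ι-≟ a b with a ℚ.≟ b
    ... | yes ≡.refl = just refl
    ... | no _       = nothing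

  module Solver = Algebra.Solver.Ring ℚ.+-*-rawRing
    (ACR.fromCommutativeRing commutativeRing) morphism ι-≟
  open Solver using (solve; _:=_; _:+_; _:*_; _:-_; :-_; con)

  0<1 : 0# < 1#
  0<1 = <-respˡ-≈ ι.0#-homo (<-respʳ-≈ ι.1#-homo (ι-mono-< (ℚ.positive⁻¹ 1ℚ)))

  ι-pos : ∀ {a} → 0ℚ ℚ.< a → 0# < ι a
  ι-pos 0<a = <-respˡ-≈ ι.0#-homo (ι-mono-< 0<a)

  <⇒0<- : ∀ {x y} → x < y → 0# < y - x
  <⇒0<- {x} x<y = <-respˡ-≈ (-‿inverseʳ x) (+-monoˡ-< (- x) x<y)

  0<-⇒< : ∀ {x y} → 0# < y - x → x < y
  0<-⇒< {x} {y} p = <-respˡ-≈ (+-identityˡ x)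
    (<-respʳ-≈ (solve 2 (λ x y → y :- x :+ x := y) refl x y) (+-monoˡ-< x p))

  <-moveʳ : ∀ {x y u v} → y - x ≈ v - u → x < y → u < v
  <-moveʳ e x<y = 0<-⇒< (<-respʳ-≈ e (<⇒0<- x<y))

  <⇒≤ : ∀ {x y} → x < y → x ≤ y
  <⇒≤ = <-asym

  ≤-<-trans : ∀ {x y z} → x ≤ y → y < z → x < z
  ≤-<-trans {x} x≤y y<z with <-cotrans y<z x
  ... | inj₁ y<x = contradiction y<x x≤y
  ... | inj₂ x<z = x<z

  <-≤-trans : ∀ {x y z} → x < y → y ≤ z → x < z
  <-≤-trans {z = z} x<y y≤z with <-cotrans x<y z
  ... | inj₁ x<z = x<z
  ... | inj₂ z<y = contradiction z<y y≤z

  ≤-antisym : ∀ {x y} → x ≤ y → y ≤ x → x ≈ y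
  ≤-antisym {x} {y} x≤y y≤x = proj₁ (tight x y) λ x#y → case (#⇒<⊎> x#y)
    where
    case : ¬ (x < y ⊎ y < x)
    case (inj₁ x<y) = y≤x x<y
    case (inj₂ y<x) = x≤y y<x

  ι-cancel-≤ : ∀ {a b} → ι a ≤ ι b → a ℚ.≤ b
  ι-cancel-≤ {a} {b} p with a ℚ.≤? b
  ... | yes a≤b = a≤b
  ... | no a≰b  = contradiction (ι-mono-< (ℚ.≰⇒> a≰b)) p

  ι-mono-≤ : ∀ {a b} → a ℚ.≤ b → ι a ≤ ι b
  ι-mono-≤ {a} {b} a≤b b<a with ℚ.<-cmp a b
  ... | tri< a<b _ _    = <-asym (ι-mono-< a<b) b<a
  ... | tri≈ _ ≡.refl _ = <-irrefl refl b<a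
  ... | tri> _ _ b<a′   = ℚ.<-irrefl ≡.refl (ℚ.<-≤-trans b<a′ a≤b)

  +-pos : ∀ {x y} → 0# < x → 0# < y → 0# < x + y
  +-pos {x} {y} 0<x 0<y = <-trans 0<y (<-respˡ-≈ (+-identityˡ y) (+-monoˡ-< y 0<x))

  *-monoʳ-< : ∀ {x y z} → 0# < z → x < y → x * z < y * z
  *-monoʳ-< {x} {y} {z} 0<z x<y = 0<-⇒< (<-respʳ-≈
    (solve 3 (λ x y z → (y :- x) :* z := y :* z :- x :* z) refl x y z)
    (*-pos (<⇒0<- x<y) 0<z))

  *-cancel-pos : ∀ {x y} → 0# < x * y → 0# ≤ y → 0# < x
  *-cancel-pos {x} {y} 0<xy 0≤y = conclude (#⇒<⊎> y#0) (#⇒<⊎> x#0)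
    where
    xy-invertible = #⇒invertible (#-sym (<⇒# 0<xy))
    z = proj₁ xy-invertible
    z[xy]≈1 : z * (x * y) ≈ 1#
    z[xy]≈1 = trans (*-congˡ (sym (x-0≈x _))) (proj₁ (proj₂ xy-invertible))
    y#0 : y # 0#
    y#0 = invertibleˡ⇒# (z * x ,
      trans (*-congˡ (x-0≈x y)) (trans (*-assoc z x y) z[xy]≈1))
    x#0 : x # 0#
    x#0 = invertibleˡ⇒# (z * y ,
      trans (*-congˡ (x-0≈x x)) (trans (*-assoc z y x) (trans (*-congˡ (*-comm y x)) z[xy]≈1)))
    conclude : y < 0# ⊎ 0# < y → x < 0# ⊎ 0# < x → 0# < x
    conclude _          (inj₂ 0<x) = 0<x
    conclude (inj₁ y<0) _          = contradiction y<0 0≤y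
    conclude (inj₂ 0<y) (inj₁ x<0) =
      contradiction 0<xy (<-asym (<-respʳ-≈ (zeroˡ y) (*-monoʳ-< 0<y x<0)))

  inverse : ∀ x → 0# < x → Carrier
  inverse x 0<x = proj₁ (#⇒invertible (#-sym (<⇒# 0<x)))

  inverse-* : ∀ x (0<x : 0# < x) → inverse x 0<x * x ≈ 1#
  inverse-* x 0<x = trans (*-congˡ (sym (x-0≈x x)))
    (proj₁ (proj₂ (#⇒invertible (#-sym (<⇒# 0<x)))))

  ≤-refl : ∀ {x} → x ≤ x
  ≤-refl = <-irrefl refl

  ≤-trans : ∀ {x y z} → x ≤ y → y ≤ z → x ≤ z
  ≤-trans x≤y y≤z z<x = x≤y (≤-<-trans y≤z z<x)

  *-monoʳ-≤ : ∀ {x y z} → 0# ≤ z → x ≤ y → x * z ≤ y * z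
  *-monoʳ-≤ {x} {y} {z} 0≤z x≤y yz<xz = x≤y (0<-⇒< (*-cancel-pos
    (<-respʳ-≈ (solve 3 (λ x y z → x :* z :- y :* z := (x :- y) :* z) refl x y z)
      (<⇒0<- yz<xz)) 0≤z))

  *-monoˡ-≤ : ∀ {x y z} → 0# ≤ z → x ≤ y → z * x ≤ z * y
  *-monoˡ-≤ {x} {y} {z} 0≤z x≤y p =
    *-monoʳ-≤ 0≤z x≤y (<-respˡ-≈ (*-comm z y) (<-respʳ-≈ (*-comm z x) p))

  ^-nonneg : ∀ n {x} → 0# ≤ x → 0# ≤ x ^ n
  ^-nonneg ℕ.zero        0≤x = <⇒≤ 0<1
  ^-nonneg (ℕ.suc n) {x} 0≤x p =
    *-monoʳ-≤ (^-nonneg n 0≤x) 0≤x (<-respʳ-≈ (sym (zeroˡ (x ^ n))) p)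

  ^-mono-≤ : ∀ n {x y} → 0# ≤ x → x ≤ y → x ^ n ≤ y ^ n
  ^-mono-≤ ℕ.zero    0≤x x≤y = ≤-refl
  ^-mono-≤ (ℕ.suc n) 0≤x x≤y = ≤-trans
    (*-monoʳ-≤ (^-nonneg n 0≤x) x≤y)
    (*-monoˡ-≤ (≤-trans 0≤x x≤y) (^-mono-≤ n 0≤x x≤y))

  ^-pos : ∀ n {x} → 0# < x → 0# < x ^ n
  ^-pos ℕ.zero    0<x = 0<1
  ^-pos (ℕ.suc n) 0<x = *-pos 0<x (^-pos n 0<x)

  ^-mono-< : ∀ n .{{_ : NonZero n}} {x y} → 0# ≤ x → x < y → x ^ n < y ^ n
  ^-mono-< (ℕ.suc n) 0≤x x<y = ≤-<-trans
    (*-monoˡ-≤ 0≤x (^-mono-≤ n 0≤x (<⇒≤ x<y)))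
    (*-monoʳ-< (^-pos n (≤-<-trans 0≤x x<y)) x<y)

  x<x+1 : ∀ x → x < x + 1#
  x<x+1 x = <-respˡ-≈ (+-identityˡ x) (<-respʳ-≈ (+-comm 1# x) (+-monoˡ-< x 0<1))

  -- u ↦ u z is uniformly continuous when z ≥ 0.
  modulus : ∀ {z a b} → 0# ≤ z → a < b → ∃[ δ ] 0# < δ × a + δ * z < b
  modulus {z} {a} {b} 0≤z a<b = δ , 0<δ , <-moveʳ δ≈b-[a+δz] 0<δ
    where
    0<ε = <⇒0<- a<b
    0<z+1 : 0# < z + 1#
    0<z+1 = ≤-<-trans 0≤z (x<x+1 z)
    w = inverse (z + 1#) 0<z+1
    δ = (b - a) * w
    0<w : 0# < w
    0<w = *-cancel-pos (<-respʳ-≈ (sym (inverse-* (z + 1#) 0<z+1)) 0<1) (<⇒≤ 0<z+1)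
    0<δ : 0# < δ
    0<δ = *-pos 0<ε 0<w
    δ≈b-[a+δz] : δ - 0# ≈ b - (a + δ * z)
    δ≈b-[a+δz] = trans (x-0≈x δ) (sym (trans
      (solve 4 (λ a b z δ → b :- (a :+ δ :* z) := (b :- a) :- δ :* z) refl a b z δ)
      (trans (+-congʳ (trans (sym (*-identityʳ (b - a))) (*-congˡ (sym (inverse-* (z + 1#) 0<z+1)))))
        (trans (solve 4 (λ ε w z o → ε :* (w :* (z :+ o)) :- ε :* w :* z := ε :* w :* o) refl (b - a) w z 1#)
          (*-identityʳ δ)))))

  increase : ∀ {x z a} → 0# ≤ z → x * z < a → ∃[ p ] x < ι p × ι p * z < a
  increase {x} {z} {a} 0≤z xz<a =
    let δ , 0<δ , xz+δz<a = modulus 0≤z xz<a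
        p , x<p , p<x+δ   = ι-dense {x} {x + δ}
          (0<-⇒< (<-respʳ-≈ (solve 2 (λ x δ → δ := x :+ δ :- x) refl x δ) 0<δ))
    in p , x<p , ≤-<-trans (*-monoʳ-≤ 0≤z (<⇒≤ p<x+δ)) (<-respˡ-≈ (sym (distribʳ z x δ)) xz+δz<a)

  decrease : ∀ {x z a} → 0# ≤ z → a < x * z → ∃[ p ] ι p < x × a < ι p * z
  decrease {x} {z} {a} 0≤z a<xz =
    let δ , 0<δ , a+δz<xz = modulus 0≤z a<xz
        p , x-δ<p , p<x   = ι-dense {x - δ} {x}
          (0<-⇒< (<-respʳ-≈ (solve 2 (λ x δ → δ := x :- (x :- δ)) refl x δ) 0<δ))
    in p , p<x , <-≤-trans
         (<-moveʳ (solve 4 (λ x δ z a → x :* z :- (a :+ δ :* z) := (x :- δ) :* z :- a) refl x δ z a) a+δz<xz)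
         (*-monoʳ-≤ 0≤z (<⇒≤ x-δ<p))

  ^-increase : ∀ n {x a} → 0# ≤ x → x ^ n < a → ∃[ p ] x < ι p × ι p ^ n < a
  ^-increase ℕ.zero    {x} 0≤x 1<a =
    let p , x<p , _ = ι-dense (x<x+1 x) in p , x<p , 1<a
  ^-increase (ℕ.suc n) {x} {a} 0≤x xxⁿ<a = smaller (ℚ.≤-total p r)
    where
    step₁ = increase (^-nonneg n 0≤x) xxⁿ<a
    p = proj₁ step₁
    x<p = proj₁ (proj₂ step₁)
    0<p = ≤-<-trans 0≤x x<p
    step₂ = increase (<⇒≤ 0<p) (<-respˡ-≈ (*-comm (ι p) (x ^ n)) (proj₂ (proj₂ step₁)))
    q = proj₁ step₂
    step₃ = ^-increase n 0≤x (proj₁ (proj₂ step₂))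
    r = proj₁ step₃
    x<r = proj₁ (proj₂ step₃)
    bound : ∀ m → x < ι m → ι m ≤ ι p → ι m ≤ ι r → ι m ^ ℕ.suc n < a
    bound m x<m m≤p m≤r = ≤-<-trans (*-monoʳ-≤ (^-nonneg n 0≤m) m≤p)
      (<-trans (<-respˡ-≈ (*-comm (ι m ^ n) (ι p))
                 (*-monoʳ-< 0<p (≤-<-trans (^-mono-≤ n 0≤m m≤r) (proj₂ (proj₂ step₃)))))
               (proj₂ (proj₂ step₂)))
      where 0≤m = <⇒≤ (≤-<-trans 0≤x x<m)
    smaller : p ℚ.≤ r ⊎ r ℚ.≤ p → ∃[ m ] x < ι m × ι m ^ ℕ.suc n < a
    smaller (inj₁ p≤r) = p , x<p , bound p x<p ≤-refl (ι-mono-≤ p≤r)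
    smaller (inj₂ r≤p) = r , x<r , bound r x<r (ι-mono-≤ r≤p) ≤-refl

  ^-decrease : ∀ n {x a} → 0# < x → 0# < a → a < x ^ n → ∃[ p ] 0# < ι p × ι p < x × a < ι p ^ n
  ^-decrease ℕ.zero    0<x 0<a a<1 =
    let p , 0<p , p<x = ι-dense 0<x in p , 0<p , p<x , a<1
  ^-decrease (ℕ.suc n) {x} {a} 0<x 0<a a<xxⁿ = larger (ℚ.≤-total p r)
    where
    0≤xⁿ = <⇒≤ (^-pos n 0<x)
    step₁ = decrease 0≤xⁿ a<xxⁿ
    p = proj₁ step₁
    p<x = proj₁ (proj₂ step₁)
    0<p = *-cancel-pos (<-trans 0<a (proj₂ (proj₂ step₁))) 0≤xⁿ
    step₂ = decrease (<⇒≤ 0<p) (<-respʳ-≈ (*-comm (ι p) (x ^ n)) (proj₂ (proj₂ step₁)))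
    q = proj₁ step₂
    a<qp = proj₂ (proj₂ step₂)
    0<q = *-cancel-pos (<-trans 0<a a<qp) (<⇒≤ 0<p)
    step₃ = ^-decrease n 0<x 0<q (proj₁ (proj₂ step₂))
    r = proj₁ step₃
    0<r = proj₁ (proj₂ step₃)
    r<x = proj₁ (proj₂ (proj₂ step₃))
    q<rⁿ = proj₂ (proj₂ (proj₂ step₃))
    bound : ∀ m → 0# < ι m → ι p ≤ ι m → ι r ≤ ι m → a < ι m ^ ℕ.suc n
    bound m 0<m p≤m r≤m = <-trans a<qp (≤-<-trans (*-monoˡ-≤ (<⇒≤ 0<q) p≤m)
      (<-respʳ-≈ (*-comm (ι m ^ n) (ι m))
        (*-monoʳ-< 0<m (<-≤-trans q<rⁿ (^-mono-≤ n (<⇒≤ 0<r) r≤m)))))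
    larger : p ℚ.≤ r ⊎ r ℚ.≤ p → ∃[ m ] 0# < ι m × ι m < x × a < ι m ^ ℕ.suc n
    larger (inj₁ p≤r) = r , 0<r , r<x , bound r 0<r (ι-mono-≤ p≤r) ≤-refl
    larger (inj₂ r≤p) = p , 0<p , p<x , bound p 0<p ≤-refl (ι-mono-≤ r≤p)

  root-∃ : ∀ n .{{_ : NonZero n}} a → 0# < a → ∃[ x ] 0# < x × x ^ n ≈ a
  root-∃ n@(ℕ.suc n-1) a 0<a = x , 0<x , ≤-antisym xⁿ≤a a≤xⁿ
    where
    L U : Pred ℚ _
    L b = ι b < 0# ⊎ ι b ^ n < a
    U b = 0# < ι b × a < ι b ^ n

    L≤U : ∀ {b d} → L b → U d → b ℚ.≤ d
    L≤U (inj₁ b<0)  (0<d , _)    = ι-cancel-≤ (<⇒≤ (<-trans b<0 0<d))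
    L≤U (inj₂ bⁿ<a) (0<d , a<dⁿ) = ι-cancel-≤ λ d<b →
      <-asym (^-mono-< n (<⇒≤ 0<d) d<b) (<-trans bⁿ<a a<dⁿ)

    located : ∀ {b d} → b ℚ.< d → L b ⊎ U d
    located {b} {d} b<d = sign (b ℚ.<? 0ℚ)
      where
      sign : Dec (b ℚ.< 0ℚ) → L b ⊎ U d
      sign (yes b<0) = inj₁ (inj₁ (<-respʳ-≈ ι.0#-homo (ι-mono-< b<0)))
      sign (no b≮0)  = compare (<-cotrans (^-mono-< n 0≤b (ι-mono-< b<d)) a)
        where
        0≤b : 0# ≤ ι b
        0≤b p = ι-mono-≤ (ℚ.≮⇒≥ b≮0) (<-respʳ-≈ (sym ι.0#-homo) p)
        compare : ι b ^ n < a ⊎ a < ι d ^ n → L b ⊎ U d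
        compare (inj₁ bⁿ<a) = inj₁ (inj₂ bⁿ<a)
        compare (inj₂ a<dⁿ) = inj₂ (≤-<-trans 0≤b (ι-mono-< b<d) , a<dⁿ)

    ∃L : ∃ L
    ∃L = ℚ.- 1ℚ , inj₁ (<-respʳ-≈ ι.0#-homo (ι-mono-< (ℚ.negative⁻¹ (ℚ.- 1ℚ))))

    0≤1 : 0# ≤ 1#
    0≤1 = <⇒≤ 0<1

    1≤^ : ∀ m {y} → 1# ≤ y → 1# ≤ y ^ m
    1≤^ ℕ.zero    1≤y = ≤-refl
    1≤^ (ℕ.suc m) {y} 1≤y = ≤-trans 1≤y (λ p →
      *-monoˡ-≤ (≤-trans 0≤1 1≤y) (1≤^ m 1≤y) (<-respʳ-≈ (sym (*-identityʳ y)) p))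

    ∃U : ∃ U
    ∃U = let b , a+1<b , _ = ι-dense (x<x+1 (a + 1#))
             a<b = <-trans (x<x+1 a) a+1<b
             0<b = <-trans 0<a a<b
             1<b = <-trans (<-respˡ-≈ (+-identityˡ 1#) (+-monoˡ-< 1# 0<a)) a+1<b
         in b , 0<b , <-≤-trans a<b (λ p →
              *-monoˡ-≤ (<⇒≤ 0<b) (1≤^ n-1 (<⇒≤ 1<b)) (<-respʳ-≈ (sym (*-identityʳ (ι b))) p))

    cut = complete L U ∃L ∃U L≤U located
    x = proj₁ cut

    0<x : 0# < x
    0<x = let p , 0<p , pⁿ<a = ^-increase n {0#} ≤-refl (<-respˡ-≈ (sym (zeroˡ (0# ^ n-1))) 0<a)
          in <-≤-trans 0<p (proj₁ (proj₂ cut) (inj₂ pⁿ<a))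

    a≤xⁿ : a ≤ x ^ n
    a≤xⁿ xⁿ<a = let p , x<p , pⁿ<a = ^-increase n (<⇒≤ 0<x) xⁿ<a
                in proj₁ (proj₂ cut) (inj₂ pⁿ<a) x<p

    xⁿ≤a : x ^ n ≤ a
    xⁿ≤a a<xⁿ = let p , 0<p , p<x , a<pⁿ = ^-decrease n 0<x 0<a a<xⁿ
                in proj₂ (proj₂ cut) (0<p , a<pⁿ) p<x

  root : ∀ n .{{_ : NonZero n}} a → 0# < a → Carrier
  root n a 0<a = proj₁ (root-∃ n a 0<a)

  -- x ^ (p / q) for x > 0: the positive real whose q-th power is x ^ p.
  power : ∀ x → 0# < x → (p q : ℕ) .{{_ : NonZero q}} → Carrier
  power x 0<x p q = root q (x ^ p) (^-pos p 0<x)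

  LinearlyIndependent : ∀ {n} → Vector Carrier n → Set ℓ₁
  LinearlyIndependent {n} v = (a : Vector ℚ n) → sum (λ i → ι (a i) * v i) ≈ 0# → ∀ i → a i ≡ 0ℚ

  Point : Set c
  Point = Carrier × Carrier

  2# : Carrier
  2# = 1# + 1#

  Δ : Pred Point ℓ₂
  Δ (x , y) = 0# ≤ x × 0# ≤ y × x + y ≤ 1#

  half : (i j : Fin 3) → i ≢ j → Pred Point ℓ₂
  half 1F 2F _ (x , y) = y ≤ x
  half 2F 1F _ (x , y) = x ≤ y
  half 0F 1F _ (x , y) = 2# * x + y - 1# ≤ 0#
  half 1F 0F _ (x , y) = 0# ≤ 2# * x + y - 1#
  half 0F 2F _ (x , y) = x + 2# * y - 1# ≤ 0#
  half 2F 0F _ (x , y) = 0# ≤ x + 2# * y - 1#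
  half 0F 0F i≢j _     = contradiction ≡.refl i≢j
  half 1F 1F i≢j _     = contradiction ≡.refl i≢j
  half 2F 2F i≢j _     = contradiction ≡.refl i≢j

  △ : (i j : Fin 3) → i ≢ j → Pred Point ℓ₂
  △ i j i≢j P = Δ P × half i j i≢j P

  -- The common denominator of the two coordinates of T i j.
  denominator : (i j : Fin 3) → i ≢ j → Point → Carrier
  denominator 1F 2F _ (x , y) = 1# - y
  denominator 2F 1F _ (x , y) = 1# - x
  denominator 0F 1F _ (x , y) = 1# - x
  denominator 1F 0F _ (x , y) = x + y
  denominator 0F 2F _ (x , y) = 1# - y
  denominator 2F 0F _ (x , y) = x + y
  denominator 0F 0F i≢j _     = contradiction ≡.refl i≢j
  denominator 1F 1F i≢j _     = contradiction ≡.refl i≢j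
  denominator 2F 2F i≢j _     = contradiction ≡.refl i≢j

  numerators : (i j : Fin 3) → i ≢ j → Point → Point
  numerators 1F 2F _ (x , y) = x - y , y
  numerators 2F 1F _ (x , y) = x , y - x
  numerators 0F 1F _ (x , y) = x , y
  numerators 1F 0F _ (x , y) = 2# * x + y - 1# , y
  numerators 0F 2F _ (x , y) = x , y
  numerators 2F 0F _ (x , y) = x , x + 2# * y - 1#
  numerators 0F 0F i≢j _     = contradiction ≡.refl i≢j
  numerators 1F 1F i≢j _     = contradiction ≡.refl i≢j
  numerators 2F 2F i≢j _     = contradiction ≡.refl i≢j

  0≤-+ : ∀ {x y} → 0# ≤ x → 0# ≤ y → 0# ≤ x + y
  0≤-+ {x} {y} 0≤x 0≤y x+y<0 = conclude (<-cotrans x+y<0 y)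
    where
    conclude : ¬ (x + y < y ⊎ y < 0#)
    conclude (inj₁ x+y<y) = 0≤x (<-moveʳ (trans
      (solve 2 (λ x y → y :- (x :+ y) := :- x) refl x y) (sym (+-identityˡ (- x)))) x+y<y)
    conclude (inj₂ y<0)   = 0≤y y<0

  ≤⇒0≤- : ∀ {x y} → x ≤ y → 0# ≤ y - x
  ≤⇒0≤- {x} {y} x≤y y-x<0 = x≤y (<-moveʳ (trans (+-identityˡ (- (y - x)))
    (solve 2 (λ x y → :- (y :- x) := x :- y) refl x y)) y-x<0)

  private
    2*≈+ : ∀ x → 2# * x ≈ x + x
    2*≈+ x = trans (distribʳ x 1# 1#) (+-cong (*-identityˡ x) (*-identityˡ x))

    positive : ∀ {d u v} → 0# ≤ u → 0# ≤ v → u + v ≈ d + d - 1# → 0# < d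
    positive {d} 0≤u 0≤v e = *-cancel-pos
      (<-respʳ-≈ (sym (trans (*-comm d 2#) (2*≈+ d))) (<-≤-trans 0<1 1≤d+d))
      (<⇒≤ (+-pos 0<1 0<1))
      where
      1≤d+d : 1# ≤ d + d
      1≤d+d p = 0≤-+ 0≤u 0≤v
        (<-respˡ-≈ (sym e) (<-respʳ-≈ (-‿inverseʳ 1#) (+-monoˡ-< (- 1#) p)))

  denominator-pos : ∀ i j (i≢j : i ≢ j) P → △ i j i≢j P → 0# < denominator i j i≢j P
  denominator-pos 1F 2F _ (x , y) ((_ , _ , x+y≤1) , y≤x) = positive (≤⇒0≤- y≤x) (≤⇒0≤- x+y≤1)
    (solve 3 (λ x y o → (x :- y) :+ (o :- (x :+ y)) := (o :- y) :+ (o :- y) :- o) refl x y 1#)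
  denominator-pos 2F 1F _ (x , y) ((_ , _ , x+y≤1) , x≤y) = positive (≤⇒0≤- x≤y) (≤⇒0≤- x+y≤1)
    (solve 3 (λ x y o → (y :- x) :+ (o :- (x :+ y)) := (o :- x) :+ (o :- x) :- o) refl x y 1#)
  denominator-pos 0F 1F _ (x , y) ((_ , 0≤y , _) , h) = positive (≤⇒0≤- h) 0≤y
    (trans (+-congʳ (+-congˡ (-‿cong (+-congʳ (+-congʳ (2*≈+ x)))))) (trans (+-congʳ (+-identityˡ _))
      (solve 3 (λ x y o → :- (x :+ x :+ y :- o) :+ y := (o :- x) :+ (o :- x) :- o) refl x y 1#)))
  denominator-pos 1F 0F _ (x , y) ((_ , 0≤y , _) , h) = positive h 0≤y
    (trans (+-congʳ (+-congʳ (+-congʳ (2*≈+ x))))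
      (solve 3 (λ x y o → (x :+ x :+ y :- o) :+ y := (x :+ y) :+ (x :+ y) :- o) refl x y 1#))
  denominator-pos 0F 2F _ (x , y) ((0≤x , _ , _) , h) = positive (≤⇒0≤- h) 0≤x
    (trans (+-congʳ (+-congˡ (-‿cong (+-congʳ (+-congˡ (2*≈+ y)))))) (trans (+-congʳ (+-identityˡ _))
      (solve 3 (λ x y o → :- (x :+ (y :+ y) :- o) :+ x := (o :- y) :+ (o :- y) :- o) refl x y 1#)))
  denominator-pos 2F 0F _ (x , y) ((0≤x , _ , _) , h) = positive h 0≤x
    (trans (+-congʳ (+-congʳ (+-congˡ (2*≈+ y))))
      (solve 3 (λ x y o → (x :+ (y :+ y) :- o) :+ x := (x :+ y) :+ (x :+ y) :- o) refl x y 1#))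
  denominator-pos 0F 0F i≢j _ _ = contradiction ≡.refl i≢j
  denominator-pos 1F 1F i≢j _ _ = contradiction ≡.refl i≢j
  denominator-pos 2F 2F i≢j _ _ = contradiction ≡.refl i≢j

  T : ∀ i j (i≢j : i ≢ j) P → △ i j i≢j P → Point
  T i j i≢j P P∈△ = proj₁ n * d⁻¹ , proj₂ n * d⁻¹
    where
    n   = numerators i j i≢j P
    d⁻¹ = inverse (denominator i j i≢j P) (denominator-pos i j i≢j P P∈△)

θ : (i j : Fin 3) → i ≢ j → Fin 3
θ 0F 1F _   = 2F
θ 1F 0F _   = 2F
θ 0F 2F _   = 1F
θ 2F 0F _   = 1F
θ 1F 2F _   = 0F
θ 2F 1F _   = 0F
θ 0F 0F i≢j = contradiction ≡.refl i≢j
θ 1F 1F i≢j = contradiction ≡.refl i≢j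
θ 2F 2F i≢j = contradiction ≡.refl i≢j

det₃ : (Fin 3 → Fin 3 → ℚ) → ℚ
det₃ m = m 0F 0F ℚ.* (m 1F 1F ℚ.* m 2F 2F ℚ.- m 1F 2F ℚ.* m 2F 1F)
   ℚ.- m 0F 1F ℚ.* (m 1F 0F ℚ.* m 2F 2F ℚ.- m 1F 2F ℚ.* m 2F 0F)
   ℚ.+ m 0F 2F ℚ.* (m 1F 0F ℚ.* m 2F 1F ℚ.- m 1F 1F ℚ.* m 2F 0F)

-- 1 / a, with the junk value 0 at a = 0.  It is applied only to norms of
-- nonzero elements of a field, which do not vanish.
reciprocal : ℚ → ℚ
reciprocal a with a ℚ.≟ 0ℚ
... | yes _  = 0ℚ
... | no a≢0 = ℚ.1/_ a {{ℚ.≢-nonZero a≢0}}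

-- A subfield of ℝ of dimension 3 over ℚ.
record RealCubicField (ℝ : RealNumbers c ℓ₁ ℓ₂) ℓ₃ : Set (c ⊔ ℓ₁ ⊔ ℓ₂ ⊔ suc ℓ₃) where
  open Real ℝ
  field
    Member   : Pred Carrier ℓ₃
    ∈-resp-≈ : ∀ {x y} → x ≈ y → Member x → Member y
    1-∈      : Member 1#
    +-∈      : ∀ {x y} → Member x → Member y → Member (x + y)
    *-∈      : ∀ {x y} → Member x → Member y → Member (x * y)
    neg-∈    : ∀ {x} → Member x → Member (- x)
    inv-∈    : ∀ {x} → Member x → ¬ (x ≈ 0#) → ∃[ y ] Member y × x * y ≈ 1#

    basis             : Vector Carrier 3
    basis-∈           : ∀ i → Member (basis i)
    basis-independent : LinearlyIndependent basis
    basis-spans       : ∀ {x} → Member x → ∃ λ (a : Vector ℚ 3) → x ≈ sum (λ i → ι (a i) * basis i)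

  -- N_{K/ℚ}(x): the determinant of multiplication by x on the ℚ-vector space
  -- K.  Coordinates are unique by basis-independent, so the value does not
  -- depend on the proof of membership.
  norm : ∀ {x} → Member x → ℚ
  norm {x} x∈K = det₃ λ i → proj₁ (basis-spans {x * basis i} (*-∈ x∈K (basis-∈ i)))

module Algorithm (ℝ : RealNumbers c ℓ₁ ℓ₂) (K : RealCubicField ℝ ℓ₃)
                 (p q : ℕ) .{{_ : NonZero q}} where
  open Real ℝ
  open RealCubicField K

  record Δ-K (P : Point) : Set (ℓ₁ ⊔ ℓ₂ ⊔ ℓ₃) where
    α = proj₁ P
    β = proj₂ P
    field
      α-∈         : Member α
      β-∈         : Member β
      independent : LinearlyIndependent (1# ∷ α ∷ β ∷ [])
      α-pos       : 0# < α
      β-pos       : 0# < β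
      α+β<1       : α + β < 1#

    -- The coordinates are indexed so that v i j below is v_{i,j}:
    -- 0 ↦ γ, 1 ↦ α, 2 ↦ β.
    coordinate : Fin 3 → Carrier
    coordinate 0F = 1# - α - β
    coordinate 1F = α
    coordinate 2F = β

    coordinate-∈ : ∀ i → Member (coordinate i)
    coordinate-∈ 0F = +-∈ (+-∈ 1-∈ (neg-∈ α-∈)) (neg-∈ β-∈)
    coordinate-∈ 1F = α-∈
    coordinate-∈ 2F = β-∈

    coordinate-pos : ∀ i → 0# < coordinate i
    coordinate-pos 0F = <-respʳ-≈ (Solver.solve 3 (λ o α β → o :- (α :+ β) := o :- α :- β) refl 1# α β)
      (<⇒0<- α+β<1)
      where open Solver using (_:=_; _:+_; _:-_)
    coordinate-pos 1F = α-pos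
    coordinate-pos 2F = β-pos

    v : Fin 3 → Fin 3 → Carrier
    v i j = power (coordinate i) (coordinate-pos i) p q * power (coordinate j) (coordinate-pos j) p q
          * ι (reciprocal ℚ.∣ norm (coordinate-∈ i) ℚ.* norm (coordinate-∈ j) ∣)

  -- The graph of ε_K : Δ_K → Ind, i.e. P ∈ Δ_K and ε_K P = (i , j).  The
  -- unordered pair at which v is maximal is unique, so the maximum is strict.
  record ε-K_≡⟨_,_⟩ (P : Point) (i j : Fin 3) : Set (ℓ₁ ⊔ ℓ₂ ⊔ ℓ₃) where
    field
      i≢j     : i ≢ j
      P∈Δ-K   : Δ-K P
    open Δ-K P∈Δ-K
    field
      maximum : ∀ k l → k ≢ l → (k , l) ≢ (i , j) → (k , l) ≢ (j , i) → v k l < v i j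
      P∈△     : △ i j i≢j P

    T-K : Point
    T-K = T i j i≢j P P∈△

-- Up to scaling, a point is a triple of positive elements of K indexed by 0, 1, 2,
-- and T (i , j) replaces the i-th of them by its difference with the j-th.  With
-- w(a) = a ^ r / |N(a)|, whose comparisons are scale-invariant, ε_K = (i , j) says
-- that w is smallest at the remaining index h and that the i-th element exceeds
-- the j-th.  Writing (x , y , z) for the elements at (i , j , h) after one step,
-- they are (x + y , y , z) before it, so we need w(z) < w(y), w(z) < w(x + y) and
-- either w(z) < w(x), or w(x) < w(y) and w(x) < w(z), with a prescribed order of
-- x and y, respectively of y and z.
--
-- Let ω ∈ K be irrational, c a rational close to ω and ζ = (ω - c) / δ, where δ is
-- Newton's approximation of ω - c.  Then ζ is close to 1 while its other two
-- conjugates are huge, so N(u ζ + v) is nearly proportional to u² (u + v), whereas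
-- u ζ + v is nearly u + v: real size and norm can be prescribed independently.
-- We take x, y, z of real size so close to 1 that the norms alone decide the
-- comparisons of w.
module Submission where

open import Defs
open import Data.Bool.Base using (Bool; true; false)
open import Data.Fin.Base using (Fin)
open import Data.Fin.Patterns using (0F; 1F; 2F)
open import Data.Integer.Base as ℤ using (+_)
import Data.Integer.Properties as ℤ
open import Data.Nat.Base as ℕ using (ℕ; NonZero)
open import Data.Nat.Coprimality using (Coprime)
open import Data.Nat.Divisibility using (_∣_)
open import Data.Product.Base using (Σ; ∃; ∃-syntax; _×_; _,_; proj₁; proj₂)
open import Data.Rational.Base as ℚ using (ℚ; 0ℚ; 1ℚ; ½)
import Data.Rational.Properties as ℚ
import Data.Rational.Unnormalised.Base as ℚᵘ
import Data.Rational.Unnormalised.Properties as ℚᵘ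
open import Data.Sum.Base using (_⊎_; inj₁; inj₂)
open import Data.Vec.Functional using (Vector; []; _∷_)
open import Level using (Level; _⊔_)
open import Relation.Binary.PropositionalEquality as ≡ using (_≡_; _≢_)
open import Relation.Nullary using (¬_; yes; no; contradiction)
open import Relation.Nullary.Decidable using (from-yes)

open import Algebra.Bundles using (CommutativeRing)
import Algebra.Properties.CommutativeSemiring.Exp as Exp
import Data.Rational.Solver as ℚ-Solver
import Relation.Binary.Reasoning.Setoid as SetoidReasoning

-- The two excluded pairs are those for which `y` would have to be lightest after the step; but `y`
-- and `z` are only rescaled by the step, so w(z) < w(y) persists. Of the remaining four pairs two
-- have `z` lightest and two have `x` lightest. The latter case is the tight one: `x + y` is about
-- twice as large as `x`, yet its norm has to lie below that of `z`, and that of `z` below that of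
-- `x`, so 2 (u₁ + u₂)² < u₃² < u₁². Hence `u₂` is negative there. The elements u ζ + v fill only a
-- plane over ℚ, whereas a point of Δ_K needs three independent elements; so `z` is moved off the
-- plane by a tiny rational multiple of a third basis element. The order of the reals is not
-- decidable here, so every estimate is a strict inequality with a rational margin. The margins are
-- fixed one after another: the factor `κ`, the tolerance `ν` of real sizes, the Newton accuracy
-- `ε`, the perturbation `τ`.

private variable
  c ℓ₁ ℓ₂ ℓ₃ : Level

Matrix : Set
Matrix = Fin 3 → Fin 3 → ℚ

𝟙 : Matrix
𝟙 0F 0F = 1ℚ
𝟙 1F 1F = 1ℚ
𝟙 2F 2F = 1ℚ
𝟙 _  _  = 0ℚ

-- Determinants of 3 by 3 rational matrices

module Determinant where
  open import Data.Rational.Base using (_+_; _*_; _-_; ∣_∣; _≤_)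
  open ℚ-Solver.+-*-Solver

  infixl 7 _⊗_
  _⊗_ : Matrix → Matrix → Matrix
  (A ⊗ B) i k = A i 0F * B 0F k + A i 1F * B 1F k + A i 2F * B 2F k

  det₃-cong : ∀ {A B : Matrix} → (∀ i j → A i j ≡ B i j) → det₃ A ≡ det₃ B
  det₃-cong e
    rewrite e 0F 0F | e 0F 1F | e 0F 2F
          | e 1F 0F | e 1F 1F | e 1F 2F
          | e 2F 0F | e 2F 1F | e 2F 2F = ≡.refl

  private
    det : ∀ {n} (a b c d e f g h i : Polynomial n) → Polynomial n
    det a b c d e f g h i = a :* (e :* i :- f :* h) :- b :* (d :* i :- f :* g) :+ c :* (d :* h :- e :* g)

  det₃-⊗ : ∀ A B → det₃ (A ⊗ B) ≡ det₃ A * det₃ B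
  det₃-⊗ A B = solve 18 (λ a b c d e f g h i a′ b′ c′ d′ e′ f′ g′ h′ i′ →
    det (a :* a′ :+ b :* d′ :+ c :* g′) (a :* b′ :+ b :* e′ :+ c :* h′) (a :* c′ :+ b :* f′ :+ c :* i′)
        (d :* a′ :+ e :* d′ :+ f :* g′) (d :* b′ :+ e :* e′ :+ f :* h′) (d :* c′ :+ e :* f′ :+ f :* i′)
        (g :* a′ :+ h :* d′ :+ i :* g′) (g :* b′ :+ h :* e′ :+ i :* h′) (g :* c′ :+ h :* f′ :+ i :* i′)
    := det a b c d e f g h i :* det a′ b′ c′ d′ e′ f′ g′ h′ i′) ≡.refl
    (A 0F 0F) (A 0F 1F) (A 0F 2F) (A 1F 0F) (A 1F 1F) (A 1F 2F) (A 2F 0F) (A 2F 1F) (A 2F 2F)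
    (B 0F 0F) (B 0F 1F) (B 0F 2F) (B 1F 0F) (B 1F 1F) (B 1F 2F) (B 2F 0F) (B 2F 1F) (B 2F 2F)

  -- Up to sign these and `det₃` are the coefficients of the characteristic polynomial, the
  -- elementary symmetric functions of the eigenvalues.
  trace minors : Matrix → ℚ
  trace A  = A 0F 0F + A 1F 1F + A 2F 2F
  minors A = (A 1F 1F * A 2F 2F - A 1F 2F * A 2F 1F)
           + (A 0F 0F * A 2F 2F - A 0F 2F * A 2F 0F)
           + (A 0F 0F * A 1F 1F - A 0F 1F * A 1F 0F)

  det₃-affine : ∀ A u v → det₃ (λ i j → u * A i j + v * 𝟙 i j) ≡
    u * u * u * det₃ A + u * u * v * minors A + u * v * v * trace A + v * v * v
  det₃-affine A u v = solve 11 (λ u v a b c d e f g h i →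
    let 1′ = v :* con 1ℚ ; 0′ = v :* con 0ℚ in
    det (u :* a :+ 1′) (u :* b :+ 0′) (u :* c :+ 0′)
        (u :* d :+ 0′) (u :* e :+ 1′) (u :* f :+ 0′)
        (u :* g :+ 0′) (u :* h :+ 0′) (u :* i :+ 1′)
    := u :* u :* u :* det a b c d e f g h i
    :+ u :* u :* v :* ((e :* i :- f :* h) :+ (a :* i :- c :* g) :+ (a :* e :- b :* d))
    :+ u :* v :* v :* (a :+ e :+ i) :+ v :* v :* v) ≡.refl u v
    (A 0F 0F) (A 0F 1F) (A 0F 2F) (A 1F 0F) (A 1F 1F) (A 1F 2F) (A 2F 0F) (A 2F 1F) (A 2F 2F)

  private
    rows : (A B C : Matrix) → Matrix
    rows A B C 0F = A 0F
    rows A B C 1F = B 1F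
    rows A B C 2F = C 2F

    det₃-+ : ∀ A B τ → det₃ (λ i j → A i j + τ * B i j) ≡
      det₃ A + τ * ((det₃ (rows B A A) + det₃ (rows A B A) + det₃ (rows A A B))
             + τ * ((det₃ (rows B B A) + det₃ (rows B A B) + det₃ (rows A B B)) + τ * det₃ B))
    det₃-+ A B τ = solve 19 (λ a b c d e f g h i a′ b′ c′ d′ e′ f′ g′ h′ i′ τ →
      det (a :+ τ :* a′) (b :+ τ :* b′) (c :+ τ :* c′)
          (d :+ τ :* d′) (e :+ τ :* e′) (f :+ τ :* f′)
          (g :+ τ :* g′) (h :+ τ :* h′) (i :+ τ :* i′)
      := det a b c d e f g h i
      :+ τ :* ((det a′ b′ c′ d e f g h i :+ det a b c d′ e′ f′ g h i :+ det a b c d e f g′ h′ i′)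
      :+ τ :* ((det a′ b′ c′ d′ e′ f′ g h i :+ det a′ b′ c′ d e f g′ h′ i′ :+ det a b c d′ e′ f′ g′ h′ i′)
      :+ τ :* det a′ b′ c′ d′ e′ f′ g′ h′ i′))) ≡.refl
      (A 0F 0F) (A 0F 1F) (A 0F 2F) (A 1F 0F) (A 1F 1F) (A 1F 2F) (A 2F 0F) (A 2F 1F) (A 2F 2F)
      (B 0F 0F) (B 0F 1F) (B 0F 2F) (B 1F 0F) (B 1F 1F) (B 1F 2F) (B 2F 0F) (B 2F 1F) (B 2F 2F) τ

    *-bound : ∀ {τ} x → 0ℚ ≤ τ → τ ≤ 1ℚ → ∣ τ * x ∣ ≤ ∣ x ∣
    *-bound {τ} x 0≤τ τ≤1 = begin
      ∣ τ * x ∣     ≡⟨ ℚ.∣p*q∣≡∣p∣*∣q∣ τ x ⟩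
      ∣ τ ∣ * ∣ x ∣ ≡⟨ ≡.cong (_* ∣ x ∣) (ℚ.0≤p⇒∣p∣≡p 0≤τ) ⟩
      τ * ∣ x ∣     ≤⟨ ℚ.*-monoʳ-≤-nonNeg ∣ x ∣ {{ℚ.nonNegative (ℚ.0≤∣p∣ x)}} τ≤1 ⟩
      1ℚ * ∣ x ∣    ≡⟨ ℚ.*-identityˡ ∣ x ∣ ⟩
      ∣ x ∣         ∎
      where open ℚ.≤-Reasoning

  -- By multilinearity in the rows the determinant is a cubic in `τ`, and its increment divided by
  -- `τ` is a quadratic, bounded on [0, 1] by the absolute values of its coefficients. The bound
  -- precedes `τ` because `τ` will be chosen depending on `C`.
  det₃-lipschitz : ∀ A B → ∃[ C ] ∀ τ → 0ℚ ≤ τ → τ ≤ 1ℚ →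
    ∃[ r ] det₃ (λ i j → A i j + τ * B i j) ≡ det₃ A + τ * r × ∣ r ∣ ≤ C
  det₃-lipschitz A B = ∣ c₁ ∣ + (∣ c₂ ∣ + ∣ c₃ ∣) , λ τ 0≤τ τ≤1 →
    c₁ + τ * (c₂ + τ * c₃) , det₃-+ A B τ , (begin
      ∣ c₁ + τ * (c₂ + τ * c₃) ∣     ≤⟨ ℚ.∣p+q∣≤∣p∣+∣q∣ c₁ _ ⟩
      ∣ c₁ ∣ + ∣ τ * (c₂ + τ * c₃) ∣ ≤⟨ ℚ.+-monoʳ-≤ ∣ c₁ ∣ (*-bound _ 0≤τ τ≤1) ⟩
      ∣ c₁ ∣ + ∣ c₂ + τ * c₃ ∣       ≤⟨ ℚ.+-monoʳ-≤ ∣ c₁ ∣ (ℚ.∣p+q∣≤∣p∣+∣q∣ c₂ _) ⟩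
      ∣ c₁ ∣ + (∣ c₂ ∣ + ∣ τ * c₃ ∣) ≤⟨ ℚ.+-monoʳ-≤ ∣ c₁ ∣ (ℚ.+-monoʳ-≤ ∣ c₂ ∣ (*-bound c₃ 0≤τ τ≤1)) ⟩
      ∣ c₁ ∣ + (∣ c₂ ∣ + ∣ c₃ ∣)     ∎)
    where
    open ℚ.≤-Reasoning
    c₁ = det₃ (rows B A A) + det₃ (rows A B A) + det₃ (rows A A B)
    c₂ = det₃ (rows B B A) + det₃ (rows B A B) + det₃ (rows A B B)
    c₃ = det₃ B

-- Rational inequalities and the norm identity behind the Newton step

module RationalProperties where
  open import Data.Rational.Base using (_+_; _*_; _-_; -_; ∣_∣; _≤_; _/_)
  open ℚ-Solver.+-*-Solver

  subtract-add : ∀ x y → x ≡ (x - y) + y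
  subtract-add = solve 2 (λ x y → x := (x :- y) :+ y) ≡.refl

  p≤∣p∣ : ∀ p → p ≤ ∣ p ∣
  p≤∣p∣ p with ℚ.≤-total 0ℚ p
  ... | inj₁ 0≤p = ℚ.≤-reflexive (≡.sym (ℚ.0≤p⇒∣p∣≡p 0≤p))
  ... | inj₂ p≤0 = ℚ.≤-trans p≤0 (ℚ.0≤∣p∣ p)

  ∣∣-pos : ∀ {a} → a ≢ 0ℚ → 0ℚ ℚ.< ∣ a ∣
  ∣∣-pos {a} a≢0 with 0ℚ ℚ.<? ∣ a ∣
  ... | yes 0<∣a∣ = 0<∣a∣
  ... | no 0≮∣a∣  = contradiction (ℚ.∣p∣≡0⇒p≡0 a (ℚ.≤-antisym (ℚ.≮⇒≥ 0≮∣a∣) (ℚ.0≤∣p∣ a))) a≢0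

  reciprocal-* : ∀ {a} → a ≢ 0ℚ → reciprocal a * a ≡ 1ℚ
  reciprocal-* {a} a≢0 with a ℚ.≟ 0ℚ
  ... | yes a≡0 = contradiction a≡0 a≢0
  ... | no a≢0′ = ℚ.*-inverseˡ a {{ℚ.≢-nonZero a≢0′}}

  reciprocal-inverse : ∀ {a} → 0ℚ ℚ.< a → reciprocal a * a ≡ 1ℚ × 0ℚ ℚ.< reciprocal a
  reciprocal-inverse {a} 0<a = ra≡1 , ℚ.*-cancelʳ-<-nonNeg a {{ℚ.nonNegative (ℚ.<⇒≤ 0<a)}}
    (≡.subst₂ ℚ._<_ (≡.sym (ℚ.*-zeroˡ a)) (≡.sym ra≡1) (ℚ.positive⁻¹ 1ℚ))
    where ra≡1 = reciprocal-* (λ a≡0 → ℚ.<-irrefl (≡.sym a≡0) 0<a)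

  *-pos-pos : ∀ {a b} → 0ℚ ℚ.< a → 0ℚ ℚ.< b → 0ℚ ℚ.< a * b
  *-pos-pos {a} {b} 0<a 0<b = ≡.subst (ℚ._< a * b) (ℚ.*-zeroˡ b) (ℚ.*-monoˡ-<-pos b {{ℚ.positive 0<b}} 0<a)

  -- Multiply the hypothesis by |x| / (|x y| |x z|). In the application `x` is the norm at the index
  -- shared by the two pairs on which `v` is compared.
  reciprocal-mono : ∀ {κ x y z} → x ≢ 0ℚ → y ≢ 0ℚ → z ≢ 0ℚ → κ * ∣ z ∣ ℚ.< ∣ y ∣ →
    κ * reciprocal ∣ x * y ∣ ℚ.< reciprocal ∣ x * z ∣
  reciprocal-mono {κ} {x} {y} {z} x≢0 y≢0 z≢0 κz<y = ≡.subst₂ ℚ._<_ lhs rhs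
    (ℚ.*-monoʳ-<-pos (g * g′ * ∣ x ∣) {{ℚ.positive (*-pos-pos (*-pos-pos (proj₂ gy) (proj₂ gz)) (∣∣-pos x≢0))}} κz<y)
    where
    g g′ : ℚ
    g  = reciprocal ∣ x * y ∣
    g′ = reciprocal ∣ x * z ∣
    ∣∣-* : ∀ {y} → y ≢ 0ℚ → 0ℚ ℚ.< ∣ x * y ∣
    ∣∣-* {y} y≢0 = ≡.subst (0ℚ ℚ.<_) (≡.sym (ℚ.∣p*q∣≡∣p∣*∣q∣ x y)) (*-pos-pos (∣∣-pos x≢0) (∣∣-pos y≢0))
    gy = reciprocal-inverse (∣∣-* y≢0)
    gz = reciprocal-inverse (∣∣-* z≢0)
    gxy≡1 : g * (∣ x ∣ * ∣ y ∣) ≡ 1ℚ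
    gxy≡1 = ≡.trans (≡.cong (g *_) (≡.sym (ℚ.∣p*q∣≡∣p∣*∣q∣ x y))) (proj₁ gy)
    gxz≡1 : g′ * (∣ x ∣ * ∣ z ∣) ≡ 1ℚ
    gxz≡1 = ≡.trans (≡.cong (g′ *_) (≡.sym (ℚ.∣p*q∣≡∣p∣*∣q∣ x z))) (proj₁ gz)
    lhs : g * g′ * ∣ x ∣ * (κ * ∣ z ∣) ≡ κ * g
    lhs = ≡.trans (solve 5 (λ g h x z k → g :* h :* x :* (k :* z) := k :* g :* (h :* (x :* z))) ≡.refl g g′ ∣ x ∣ ∣ z ∣ κ)
      (≡.trans (≡.cong (κ * g *_) gxz≡1) (ℚ.*-identityʳ (κ * g)))
    rhs : g * g′ * ∣ x ∣ * ∣ y ∣ ≡ g′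
    rhs = ≡.trans (solve 4 (λ g h x y → g :* h :* x :* y := h :* (g :* (x :* y))) ≡.refl g g′ ∣ x ∣ ∣ y ∣)
      (≡.trans (≡.cong (g′ *_) gxy≡1) (ℚ.*-identityʳ g′))

  ∣+∣-upper : ∀ X {r} → ∣ r ∣ ℚ.< 1ℚ → ∣ X + r ∣ ≤ ∣ X ∣ + 1ℚ
  ∣+∣-upper X {r} ∣r∣<1 = ℚ.≤-trans (ℚ.∣p+q∣≤∣p∣+∣q∣ X r) (ℚ.+-monoʳ-≤ ∣ X ∣ (ℚ.<⇒≤ ∣r∣<1))

  ∣+∣-lower : ∀ X {r} → ∣ r ∣ ℚ.< 1ℚ → ∣ X ∣ - 1ℚ ≤ ∣ X + r ∣
  ∣+∣-lower X {r} ∣r∣<1 = begin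
    ∣ X ∣ - 1ℚ                  ≡⟨ ≡.cong (λ x → ∣ x ∣ - 1ℚ) (solve 2 (λ X r → X := (X :+ r) :+ (:- r)) ≡.refl X r) ⟩
    ∣ (X + r) + (- r) ∣ - 1ℚ    ≤⟨ ℚ.+-monoˡ-≤ (- 1ℚ) (ℚ.∣p+q∣≤∣p∣+∣q∣ (X + r) (- r)) ⟩
    ∣ X + r ∣ + ∣ - r ∣ - 1ℚ    ≡⟨ ≡.cong (λ x → ∣ X + r ∣ + x - 1ℚ) (ℚ.∣-p∣≡∣p∣ r) ⟩
    ∣ X + r ∣ + ∣ r ∣ - 1ℚ      ≤⟨ ℚ.+-monoˡ-≤ (- 1ℚ) (ℚ.+-monoʳ-≤ ∣ X + r ∣ (ℚ.<⇒≤ ∣r∣<1)) ⟩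
    ∣ X + r ∣ + 1ℚ - 1ℚ         ≡⟨ solve 1 (λ x → x :+ con 1ℚ :- con 1ℚ := x) ≡.refl ∣ X + r ∣ ⟩
    ∣ X + r ∣                   ∎
    where open ℚ.≤-Reasoning

  ∣+∣-< : ∀ {x y a b} → ∣ x ∣ ℚ.< a → ∣ y ∣ ℚ.< b → ∣ x + y ∣ ℚ.< a + b
  ∣+∣-< {x} {y} x<a y<b = ℚ.≤-<-trans (ℚ.∣p+q∣≤∣p∣+∣q∣ x y) (ℚ.+-mono-< x<a y<b)

  ∣*∣-< : ∀ {x y a b} → ∣ x ∣ ℚ.< a → ∣ y ∣ ℚ.< b → ∣ x * y ∣ ℚ.< a * b
  ∣*∣-< {x} {y} {a} {b} x<a y<b = begin-strict
    ∣ x * y ∣     ≡⟨ ℚ.∣p*q∣≡∣p∣*∣q∣ x y ⟩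
    ∣ x ∣ * ∣ y ∣ ≤⟨ ℚ.*-monoˡ-≤-nonNeg ∣ x ∣ {{ℚ.nonNegative (ℚ.0≤∣p∣ x)}} (ℚ.<⇒≤ y<b) ⟩
    ∣ x ∣ * b     <⟨ ℚ.*-monoˡ-<-pos b {{ℚ.positive (ℚ.≤-<-trans (ℚ.0≤∣p∣ y) y<b)}} x<a ⟩
    a * b         ∎
    where open ℚ.≤-Reasoning

  module _ (n s t c k H : ℚ) where
    private
      2ℚ 3ℚ D G Q l N : ℚ
      2ℚ = + 2 / 1
      3ℚ = + 3 / 1
      D = n - c * s + c * c * t - c * c * c
      G = s - 2ℚ * c * t + 3ℚ * c * c
      Q = t - 3ℚ * c
      l = k * (- c)
      N = D * H

    -- Let ω have norm, minor sum and trace `n`, `s`, `t`; then `D`, `G`, `Q` are those of ω - c,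
    -- and U ω + V = u k (ω - c) + v. The norm is a cubic form in u k and v with these coefficients,
    -- and k = G / D makes the coefficients of u³ and u² v equal, which produces the factor u² (u +
    -- v).
    newton-identity : k * D ≡ G → k * D * H ≡ 1ℚ → ∀ u v → let U = u * k ; V = u * l + v in
      U * U * U * n + U * U * V * s + U * V * V * t + V * V * V
      ≡ G * k * k * (u * u * (u + v) + (u * v * v * (Q * N * H) + v * v * v * (N * N * H)))
    newton-identity kD≡G kDH≡1 u v = begin
      _ ≡⟨ solve 7 (λ n s t c k u v →
             let U = u :* k ; V = u :* (k :* (:- c)) :+ v
                 D = n :- c :* s :+ c :* c :* t :- c :* c :* c
                 G = s :- con 2ℚ :* c :* t :+ con 3ℚ :* c :* c
                 Q = t :- con 3ℚ :* c in
             U :* U :* U :* n :+ U :* U :* V :* s :+ U :* V :* V :* t :+ V :* V :* V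
             := k :* k :* k :* D :* u :* u :* u :+ k :* k :* G :* u :* u :* v
             :+ con 1ℚ :* con 1ℚ :* k :* Q :* u :* v :* v :+ con 1ℚ :* con 1ℚ :* con 1ℚ :* v :* v :* v)
             ≡.refl n s t c k u v ⟩
      -- Writing 1 as `k * D * H` in the last two terms brings out the common factor and leaves a
      -- polynomial identity, although `H` is an inverse.
      expanded G 1ℚ ≡⟨ ≡.cong₂ expanded kD≡G kDH≡1 ⟨
      expanded (k * D) (k * D * H) ≡⟨ solve 6 (λ D Q k H u v → let N = D :* H in
             k :* k :* k :* D :* u :* u :* u :+ k :* k :* (k :* D) :* u :* u :* v
             :+ (k :* D :* H) :* (k :* D :* H) :* k :* Q :* u :* v :* v
             :+ (k :* D :* H) :* (k :* D :* H) :* (k :* D :* H) :* v :* v :* v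
             := (k :* D) :* k :* k :* (u :* u :* (u :+ v) :+ (u :* v :* v :* (Q :* N :* H) :+ v :* v :* v :* (N :* N :* H))))
             ≡.refl D Q k H u v ⟩
      (k * D) * k * k * (u * u * (u + v) + (u * v * v * (Q * N * H) + v * v * v * (N * N * H)))
        ≡⟨ ≡.cong (λ G → G * k * k * (u * u * (u + v) + (u * v * v * (Q * N * H) + v * v * v * (N * N * H)))) kD≡G ⟩
      _ ∎
      where
      open ≡.≡-Reasoning
      expanded : ℚ → ℚ → ℚ
      expanded G p = k * k * k * D * u * u * u + k * k * G * u * u * v + p * p * k * Q * u * v * v + p * p * p * v * v * v

-- Two-sided bounds and rational powers in the reals

module RealProperties (ℝ : RealNumbers c ℓ₁ ℓ₂) where
  open Real ℝ public
  open RationalProperties using (p≤∣p∣)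
  open Solver public using (solve; _:=_; _:+_; _:*_; _:-_; :-_; con)
  open Exp (CommutativeRing.commutativeSemiring commutativeRing) public using (^-distrib-*; ^-congˡ)

  <-by : ∀ {x y e} → 0# < e → y - x ≈ e → x < y
  <-by 0<e y-x≈e = 0<-⇒< (<-respʳ-≈ (sym y-x≈e) 0<e)

  ≤-respˡ-≈ : ∀ {x y z} → x ≈ y → x ≤ z → y ≤ z
  ≤-respˡ-≈ x≈y x≤z z<y = x≤z (<-respʳ-≈ (sym x≈y) z<y)

  ≤-respʳ-≈ : ∀ {x y z} → x ≈ y → z ≤ x → z ≤ y
  ≤-respʳ-≈ x≈y z≤x y<z = z≤x (<-respˡ-≈ (sym x≈y) y<z)

  ≤-reflexive : ∀ {x y} → x ≈ y → x ≤ y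
  ≤-reflexive x≈y = ≤-respʳ-≈ x≈y ≤-refl

  +-mono-< : ∀ {x y u v} → x < y → u < v → x + u < y + v
  +-mono-< {x} {y} {u} {v} x<y u<v = <-by (+-pos (<⇒0<- x<y) (<⇒0<- u<v))
    (solve 4 (λ x y u v → (y :+ v) :- (x :+ u) := (y :- x) :+ (v :- u)) refl x y u v)

  ι-cancel-< : ∀ {a b} → ι a < ι b → a ℚ.< b
  ι-cancel-< {a} {b} ιa<ιb with a ℚ.<? b
  ... | yes a<b = a<b
  ... | no a≮b  = contradiction ιa<ιb (ι-mono-≤ (ℚ.≮⇒≥ a≮b))

  ι-0 : ∀ {a} → a ≡ 0ℚ → ι a ≈ 0#
  ι-0 ≡.refl = ι.0#-homo

  infix 4 _∈±_
  -- Stands for |x| < a. Two strict inequalities avoid a distinction by sign and are stable under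
  -- sums and products by ring identities.
  _∈±_ : Carrier → Carrier → Set ℓ₂
  x ∈± a = x < a × - x < a

  ±-resp-≈ : ∀ {x y a} → x ≈ y → x ∈± a → y ∈± a
  ±-resp-≈ x≈y (x<a , -x<a) = <-respˡ-≈ x≈y x<a , <-respˡ-≈ (-‿cong x≈y) -x<a

  ±-weaken : ∀ {x a b} → a ≤ b → x ∈± a → x ∈± b
  ±-weaken a≤b (x<a , -x<a) = <-≤-trans x<a a≤b , <-≤-trans -x<a a≤b

  ±-+ : ∀ {x y a b} → x ∈± a → y ∈± b → x + y ∈± a + b
  ±-+ {x} {y} (x<a , -x<a) (y<b , -y<b) = +-mono-< x<a y<b ,
    <-respˡ-≈ (solve 2 (λ x y → :- x :+ :- y := :- (x :+ y)) refl x y) (+-mono-< -x<a -y<b)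

  -- ab ∓ xy is half of (a - x)(b ± y) + (a + x)(b ∓ y).
  ±-* : ∀ {x y a b} → x ∈± a → y ∈± b → x * y ∈± a * b
  ±-* {x} {y} {a} {b} (x<a , -x<a) (y<b , -y<b) =
    <-by (*-pos (ι-pos 0<½) (+-pos (*-pos a-x b+y) (*-pos a+x b-y)))
      (solve 4 (λ x y a b → a :* b :- x :* y :=
        con ½ :* ((a :- x) :* (b :- :- y) :+ (a :- :- x) :* (b :- y))) refl x y a b) ,
    <-by (*-pos (ι-pos 0<½) (+-pos (*-pos a-x b-y) (*-pos a+x b+y)))
      (solve 4 (λ x y a b → a :* b :- :- (x :* y) :=
        con ½ :* ((a :- x) :* (b :- y) :+ (a :- :- x) :* (b :- :- y))) refl x y a b)
    where
    0<½ : 0ℚ ℚ.< ½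
    0<½ = ℚ.positive⁻¹ ½
    a-x = <⇒0<- x<a
    a+x = <⇒0<- -x<a
    b-y = <⇒0<- y<b
    b+y = <⇒0<- -y<b

  ±-ι : ∀ {x a} → ℚ.∣ x ∣ ℚ.< a → ι x ∈± ι a
  ±-ι {x} {a} ∣x∣<a = ι-mono-< (ℚ.≤-<-trans (p≤∣p∣ x) ∣x∣<a) ,
    <-respˡ-≈ (ι.-‿homo x) (ι-mono-< (ℚ.≤-<-trans (ℚ.≤-trans (p≤∣p∣ (ℚ.- x)) (ℚ.≤-reflexive (ℚ.∣-p∣≡∣p∣ x))) ∣x∣<a))

  ±-ι⁻¹ : ∀ {x a} → ι x ∈± ι a → ℚ.∣ x ∣ ℚ.< a
  ±-ι⁻¹ {x} {a} (x<a , -x<a) with ℚ.∣p∣≡p∨∣p∣≡-p x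
  ... | inj₁ e = ≡.subst (ℚ._< a) (≡.sym e) (ι-cancel-< x<a)
  ... | inj₂ e = ≡.subst (ℚ._< a) (≡.sym e) (ι-cancel-< (<-respˡ-≈ (sym (ι.-‿homo x)) -x<a))

  bounded : ∀ x → ∃[ R ] 0ℚ ℚ.≤ R × x ∈± ι R
  bounded x =
    let a , x<a , _  = ι-dense (x<x+1 x)
        b , -x<b , _ = ι-dense (x<x+1 (- x))
    in a ℚ.⊔ b ℚ.⊔ 0ℚ , ℚ.p≤q⊔p (a ℚ.⊔ b) 0ℚ ,
       <-≤-trans x<a (ι-mono-≤ (ℚ.≤-trans (ℚ.p≤p⊔q a b) (ℚ.p≤p⊔q (a ℚ.⊔ b) 0ℚ))) ,
       <-≤-trans -x<b (ι-mono-≤ (ℚ.≤-trans (ℚ.p≤q⊔p a b) (ℚ.p≤p⊔q (a ℚ.⊔ b) 0ℚ)))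

  small : ∀ {K η} → 0# ≤ K → 0# < η → ∃[ δ ] 0ℚ ℚ.< δ × ι δ * K < η
  small {K} {η} 0≤K 0<η =
    let δ , 0<δ , 0+δK<η = modulus {K} {0#} {η} 0≤K 0<η
        d , 0<d , d<δ    = ι-dense 0<δ
    in d , ι-cancel-< (<-respˡ-≈ (sym ι.0#-homo) 0<d) ,
       ≤-<-trans (*-monoʳ-≤ 0≤K (<⇒≤ d<δ)) (<-respˡ-≈ (+-identityˡ _) 0+δK<η)

  inverse-pos : ∀ {x} (0<x : 0# < x) → 0# < inverse x 0<x
  inverse-pos {x} 0<x = *-cancel-pos (<-respʳ-≈ (sym (inverse-* x 0<x)) 0<1) (<⇒≤ 0<x)

  *-inverse-cancel : ∀ {x y z w} → x * y ≈ 1# → z * x ≈ w → z ≈ w * y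
  *-inverse-cancel {x} {y} {z} {w} xy≈1 zx≈w = begin
    z           ≈⟨ *-identityʳ z ⟨
    z * 1#      ≈⟨ *-congˡ xy≈1 ⟨
    z * (x * y) ≈⟨ *-assoc z x y ⟨
    z * x * y   ≈⟨ *-congʳ zx≈w ⟩
    w * y       ∎
    where open SetoidReasoning setoid

  1≤^ : ∀ n {x} → 1# ≤ x → 1# ≤ x ^ n
  1≤^ ℕ.zero    1≤x = ≤-refl
  1≤^ (ℕ.suc n) 1≤x = ≤-trans 1≤x (≤-respˡ-≈ (*-identityʳ _)
    (*-monoˡ-≤ (≤-trans (<⇒≤ 0<1) 1≤x) (1≤^ n 1≤x)))

  power-pos : ∀ x (0<x : 0# < x) p q .{{_ : NonZero q}} → 0# < power x 0<x p q
  power-pos x 0<x p q = proj₁ (proj₂ (root-∃ q (x ^ p) (^-pos p 0<x)))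

  power-^ : ∀ x (0<x : 0# < x) p q .{{_ : NonZero q}} → power x 0<x p q ^ q ≈ x ^ p
  power-^ x 0<x p q = proj₂ (proj₂ (root-∃ q (x ^ p) (^-pos p 0<x)))

  -- Raised to the power `q`, a failure would give κ ^ q y ^ p < x ^ p, while κ ≤ κ ^ q because κ ≥
  -- 1 and q ≥ 1. So one `κ` serves for every `q`, and roots disappear from all later comparisons.
  power-mono-≤ : ∀ {x y κ} (0<x : 0# < x) (0<y : 0# < y) p q .{{_ : NonZero q}} →
    1# ≤ κ → x ^ p ≤ κ * y ^ p → power x 0<x p q ≤ κ * power y 0<y p q
  power-mono-≤ {x} {y} {κ} 0<x 0<y p q@(ℕ.suc n) 1≤κ xᵖ≤κyᵖ κY<X =
    xᵖ≤κyᵖ (≤-<-trans (*-monoʳ-≤ (<⇒≤ (^-pos p 0<y)) κ≤κ^q) (<-respˡ-≈ [κY]^q≈ (<-respʳ-≈ (power-^ x 0<x p q)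
      (^-mono-< q 0≤κY κY<X))))
    where
    Y = power y 0<y p q
    0<κ = <-≤-trans 0<1 1≤κ
    0≤κY = <⇒≤ (*-pos 0<κ (power-pos y 0<y p q))
    κ≤κ^q : κ ≤ κ ^ q
    κ≤κ^q = ≤-respˡ-≈ (*-identityʳ κ) (*-monoˡ-≤ (<⇒≤ 0<κ) (1≤^ n 1≤κ))
    [κY]^q≈ : (κ * Y) ^ q ≈ κ ^ q * y ^ p
    [κY]^q≈ = trans (^-distrib-* κ Y q) (*-congˡ (power-^ y 0<y p q))

-- The norm computed from multiplication matrices

module FieldProperties (ℝ : RealNumbers c ℓ₁ ℓ₂) (K : RealCubicField ℝ ℓ₃) where
  open RealProperties ℝ
  open RealCubicField K
  open Determinant
  open RationalProperties

  comb : Vector ℚ 3 → Vector Carrier 3 → Carrier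
  comb a x = ι (a 0F) * x 0F + ι (a 1F) * x 1F + ι (a 2F) * x 2F

  sum≈comb : ∀ a x → sum (λ i → ι (a i) * x i) ≈ comb a x
  sum≈comb a x = trans (+-congˡ (+-congˡ (+-identityʳ _))) (sym (+-assoc _ _ _))

  comb-+ : ∀ a b x → comb (λ i → a i ℚ.+ b i) x ≈ comb a x + comb b x
  comb-+ a b x = trans (+-cong (+-cong (e 0F) (e 1F)) (e 2F))
    (solve 9 (λ x y z a₀ a₁ a₂ b₀ b₁ b₂ →
      (a₀ :+ b₀) :* x :+ (a₁ :+ b₁) :* y :+ (a₂ :+ b₂) :* z
      := (a₀ :* x :+ a₁ :* y :+ a₂ :* z) :+ (b₀ :* x :+ b₁ :* y :+ b₂ :* z))
      refl (x 0F) (x 1F) (x 2F) (ι (a 0F)) (ι (a 1F)) (ι (a 2F)) (ι (b 0F)) (ι (b 1F)) (ι (b 2F)))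
    where e = λ i → *-congʳ {x i} (ι.+-homo (a i) (b i))

  comb-* : ∀ u a x → comb (λ i → u ℚ.* a i) x ≈ ι u * comb a x
  comb-* u a x = trans (+-cong (+-cong (e 0F) (e 1F)) (e 2F))
    (solve 7 (λ u x y z a₀ a₁ a₂ →
      u :* a₀ :* x :+ u :* a₁ :* y :+ u :* a₂ :* z := u :* (a₀ :* x :+ a₁ :* y :+ a₂ :* z))
      refl (ι u) (x 0F) (x 1F) (x 2F) (ι (a 0F)) (ι (a 1F)) (ι (a 2F)))
    where e = λ i → *-congʳ {x i} (ι.*-homo u (a i))

  comb-neg : ∀ a x → comb (λ i → ℚ.- a i) x ≈ - comb a x
  comb-neg a x = trans (+-cong (+-cong (e 0F) (e 1F)) (e 2F))
    (solve 6 (λ x y z a₀ a₁ a₂ → (:- a₀) :* x :+ (:- a₁) :* y :+ (:- a₂) :* z := :- (a₀ :* x :+ a₁ :* y :+ a₂ :* z))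
      refl (x 0F) (x 1F) (x 2F) (ι (a 0F)) (ι (a 1F)) (ι (a 2F)))
    where e = λ i → *-congʳ {x i} (ι.-‿homo (a i))

  coordinates-unique : ∀ a b → comb a basis ≈ comb b basis → ∀ i → a i ≡ b i
  coordinates-unique a b e i = ≡.trans (subtract-add (a i) (b i))
    (≡.trans (≡.cong (ℚ._+ b i) (basis-independent a-b (trans (sum≈comb a-b basis) a-b≈0) i)) (ℚ.+-identityˡ (b i)))
    where
    a-b : Vector ℚ 3
    a-b i = a i ℚ.- b i
    a-b≈0 : comb a-b basis ≈ 0#
    a-b≈0 = trans (comb-+ a (λ i → ℚ.- b i) basis)
      (trans (+-cong e (comb-neg b basis)) (-‿inverseʳ (comb b basis)))

  private
    fromℕ : ℕ → ℚ
    fromℕ ℕ.zero    = 0ℚ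
    fromℕ (ℕ.suc n) = 1ℚ ℚ.+ fromℕ n

    toℚᵘ-fromℕ : ∀ n → ℚ.toℚᵘ (fromℕ n) ℚᵘ.≃ ℚᵘ.mkℚᵘ (ℤ.+ n) 0
    toℚᵘ-fromℕ ℕ.zero    = ℚᵘ.≃-refl
    toℚᵘ-fromℕ (ℕ.suc n) = ℚᵘ.≃-trans (ℚ.toℚᵘ-homo-+ 1ℚ (fromℕ n))
      (ℚᵘ.≃-trans (ℚᵘ.+-congʳ ℚᵘ.1ℚᵘ (toℚᵘ-fromℕ n))
        (ℚᵘ.*≡* (≡.cong (ℤ._* ℤ.+ 1) (≡.cong (λ m → ℤ.1ℤ ℤ.+ m) (ℤ.*-identityʳ (ℤ.+ n))))))

    *-denominator : ∀ n d .(c : Coprime n (ℕ.suc d)) → ℚ.mkℚ (ℤ.+ n) d c ℚ.* fromℕ (ℕ.suc d) ≡ fromℕ n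
    *-denominator n d c = ℚ.toℚᵘ-injective (ℚᵘ.≃-trans (ℚ.toℚᵘ-homo-* q (fromℕ (ℕ.suc d)))
      (ℚᵘ.≃-trans (ℚᵘ.*-congˡ {ℚ.toℚᵘ q} (toℚᵘ-fromℕ (ℕ.suc d)))
        (ℚᵘ.≃-trans (ℚᵘ.*≡* lemma) (ℚᵘ.≃-sym (toℚᵘ-fromℕ n)))))
      where
      q = ℚ.mkℚ (ℤ.+ n) d c
      lemma : (ℤ.+ n ℤ.* ℤ.+ ℕ.suc d) ℤ.* ℤ.+ 1 ≡ ℤ.+ n ℤ.* ℤ.+ (ℕ.suc d ℕ.* 1)
      lemma = ≡.trans (ℤ.*-assoc (ℤ.+ n) (ℤ.+ ℕ.suc d) (ℤ.+ 1)) (≡.cong (λ m → (ℤ.+ n) ℤ.* m) (≡.sym (ℤ.pos-* (ℕ.suc d) 1)))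

    fromℕ-∈ : ∀ n → Member (ι (fromℕ n))
    fromℕ-∈ ℕ.zero    = ∈-resp-≈ (trans (-‿inverseʳ 1#) (sym ι.0#-homo)) (+-∈ 1-∈ (neg-∈ 1-∈))
    fromℕ-∈ (ℕ.suc n) = ∈-resp-≈ (sym (trans (ι.+-homo 1ℚ (fromℕ n)) (+-congʳ ι.1#-homo))) (+-∈ 1-∈ (fromℕ-∈ n))

    fromℕ-nonneg : ∀ n → 0ℚ ℚ.≤ fromℕ n
    fromℕ-nonneg ℕ.zero    = ℚ.≤-refl
    fromℕ-nonneg (ℕ.suc n) = ℚ.≤-trans (fromℕ-nonneg n)
      (≡.subst (ℚ._≤ 1ℚ ℚ.+ fromℕ n) (ℚ.+-identityˡ (fromℕ n)) (ℚ.+-monoˡ-≤ (fromℕ n) (ℚ.<⇒≤ (ℚ.positive⁻¹ 1ℚ))))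

    fromℕ-suc≉0 : ∀ n → ¬ (ι (fromℕ (ℕ.suc n)) ≈ 0#)
    fromℕ-suc≉0 n e = <-irrefl (sym e) (ι-pos (ℚ.<-≤-trans (ℚ.positive⁻¹ 1ℚ)
      (≡.subst (ℚ._≤ 1ℚ ℚ.+ fromℕ n) (ℚ.+-identityʳ 1ℚ) (ℚ.+-monoʳ-≤ 1ℚ (fromℕ-nonneg n)))))

  -- The field axioms of `Member` yield the prime field: naturals as sums of 1, then a numerator
  -- times the inverse of a denominator, then signs.
  ι-∈ : ∀ q → Member (ι q)
  ι-∈ q@(ℚ.mkℚ (ℤ.+ n) d c) =
    let y , y∈ , xy≈1 = inv-∈ (fromℕ-∈ (ℕ.suc d)) (fromℕ-suc≉0 d)
    in ∈-resp-≈ (sym (*-inverse-cancel xy≈1 (trans (sym (ι.*-homo q (fromℕ (ℕ.suc d)))) (reflexive (≡.cong ι (*-denominator n d c))))))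
      (*-∈ (fromℕ-∈ n) y∈)
  ι-∈ (ℚ.mkℚ (ℤ.-[1+ n ]) d c) = ∈-resp-≈ (sym (ι.-‿homo (ℚ.mkℚ (ℤ.+ ℕ.suc n) d c))) (neg-∈ (ι-∈ (ℚ.mkℚ (ℤ.+ ℕ.suc n) d c)))

  mult : ∀ {x} → Member x → Matrix
  mult {x} x∈K i = proj₁ (basis-spans {x * basis i} (*-∈ x∈K (basis-∈ i)))

  mult-row : ∀ {x} (x∈K : Member x) i → x * basis i ≈ comb (mult x∈K i) basis
  mult-row {x} x∈K i = trans (proj₂ (basis-spans {x * basis i} (*-∈ x∈K (basis-∈ i)))) (sum≈comb (mult x∈K i) basis)

  -- Uniqueness of coordinates identifies `A` with the matrix taken from `basis-spans`, so a norm
  -- may be read off any matrix describing the multiplication.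
  norm-unique : ∀ {x} (x∈K : Member x) A → (∀ i → x * basis i ≈ comb (A i) basis) → norm x∈K ≡ det₃ A
  norm-unique x∈K A e = det₃-cong {mult x∈K} {A}
    (λ i → coordinates-unique (mult x∈K i) (A i) (trans (sym (mult-row x∈K i)) (e i)))

  norm-cong : ∀ {x y} (x∈K : Member x) (y∈K : Member y) → x ≈ y → norm x∈K ≡ norm y∈K
  norm-cong x∈K y∈K x≈y = norm-unique x∈K (mult y∈K) (λ i → trans (*-congʳ x≈y) (mult-row y∈K i))

  -- Rows of `mult` hold coordinates, so expanding x (y b) composes the matrices as `My ⊗ Mx`; hence
  -- the reversed factors.
  norm-* : ∀ {x y} (x∈K : Member x) (y∈K : Member y) (xy∈K : Member (x * y)) →
    norm xy∈K ≡ norm y∈K ℚ.* norm x∈K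
  norm-* {x} {y} x∈K y∈K xy∈K = ≡.trans (norm-unique xy∈K (My ⊗ Mx) row) (det₃-⊗ My Mx)
    where
    Mx = mult x∈K
    My = mult y∈K
    row : ∀ i → x * y * basis i ≈ comb ((My ⊗ Mx) i) basis
    row i = begin
      x * y * basis i                ≈⟨ *-assoc x y (basis i) ⟩
      x * (y * basis i)              ≈⟨ *-congˡ (mult-row y∈K i) ⟩
      x * comb (My i) basis          ≈⟨ solve 7 (λ x m₀ m₁ m₂ b₀ b₁ b₂ →
        x :* (m₀ :* b₀ :+ m₁ :* b₁ :+ m₂ :* b₂) := m₀ :* (x :* b₀) :+ m₁ :* (x :* b₁) :+ m₂ :* (x :* b₂))
        refl x (ι (My i 0F)) (ι (My i 1F)) (ι (My i 2F)) (basis 0F) (basis 1F) (basis 2F) ⟩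
      ι (My i 0F) * (x * basis 0F) + ι (My i 1F) * (x * basis 1F) + ι (My i 2F) * (x * basis 2F)
        ≈⟨ +-cong (+-cong (*-congˡ (mult-row x∈K 0F)) (*-congˡ (mult-row x∈K 1F))) (*-congˡ (mult-row x∈K 2F)) ⟩
      ι (My i 0F) * comb (Mx 0F) basis + ι (My i 1F) * comb (Mx 1F) basis + ι (My i 2F) * comb (Mx 2F) basis
        ≈⟨ trans (comb-+ (λ j → My i 0F ℚ.* Mx 0F j ℚ.+ My i 1F ℚ.* Mx 1F j) (λ j → My i 2F ℚ.* Mx 2F j) basis) (+-cong
             (trans (comb-+ (λ j → My i 0F ℚ.* Mx 0F j) (λ j → My i 1F ℚ.* Mx 1F j) basis) (+-cong
               (comb-* (My i 0F) (Mx 0F) basis) (comb-* (My i 1F) (Mx 1F) basis)))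
             (comb-* (My i 2F) (Mx 2F) basis)) ⟨
      comb ((My ⊗ Mx) i) basis ∎
      where open SetoidReasoning setoid

  private
    1* : ∀ x → ι 1ℚ * x ≈ x
    1* x = trans (*-congʳ ι.1#-homo) (*-identityˡ x)

    0* : ∀ x → ι 0ℚ * x ≈ 0#
    0* x = trans (*-congʳ ι.0#-homo) (zeroˡ x)

  comb-𝟙 : ∀ x i → comb (𝟙 i) x ≈ x i
  comb-𝟙 x 0F = trans (+-cong (+-cong (1* (x 0F)) (0* (x 1F))) (0* (x 2F))) (trans (+-identityʳ _) (+-identityʳ _))
  comb-𝟙 x 1F = trans (+-cong (+-cong (0* (x 0F)) (1* (x 1F))) (0* (x 2F))) (trans (+-identityʳ _) (+-identityˡ _))
  comb-𝟙 x 2F = trans (+-cong (+-cong (0* (x 0F)) (0* (x 1F))) (1* (x 2F))) (trans (+-congʳ (+-identityˡ _)) (+-identityˡ _))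

  norm-1 : (1∈K : Member 1#) → norm 1∈K ≡ 1ℚ
  norm-1 1∈K = norm-unique 1∈K 𝟙 (λ i → trans (*-identityˡ (basis i)) (sym (comb-𝟙 basis i)))

  norm-affine : ∀ {x y} (x∈K : Member x) (y∈K : Member y) u v → y ≈ ι u * x + ι v → let A = mult x∈K in
    norm y∈K ≡ u ℚ.* u ℚ.* u ℚ.* det₃ A ℚ.+ u ℚ.* u ℚ.* v ℚ.* minors A ℚ.+ u ℚ.* v ℚ.* v ℚ.* trace A ℚ.+ v ℚ.* v ℚ.* v
  norm-affine {x} {y} x∈K y∈K u v e = ≡.trans (norm-unique y∈K (λ i j → u ℚ.* A i j ℚ.+ v ℚ.* 𝟙 i j) row) (det₃-affine A u v)
    where
    A = mult x∈K
    row : ∀ i → y * basis i ≈ comb (λ j → u ℚ.* A i j ℚ.+ v ℚ.* 𝟙 i j) basis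
    row i = begin
      y * basis i                     ≈⟨ *-congʳ e ⟩
      (ι u * x + ι v) * basis i       ≈⟨ solve 4 (λ u v x b → (u :* x :+ v) :* b := u :* (x :* b) :+ v :* b) refl (ι u) (ι v) x (basis i) ⟩
      ι u * (x * basis i) + ι v * basis i ≈⟨ +-cong (*-congˡ (mult-row x∈K i)) (*-congˡ (sym (comb-𝟙 basis i))) ⟩
      ι u * comb (A i) basis + ι v * comb (𝟙 i) basis
        ≈⟨ trans (comb-+ (λ j → u ℚ.* A i j) (λ j → v ℚ.* 𝟙 i j) basis) (+-cong (comb-* u (A i) basis) (comb-* v (𝟙 i) basis)) ⟨
      comb (λ j → u ℚ.* A i j ℚ.+ v ℚ.* 𝟙 i j) basis ∎
      where open SetoidReasoning setoid

  norm-lipschitz : ∀ {x y} (x∈K : Member x) (y∈K : Member y) → ∃[ C ] ∀ {z} (z∈K : Member z) τ →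
    0ℚ ℚ.≤ τ → τ ℚ.≤ 1ℚ → z ≈ x + ι τ * y → ∃[ r ] norm z∈K ≡ norm x∈K ℚ.+ τ ℚ.* r × ℚ.∣ r ∣ ℚ.≤ C
  norm-lipschitz {x} {y} x∈K y∈K = proj₁ lip , λ {z} z∈K τ 0≤τ τ≤1 e →
    let r , eq , ∣r∣≤C = proj₂ lip τ 0≤τ τ≤1 in r , ≡.trans (norm-unique z∈K (λ i j → A i j ℚ.+ τ ℚ.* B i j) (row e)) eq , ∣r∣≤C
    where
    A = mult x∈K
    B = mult y∈K
    lip = det₃-lipschitz A B
    row : ∀ {z τ} → z ≈ x + ι τ * y → ∀ i → z * basis i ≈ comb (λ j → A i j ℚ.+ τ ℚ.* B i j) basis
    row {z} {τ} e i = begin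
      z * basis i                     ≈⟨ *-congʳ e ⟩
      (x + ι τ * y) * basis i         ≈⟨ solve 4 (λ x t y b → (x :+ t :* y) :* b := x :* b :+ t :* (y :* b)) refl x (ι τ) y (basis i) ⟩
      x * basis i + ι τ * (y * basis i) ≈⟨ +-cong (mult-row x∈K i) (*-congˡ (mult-row y∈K i)) ⟩
      comb (A i) basis + ι τ * comb (B i) basis
        ≈⟨ trans (comb-+ (A i) (λ j → τ ℚ.* B i j) basis) (+-congˡ (comb-* τ (B i) basis)) ⟨
      comb (λ j → A i j ℚ.+ τ ℚ.* B i j) basis ∎
      where open SetoidReasoning setoid
  -- Cayley-Hamilton: the basis is an eigenvector of `mult x∈K` with eigenvalue `x`, so the
  -- characteristic polynomial at `x` annihilates every basis element and therefore 1.
  norm-root : ∀ {x} (x∈K : Member x) → let A = mult x∈K in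
    x * x * x - ι (trace A) * (x * x) + ι (minors A) * x - ι (det₃ A) ≈ 0#
  norm-root {x} x∈K = begin
    χ ≈⟨ *-identityʳ χ ⟨
    χ * 1# ≈⟨ *-congˡ (trans (proj₂ (basis-spans 1-∈)) (sum≈comb q basis)) ⟩
    χ * comb q basis ≈⟨ solve 7 (λ χ q₀ q₁ q₂ x y z →
      χ :* (q₀ :* x :+ q₁ :* y :+ q₂ :* z) := q₀ :* (χ :* x) :+ q₁ :* (χ :* y) :+ q₂ :* (χ :* z))
      refl χ (ι (q 0F)) (ι (q 1F)) (ι (q 2F)) (basis 0F) (basis 1F) (basis 2F) ⟩
    ι (q 0F) * (χ * basis 0F) + ι (q 1F) * (χ * basis 1F) + ι (q 2F) * (χ * basis 2F)
      ≈⟨ +-cong (+-cong (*-congˡ (χb≈0 0F)) (*-congˡ (χb≈0 1F))) (*-congˡ (χb≈0 2F)) ⟩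
    ι (q 0F) * 0# + ι (q 1F) * 0# + ι (q 2F) * 0# ≈⟨ +-cong (+-cong (zeroʳ _) (zeroʳ _)) (zeroʳ _) ⟩
    0# + 0# + 0# ≈⟨ trans (+-identityʳ _) (+-identityʳ _) ⟩
    0# ∎
    where
    open SetoidReasoning setoid
    A = mult x∈K
    q = proj₁ (basis-spans 1-∈)
    χ = x * x * x - ι (trace A) * (x * x) + ι (minors A) * x - ι (det₃ A)

    a : Fin 3 → Fin 3 → Carrier
    a i j = ι (A i j)

    E : Fin 3 → Carrier
    E i = a i 0F * basis 0F + a i 1F * basis 1F + a i 2F * basis 2F - x * basis i

    E≈0 : ∀ i → E i ≈ 0#
    E≈0 i = trans (+-congʳ (sym (mult-row x∈K i))) (-‿inverseʳ (x * basis i))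

    ι-minor : ∀ i j k l → ι (A i j ℚ.* A k l ℚ.- A i l ℚ.* A k j) ≈ a i j * a k l - a i l * a k j
    ι-minor i j k l = trans (ι.+-homo _ _) (+-cong (ι.*-homo (A i j) (A k l))
      (trans (ι.-‿homo _) (-‿cong (ι.*-homo (A i l) (A k j)))))

    tr mi de : Carrier
    tr = a 0F 0F + a 1F 1F + a 2F 2F
    mi = (a 1F 1F * a 2F 2F - a 1F 2F * a 2F 1F) + (a 0F 0F * a 2F 2F - a 0F 2F * a 2F 0F)
       + (a 0F 0F * a 1F 1F - a 0F 1F * a 1F 0F)
    de = a 0F 0F * (a 1F 1F * a 2F 2F - a 1F 2F * a 2F 1F) - a 0F 1F * (a 1F 0F * a 2F 2F - a 1F 2F * a 2F 0F)
       + a 0F 2F * (a 1F 0F * a 2F 1F - a 1F 1F * a 2F 0F)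

    χ≈ : χ ≈ x * x * x - tr * (x * x) + mi * x - de
    χ≈ = +-cong (+-cong (+-congˡ (-‿cong (*-congʳ tr≈))) (*-congʳ mi≈)) (-‿cong de≈)
      where
      tr≈ = trans (ι.+-homo _ _) (+-congʳ (ι.+-homo _ _))
      mi≈ = trans (ι.+-homo _ _) (+-cong (trans (ι.+-homo _ _) (+-cong (ι-minor 1F 1F 2F 2F) (ι-minor 0F 0F 2F 2F))) (ι-minor 0F 0F 1F 1F))
      de≈ = trans (ι.+-homo _ _) (+-cong
        (trans (ι.+-homo _ _) (+-cong (trans (ι.*-homo _ _) (*-congˡ (ι-minor 1F 1F 2F 2F)))
          (trans (ι.-‿homo _) (-‿cong (trans (ι.*-homo _ _) (*-congˡ (ι-minor 1F 0F 2F 2F)))))))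
        (trans (ι.*-homo _ _) (*-congˡ (ι-minor 1F 0F 2F 1F))))

    vanish : ∀ {y} c₀ c₁ c₂ → y ≈ c₀ * E 0F + c₁ * E 1F + c₂ * E 2F → y ≈ 0#
    vanish c₀ c₁ c₂ e = trans e (trans (+-cong (+-cong
      (trans (*-congˡ (E≈0 0F)) (zeroʳ c₀)) (trans (*-congˡ (E≈0 1F)) (zeroʳ c₁))) (trans (*-congˡ (E≈0 2F)) (zeroʳ c₂)))
      (trans (+-identityʳ _) (+-identityʳ _)))

    -- χ b_k is the k-th row of - adj (A - x) (A - x) b.
    χb≈0 : ∀ k → χ * basis k ≈ 0#
    χb≈0 0F = trans (*-congʳ χ≈) (vanish
      (a 1F 2F * a 2F 1F - (a 1F 1F - x) * (a 2F 2F - x))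
      (a 0F 1F * (a 2F 2F - x) - a 0F 2F * a 2F 1F)
      (a 0F 2F * (a 1F 1F - x) - a 0F 1F * a 1F 2F)
      (solve 13 (λ x a b c d e f g h i y₀ y₁ y₂ →
        (x :* x :* x :- (a :+ e :+ i) :* (x :* x) :+ ((e :* i :- f :* h) :+ (a :* i :- c :* g) :+ (a :* e :- b :* d)) :* x
          :- (a :* (e :* i :- f :* h) :- b :* (d :* i :- f :* g) :+ c :* (d :* h :- e :* g))) :* y₀
        := (f :* h :- (e :- x) :* (i :- x)) :* (a :* y₀ :+ b :* y₁ :+ c :* y₂ :- x :* y₀)
        :+ (b :* (i :- x) :- c :* h) :* (d :* y₀ :+ e :* y₁ :+ f :* y₂ :- x :* y₁)
        :+ (c :* (e :- x) :- b :* f) :* (g :* y₀ :+ h :* y₁ :+ i :* y₂ :- x :* y₂)) refl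
        x (a 0F 0F) (a 0F 1F) (a 0F 2F) (a 1F 0F) (a 1F 1F) (a 1F 2F) (a 2F 0F) (a 2F 1F) (a 2F 2F) (basis 0F) (basis 1F) (basis 2F)))
    χb≈0 1F = trans (*-congʳ χ≈) (vanish
      (a 1F 0F * (a 2F 2F - x) - a 1F 2F * a 2F 0F)
      (a 0F 2F * a 2F 0F - (a 0F 0F - x) * (a 2F 2F - x))
      ((a 0F 0F - x) * a 1F 2F - a 0F 2F * a 1F 0F)
      (solve 13 (λ x a b c d e f g h i y₀ y₁ y₂ →
        (x :* x :* x :- (a :+ e :+ i) :* (x :* x) :+ ((e :* i :- f :* h) :+ (a :* i :- c :* g) :+ (a :* e :- b :* d)) :* x
          :- (a :* (e :* i :- f :* h) :- b :* (d :* i :- f :* g) :+ c :* (d :* h :- e :* g))) :* y₁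
        := (d :* (i :- x) :- f :* g) :* (a :* y₀ :+ b :* y₁ :+ c :* y₂ :- x :* y₀)
        :+ (c :* g :- (a :- x) :* (i :- x)) :* (d :* y₀ :+ e :* y₁ :+ f :* y₂ :- x :* y₁)
        :+ ((a :- x) :* f :- c :* d) :* (g :* y₀ :+ h :* y₁ :+ i :* y₂ :- x :* y₂)) refl
        x (a 0F 0F) (a 0F 1F) (a 0F 2F) (a 1F 0F) (a 1F 1F) (a 1F 2F) (a 2F 0F) (a 2F 1F) (a 2F 2F) (basis 0F) (basis 1F) (basis 2F)))
    χb≈0 2F = trans (*-congʳ χ≈) (vanish
      ((a 1F 1F - x) * a 2F 0F - a 1F 0F * a 2F 1F)
      ((a 0F 0F - x) * a 2F 1F - a 0F 1F * a 2F 0F)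
      (a 0F 1F * a 1F 0F - (a 0F 0F - x) * (a 1F 1F - x))
      (solve 13 (λ x a b c d e f g h i y₀ y₁ y₂ →
        (x :* x :* x :- (a :+ e :+ i) :* (x :* x) :+ ((e :* i :- f :* h) :+ (a :* i :- c :* g) :+ (a :* e :- b :* d)) :* x
          :- (a :* (e :* i :- f :* h) :- b :* (d :* i :- f :* g) :+ c :* (d :* h :- e :* g))) :* y₂
        := ((e :- x) :* g :- d :* h) :* (a :* y₀ :+ b :* y₁ :+ c :* y₂ :- x :* y₀)
        :+ ((a :- x) :* h :- b :* g) :* (d :* y₀ :+ e :* y₁ :+ f :* y₂ :- x :* y₁)
        :+ (b :* d :- (a :- x) :* (e :- x)) :* (g :* y₀ :+ h :* y₁ :+ i :* y₂ :- x :* y₂)) refl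
        x (a 0F 0F) (a 0F 1F) (a 0F 2F) (a 1F 0F) (a 1F 1F) (a 1F 2F) (a 2F 0F) (a 2F 1F) (a 2F 2F) (basis 0F) (basis 1F) (basis 2F)))

-- Error estimates for one Newton step

module NewtonStep (ℝ : RealNumbers c ℓ₁ ℓ₂) where
  open RealProperties ℝ

  2ℚ 3ℚ 32ℚ : ℚ
  2ℚ = + 2 ℚ./ 1
  3ℚ = + 3 ℚ./ 1
  32ℚ = + 32 ℚ./ 1

  2ᴿ 3ᴿ : Carrier
  2ᴿ = ι 2ℚ
  3ᴿ = ι 3ℚ

  -- For a cubic P with root a, and with m = P′(a) and Q = P″(a) / 2, the factors
  -- A and B are P(a + z) / (m z) and P′(a + z) / m.
  record Estimates (m μ Q z η : Carrier) : Set (c ⊔ ℓ₁ ⊔ ℓ₂) where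
    field
      A B A⁻¹ B⁻¹ : Carrier
      mA≈   : m * A ≈ m + Q * z + z * z
      mB≈   : m * B ≈ m + 2ᴿ * (Q * z) + 3ᴿ * (z * z)
      A⁻¹A≈1 : A⁻¹ * A ≈ 1#
      B⁻¹B≈1 : B⁻¹ * B ≈ 1#
      small₁ : z * (μ * (Q + 2ᴿ * z) * A⁻¹) ∈± η
      small₂ : z * (μ * (Q + 3ᴿ * z) * (A * (B⁻¹ * B⁻¹))) ∈± η
      small₃ : z * (z * ((A * A) * (B⁻¹ * B⁻¹ * B⁻¹)) * μ) ∈± η

  private
    ½<1 : ι ½ < 1#
    ½<1 = <-respʳ-≈ ι.1#-homo (ι-mono-< (from-yes (½ ℚ.<? 1ℚ)))

    -- A deviation below 1/2 keeps `A` between 1/2 and 3/2, so `A` and its inverse are both below 2.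
    module Unit {x} (x∈ : x ∈± ι ½) where
      A = 1# + x
      ½<A : ι ½ < A
      ½<A = <-by (<⇒0<- (proj₂ x∈)) (trans (+-congʳ (+-congʳ (sym ι.1#-homo)))
        (solve 1 (λ x → con 1ℚ :+ x :- con ½ := con ½ :- :- x) refl x))
      0<A : 0# < A
      0<A = <-trans (ι-pos (ℚ.positive⁻¹ ½)) ½<A
      A⁻¹ = inverse A 0<A
      A⁻¹A≈1 : A⁻¹ * A ≈ 1#
      A⁻¹A≈1 = inverse-* A 0<A
      0<⇒± : ∀ {y} → 0# < y → y < 2ᴿ → y ∈± 2ᴿ
      0<⇒± {y} 0<y y<2 = y<2 , <-trans (<-by 0<y (solve 1 (λ y → con 0ℚ :- :- y := y) refl y))
        (ι-mono-< (from-yes (0ℚ ℚ.<? 2ℚ)))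
      A∈± : A ∈± 2ᴿ
      A∈± = 0<⇒± 0<A (<-by (+-pos (<⇒0<- (proj₁ x∈)) (ι-pos (ℚ.positive⁻¹ ½)))
        (trans (+-congˡ (-‿cong (+-congʳ (sym ι.1#-homo))))
          (solve 1 (λ x → con 2ℚ :- (con 1ℚ :+ x) := con ½ :- x :+ con ½) refl x)))
      A⁻¹∈± : A⁻¹ ∈± 2ᴿ
      A⁻¹∈± = 0<⇒± (inverse-pos 0<A) (<-by (*-pos (ι-pos (from-yes (0ℚ ℚ.<? 2ℚ))) (*-pos (inverse-pos 0<A) (<⇒0<- ½<A)))
        (trans (+-congʳ (trans (sym (*-identityʳ 2ᴿ)) (*-congˡ (sym A⁻¹A≈1))))
          (solve 2 (λ a b → con 2ℚ :* (b :* a) :- b := con 2ℚ :* (b :* (a :- con ½))) refl A A⁻¹)))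

  module _ {m μ Q : Carrier} (mμ≈1 : m * μ ≈ 1#) where
    private
      R₁ = proj₁ (bounded μ)
      R₂ = proj₁ (bounded Q)
      -- One constant for both |μ| and |Q|. The summand 3 gives ρ + 3 ≤ 2 ρ, which absorbs the terms
      -- k z with k ≤ 3 and z < 1.
      R = R₁ ℚ.+ R₂ ℚ.+ 3ℚ
      ρ = ι R

      3≤R : 3ℚ ℚ.≤ R
      3≤R = ≡.subst (ℚ._≤ R) (ℚ.+-identityˡ 3ℚ) (ℚ.+-monoˡ-≤ 3ℚ
        (ℚ.+-mono-≤ (proj₁ (proj₂ (bounded μ))) (proj₁ (proj₂ (bounded Q)))))
      0≤3 = from-yes (0ℚ ℚ.≤? 3ℚ)

      μ∈± : μ ∈± ρ
      μ∈± = ±-weaken (ι-mono-≤ (≡.subst (ℚ._≤ R) (≡.trans (ℚ.+-identityʳ _) (ℚ.+-identityʳ R₁))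
        (ℚ.+-mono-≤ (ℚ.+-monoʳ-≤ R₁ (proj₁ (proj₂ (bounded Q)))) 0≤3))) (proj₂ (proj₂ (bounded μ)))
      Q∈± : Q ∈± ρ
      Q∈± = ±-weaken (ι-mono-≤ (≡.subst (ℚ._≤ R) (≡.trans (ℚ.+-identityʳ _) (ℚ.+-identityˡ R₂))
        (ℚ.+-mono-≤ (ℚ.+-monoˡ-≤ R₂ (proj₁ (proj₂ (bounded μ)))) 0≤3))) (proj₂ (proj₂ (bounded Q)))

      3≤ρ : 3ᴿ ≤ ρ
      3≤ρ = ι-mono-≤ 3≤R
      1≤ρ : 1# ≤ ρ
      1≤ρ = ≤-respˡ-≈ ι.1#-homo (ι-mono-≤ (ℚ.≤-trans (from-yes (1ℚ ℚ.≤? 3ℚ)) 3≤R))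
      0≤ρ : 0# ≤ ρ
      0≤ρ = ≤-trans (<⇒≤ 0<1) 1≤ρ

    -- The 32 is 2⁵, from A² B⁻³ in the third estimate with each factor below 2; the other estimates
    -- need only 2, 4, 6 and 16 in its place.
    bound : Carrier
    bound = ι 32ℚ * (ρ * ρ)

    private
      0≤ρρ : 0# ≤ ρ * ρ
      0≤ρρ = ≤-respˡ-≈ (zeroˡ ρ) (*-monoʳ-≤ 0≤ρ 0≤ρ)

      1≤bound : 1# ≤ bound
      1≤bound = ≤-trans (≤-respˡ-≈ (*-identityˡ 1#) (≤-trans (*-monoʳ-≤ (<⇒≤ 0<1) 1≤ρ) (*-monoˡ-≤ 0≤ρ 1≤ρ)))
        (≤-respˡ-≈ (trans (*-congʳ ι.1#-homo) (*-identityˡ _)) (*-monoʳ-≤ 0≤ρρ (ι-mono-≤ (from-yes (1ℚ ℚ.≤? 32ℚ)))))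

    0≤bound : 0# ≤ bound
    0≤bound = ≤-trans (<⇒≤ 0<1) 1≤bound

    estimates : ∀ {z η} → 0# < z → z * bound < η → η ≤ ι ½ → Estimates m μ Q z η
    estimates {z} {η} 0<z z*bound<η η≤½ = record
      { A = A ; B = B ; A⁻¹ = A⁻¹ ; B⁻¹ = B⁻¹
      ; mA≈ = factor (Q + z) (solve 3 (λ m Q z → m :+ z :* (Q :+ z) := m :+ Q :* z :+ z :* z) refl m Q z)
      ; mB≈ = factor (2ᴿ * Q + 3ᴿ * z) (solve 3 (λ m Q z → m :+ z :* (con 2ℚ :* Q :+ con 3ℚ :* z)
                := m :+ con 2ℚ :* (Q :* z) :+ con 3ℚ :* (z :* z)) refl m Q z)
      ; A⁻¹A≈1 = A⁻¹A≈1 ; B⁻¹B≈1 = B⁻¹B≈1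
      ; small₁ = z*small 4ℚ (from-yes (4ℚ ℚ.≤? 32ℚ)) (±-* (±-* μ∈± (Q+ 2ℚ (from-yes (0ℚ ℚ.<? 2ℚ)) (from-yes (2ℚ ℚ.≤? 3ℚ)))) A⁻¹∈±)
          (solve 1 (λ r → r :* (con 2ℚ :* r) :* con 2ℚ := con 4ℚ :* (r :* r)) refl ρ)
      ; small₂ = z*small 16ℚ (from-yes (16ℚ ℚ.≤? 32ℚ)) (±-* (±-* μ∈± (Q+ 3ℚ (from-yes (0ℚ ℚ.<? 3ℚ)) ℚ.≤-refl)) (±-* A∈± (±-* B⁻¹∈± B⁻¹∈±)))
          (solve 1 (λ r → r :* (con 2ℚ :* r) :* (con 2ℚ :* (con 2ℚ :* con 2ℚ)) := con 16ℚ :* (r :* r)) refl ρ)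
      -- The inner `z` is bounded by ρ rather than by 1, only to reach a multiple of ρ² as in the
      -- other estimates.
      ; small₃ = z*small 32ℚ ℚ.≤-refl (±-* (±-* (±-weaken 1≤ρ z∈±1) (±-* (±-* A∈± A∈±) (±-* (±-* B⁻¹∈± B⁻¹∈±) B⁻¹∈±))) μ∈±)
          (solve 1 (λ r → r :* ((con 2ℚ :* con 2ℚ) :* (con 2ℚ :* con 2ℚ :* con 2ℚ)) :* r := con 32ℚ :* (r :* r)) refl ρ)
      }
      where
      4ℚ = + 4 ℚ./ 1
      16ℚ = + 16 ℚ./ 1
      6ℚ = + 6 ℚ./ 1
      2∈±3 : 2ᴿ ∈± 3ᴿ
      2∈±3 = ±-ι {2ℚ} {3ℚ} (from-yes (2ℚ ℚ.<? 3ℚ))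

      z<1 : z < 1#
      z<1 = ≤-<-trans (≤-respˡ-≈ (*-identityʳ z) (*-monoˡ-≤ (<⇒≤ 0<z) 1≤bound))
        (<-trans z*bound<η (≤-<-trans η≤½ ½<1))
      -z<0 : - z < 0#
      -z<0 = <-by 0<z (trans (+-congʳ (sym ι.0#-homo)) (solve 1 (λ z → con 0ℚ :- :- z := z) refl z))
      z∈±1 : z ∈± 1#
      z∈±1 = z<1 , <-trans -z<0 0<1

      z*small : ∀ {x b} k → k ℚ.≤ 32ℚ → x ∈± b → b ≈ ι k * (ρ * ρ) → z * x ∈± η
      z*small {x} {b} k k≤32 (x<b , -x<b) b≈ =
        <-trans (<-respˡ-≈ (*-comm x z) (*-monoʳ-< 0<z x<b)) zb<η ,
        <-trans (<-respˡ-≈ (solve 2 (λ x z → (:- x) :* z := :- (z :* x)) refl x z) (*-monoʳ-< 0<z -x<b)) zb<η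
        where
        zb<η : b * z < η
        zb<η = ≤-<-trans (*-monoʳ-≤ (<⇒≤ 0<z) (≤-respˡ-≈ (sym b≈) (*-monoʳ-≤ 0≤ρρ (ι-mono-≤ k≤32))))
          (<-respˡ-≈ (*-comm z bound) z*bound<η)

      ρ+3≤2ρ : ρ + 3ᴿ ≤ 2ᴿ * ρ
      ρ+3≤2ρ 2ρ<ρ+3 = 3≤ρ (<-moveʳ (solve 1 (λ r → r :+ con 3ℚ :- con 2ℚ :* r := con 3ℚ :- r) refl ρ) 2ρ<ρ+3)

      Q+ : ∀ k → 0ℚ ℚ.< k → k ℚ.≤ 3ℚ → Q + ι k * z ∈± 2ᴿ * ρ
      Q+ k 0<k k≤3 = ±-weaken ρ+3≤2ρ (±-+ Q∈± (±-weaken (ι-mono-≤ k≤3)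
        (<-respʳ-≈ (*-identityʳ (ι k)) (<-respˡ-≈ (*-comm z (ι k)) (<-respʳ-≈ (*-comm 1# (ι k)) (*-monoʳ-< (ι-pos 0<k) z<1))) ,
         <-trans (<-respˡ-≈ (solve 2 (λ k z → (:- z) :* k := :- (k :* z)) refl (ι k) z)
           (<-respʳ-≈ (zeroˡ (ι k)) (*-monoʳ-< (ι-pos 0<k) -z<0))) (ι-pos 0<k))))

      α β : Carrier
      α = μ * (Q + z)
      β = μ * (2ᴿ * Q + 3ᴿ * z)
      open Unit (±-weaken η≤½ (z*small {α} 2ℚ (from-yes (2ℚ ℚ.≤? 32ℚ))
        (±-* μ∈± (±-resp-≈ (+-congˡ (trans (*-congʳ ι.1#-homo) (*-identityˡ z))) (Q+ 1ℚ (ℚ.positive⁻¹ 1ℚ) (from-yes (1ℚ ℚ.≤? 3ℚ)))))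
        (solve 1 (λ r → r :* (con 2ℚ :* r) := con 2ℚ :* (r :* r)) refl ρ)))
      open Unit (±-weaken η≤½ (z*small {β} 6ℚ (from-yes (6ℚ ℚ.≤? 32ℚ))
        (±-* μ∈± (±-resp-≈ (solve 2 (λ Q z → con 2ℚ :* (Q :+ con (3ℚ ℚ.* ½) :* z) := con 2ℚ :* Q :+ con 3ℚ :* z) refl Q z)
          (±-* 2∈±3 (Q+ (3ℚ ℚ.* ½) (from-yes (0ℚ ℚ.<? 3ℚ ℚ.* ½)) (from-yes (3ℚ ℚ.* ½ ℚ.≤? 3ℚ))))))
        (solve 1 (λ r → r :* (con 3ℚ :* (con 2ℚ :* r)) := con 6ℚ :* (r :* r)) refl ρ)))
        renaming (A to B; 0<A to 0<B; ½<A to ½<B; A∈± to B∈±; A⁻¹ to B⁻¹; A⁻¹A≈1 to B⁻¹B≈1; A⁻¹∈± to B⁻¹∈±; 0<⇒± to 0<⇒±′)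

      factor : ∀ {y} x → m + z * x ≈ y → m * (1# + z * (μ * x)) ≈ y
      factor {y} x e = begin
        m * (1# + z * (μ * x)) ≈⟨ solve 5 (λ m μ z x o → m :* (o :+ z :* (μ :* x)) := m :* o :+ (m :* μ) :* (z :* x)) refl m μ z x 1# ⟩
        m * 1# + m * μ * (z * x) ≈⟨ +-cong (*-identityʳ m) (trans (*-congʳ mμ≈1) (*-identityˡ _)) ⟩
        m + z * x ≈⟨ e ⟩
        y ∎
        where open SetoidReasoning setoid

-- Bases containing 1, and the construction of ζ

module Approximation (ℝ : RealNumbers c ℓ₁ ℓ₂) (K : RealCubicField ℝ ℓ₃) where
  open RealProperties ℝ
  open RealCubicField K
  open FieldProperties ℝ K
  open Determinant
  open RationalProperties
  open NewtonStep ℝ using (2ℚ; 3ℚ; 2ᴿ; 3ᴿ; bound; 0≤bound; estimates; module Estimates)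

  vanish₂ : ∀ {x} c₁ c₂ {e₁ e₂} → e₁ ≈ 0# → e₂ ≈ 0# → x ≈ c₁ * e₁ + c₂ * e₂ → x ≈ 0#
  vanish₂ c₁ c₂ e₁≈0 e₂≈0 e = trans e (trans
    (+-cong (trans (*-congˡ e₁≈0) (zeroʳ c₁)) (trans (*-congˡ e₂≈0) (zeroʳ c₂))) (+-identityʳ 0#))

  ≈⇒-≈0 : ∀ {x y} → x ≈ y → x - y ≈ 0#
  ≈⇒-≈0 {x} {y} e = trans (+-congʳ e) (-‿inverseʳ y)

  -≈0⇒≈ : ∀ {x y} → x - y ≈ 0# → x ≈ y
  -≈0⇒≈ {x} {y} e = begin
    x         ≈⟨ solve 2 (λ x y → x := (x :- y) :+ y) refl x y ⟩
    x - y + y ≈⟨ +-congʳ e ⟩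
    0# + y    ≈⟨ +-identityˡ y ⟩
    y         ∎
    where open SetoidReasoning setoid

  span : (x y z : Carrier) (a b c : ℚ) → Carrier
  span x y z a b c = ι a * x + ι b * y + ι c * z

  record IsBasis (x y z : Carrier) : Set (c ⊔ ℓ₁ ⊔ ℓ₂ ⊔ ℓ₃) where
    field
      ∈₁     : Member x
      ∈₂     : Member y
      ∈₃     : Member z
      free   : ∀ {a b c} → span x y z a b c ≈ 0# → a ≡ 0ℚ × b ≡ 0ℚ × c ≡ 0ℚ
      spans  : ∀ {w} → Member w → ∃[ a ] ∃[ b ] ∃[ c ] w ≈ span x y z a b c

  basis-isBasis : IsBasis (basis 0F) (basis 1F) (basis 2F)
  basis-isBasis = record
    { ∈₁ = basis-∈ 0F ; ∈₂ = basis-∈ 1F ; ∈₃ = basis-∈ 2F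
    ; free = λ {a} {b} {c} e → let a≡0 = basis-independent (a ∷ b ∷ c ∷ []) (trans (sum≈comb (a ∷ b ∷ c ∷ []) basis) e)
             in a≡0 0F , a≡0 1F , a≡0 2F
    ; spans = λ w∈K → let a , e = basis-spans w∈K in a 0F , a 1F , a 2F , trans e (sum≈comb a basis)
    }

  rotate : ∀ {x y z} → IsBasis x y z → IsBasis y z x
  rotate {x} {y} {z} B = record
    { ∈₁ = ∈₂ ; ∈₂ = ∈₃ ; ∈₃ = ∈₁
    ; free  = λ e → let a , b , c = free (trans (cycle x y z _ _ _) e) in b , c , a
    ; spans = λ w∈K → let a , b , c , e = spans w∈K in b , c , a , trans e (cycle x y z _ _ _)
    }
    where
    open IsBasis B
    cycle : ∀ x y z a b c → span x y z a b c ≈ span y z x b c a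
    cycle x y z a b c = solve 6 (λ x y z a b c → a :* x :+ b :* y :+ c :* z := b :* y :+ c :* z :+ a :* x)
      refl x y z (ι a) (ι b) (ι c)

  1/-cancel : ∀ {a} → a ≢ 0ℚ → ∃[ h ] h ℚ.* a ≡ 1ℚ
  1/-cancel {a} a≢0 = (ℚ.1/ a) , ℚ.*-inverseˡ a
    where instance _ = ℚ.≢-nonZero a≢0

  *-cancel-0 : ∀ {a b} → a ≢ 0ℚ → b ℚ.* a ≡ 0ℚ → b ≡ 0ℚ
  *-cancel-0 {a} {b} a≢0 e = let h , ha≡1 = 1/-cancel a≢0 in ≡.trans (≡.sym (ℚ.*-identityʳ b))
    (≡.trans (≡.cong (b ℚ.*_) (≡.trans (≡.sym ha≡1) (ℚ.*-comm h a)))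
    (≡.trans (≡.sym (ℚ.*-assoc b a h)) (≡.trans (≡.cong (ℚ._* h) e) (ℚ.*-zeroˡ h))))

  -- Steinitz exchange: x = (1 - b y - c z) / a can be eliminated.
  exchange : ∀ {x y z a b c} → IsBasis x y z → a ≢ 0ℚ → 1# ≈ span x y z a b c → IsBasis 1# y z
  exchange {x} {y} {z} {a} {b} {c} B a≢0 1≈ = record
    { ∈₁ = 1-∈ ; ∈₂ = ∈₂ ; ∈₃ = ∈₃
    ; free = free′ ; spans = spans′ }
    where
    open IsBasis B
    ι-+* : ∀ r s t → ι (r ℚ.+ s ℚ.* t) ≈ ι r + ι s * ι t
    ι-+* r s t = trans (ι.+-homo r _) (+-congˡ (ι.*-homo s t))
    free′ : ∀ {p q r} → span 1# y z p q r ≈ 0# → p ≡ 0ℚ × q ≡ 0ℚ × r ≡ 0ℚ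
    free′ {p} {q} {r} e = p≡0 , ≡.trans (drop q b) (proj₁ (proj₂ zeros)) , ≡.trans (drop r c) (proj₂ (proj₂ zeros))
      where
      zeros : p ℚ.* a ≡ 0ℚ × q ℚ.+ p ℚ.* b ≡ 0ℚ × r ℚ.+ p ℚ.* c ≡ 0ℚ
      zeros = free (trans (+-cong (+-cong (*-congʳ (ι.*-homo p a)) (*-congʳ (ι-+* q p b))) (*-congʳ (ι-+* r p c)))
        (trans (solve 9 (λ p q r x y z a b c →
          p :* a :* x :+ (q :+ p :* b) :* y :+ (r :+ p :* c) :* z := p :* (a :* x :+ b :* y :+ c :* z) :+ q :* y :+ r :* z)
          refl (ι p) (ι q) (ι r) x y z (ι a) (ι b) (ι c))
        (trans (+-congʳ (+-congʳ (*-congˡ (sym 1≈)))) e)))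
      p≡0 = *-cancel-0 a≢0 (proj₁ zeros)
      drop : ∀ s t → s ≡ s ℚ.+ p ℚ.* t
      drop s t = ≡.sym (≡.trans (≡.cong (λ p → s ℚ.+ p ℚ.* t) p≡0)
        (≡.trans (≡.cong (s ℚ.+_) (ℚ.*-zeroˡ t)) (ℚ.+-identityʳ s)))
    spans′ : ∀ {w} → Member w → ∃[ p ] ∃[ q ] ∃[ r ] w ≈ span 1# y z p q r
    spans′ {w} w∈K =
      let α , β , γ , e = spans w∈K
          h , ha≡1 = 1/-cancel a≢0
          ιh*ιa≈1 : ι h * ι a ≈ ι 1ℚ
          ιh*ιa≈1 = trans (sym (ι.*-homo h a)) (reflexive (≡.cong ι ha≡1))
          p = α ℚ.* h
      in p , β ℚ.+ p ℚ.* (ℚ.- b) , γ ℚ.+ p ℚ.* (ℚ.- c) , (begin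
        w ≈⟨ e ⟩
        ι α * x + ι β * y + ι γ * z ≈⟨ solve 6 (λ α β γ x y z →
          α :* x :+ β :* y :+ γ :* z := α :* con 1ℚ :* x :+ β :* y :+ γ :* z) refl (ι α) (ι β) (ι γ) x y z ⟩
        ι α * ι 1ℚ * x + ι β * y + ι γ * z ≈⟨ +-congʳ (+-congʳ (*-congʳ (*-congˡ ιh*ιa≈1))) ⟨
        ι α * (ι h * ι a) * x + ι β * y + ι γ * z ≈⟨ solve 10 (λ α β γ x y z a b c h →
          α :* (h :* a) :* x :+ β :* y :+ γ :* z :=
          (α :* h) :* (a :* x :+ b :* y :+ c :* z) :+ (β :+ (α :* h) :* (:- b)) :* y :+ (γ :+ (α :* h) :* (:- c)) :* z)
          refl (ι α) (ι β) (ι γ) x y z (ι a) (ι b) (ι c) (ι h) ⟩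
        (ι α * ι h) * (ι a * x + ι b * y + ι c * z) + (ι β + (ι α * ι h) * (- ι b)) * y + (ι γ + (ι α * ι h) * (- ι c)) * z
          ≈⟨ +-cong (+-cong (*-cong (sym (ι.*-homo α h)) (sym 1≈)) (*-congʳ (coef α h β b))) (*-congʳ (coef α h γ c)) ⟩
        span 1# y z p (β ℚ.+ p ℚ.* (ℚ.- b)) (γ ℚ.+ p ℚ.* (ℚ.- c)) ∎)
      where
      open SetoidReasoning setoid
      coef : ∀ α h β b → ι β + (ι α * ι h) * (- ι b) ≈ ι (β ℚ.+ (α ℚ.* h) ℚ.* (ℚ.- b))
      coef α h β b = sym (trans (ι-+* β (α ℚ.* h) (ℚ.- b)) (+-congˡ (*-cong (ι.*-homo α h) (ι.-‿homo b))))

  -- Some coordinate of 1 is nonzero, as otherwise 1 would vanish; a rotation brings it to the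
  -- front.
  unital-basis : ∃[ ω ] ∃[ η ] IsBasis 1# ω η
  unital-basis with IsBasis.spans basis-isBasis 1-∈
  ... | a , b , c , 1≈ with a ℚ.≟ 0ℚ | b ℚ.≟ 0ℚ | c ℚ.≟ 0ℚ
  ... | no a≢0 | _ | _ = _ , _ , exchange basis-isBasis a≢0 1≈
  ... | yes _ | no b≢0 | _ = _ , _ , exchange (rotate basis-isBasis) b≢0
    (trans 1≈ (trans (+-assoc _ _ _) (+-comm _ _)))
  ... | yes _ | yes _ | no c≢0 = _ , _ , exchange (rotate (rotate basis-isBasis)) c≢0
    (trans 1≈ (trans (+-comm _ _) (sym (+-assoc _ _ _))))
  ... | yes ≡.refl | yes ≡.refl | yes ≡.refl = contradiction 0<1 (<-irrefl (sym (trans 1≈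
    (trans (solve 3 (λ x y z → con 0ℚ :* x :+ con 0ℚ :* y :+ con 0ℚ :* z := con 0ℚ) refl (basis 0F) (basis 1F) (basis 2F)) ι.0#-homo))))

  inverse-∈ : ∀ {x} → Member x → (0<x : 0# < x) → Member (inverse x 0<x)
  inverse-∈ {x} x∈K 0<x =
    let y , y∈K , xy≈1 = inv-∈ x∈K (λ x≈0 → <-irrefl (sym x≈0) 0<x)
    in ∈-resp-≈ (sym (trans (*-inverse-cancel xy≈1 (inverse-* x 0<x)) (*-identityˡ y))) y∈K

  -- A relation ω² = p ω + q would make K a vector space over the quadratic field ℚ(ω).
  no-quadratic : ∀ {ω η p q} → IsBasis 1# ω η → ¬ (ω * ω ≈ ι p * ω + ι q)
  no-quadratic {ω} {η} {p} {q} basis ω²≈ = contradiction (proj₁ (proj₂ (free {ℚ.- (p ℚ.- C)} {1ℚ} {0ℚ} linear≈0))) (λ ())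
    where
    open IsBasis basis
    1*ι : ∀ a → ι a * 1# ≈ ι a
    1*ι a = *-identityʳ (ι a)
    coords = spans (*-∈ ∈₂ ∈₃)
    A = proj₁ coords
    B = proj₁ (proj₂ coords)
    C = proj₁ (proj₂ (proj₂ coords))
    ωη≈ : ω * η ≈ ι A + ι B * ω + ι C * η
    ωη≈ = trans (proj₂ (proj₂ (proj₂ coords))) (+-congʳ (+-congʳ (1*ι A)))
    -- The product (ω - (p - C)) (ω - C) equals - R. Multiplying (ω - C) η = A + B ω by ω - (p - C)
    -- therefore gives A′ + B′ ω + R η = 0, whence R = 0. Then the product vanishes, and ω would be
    -- one of the rationals C and p - C.
    R A′ B′ : ℚ
    R  = (p ℚ.- C) ℚ.* (ℚ.- C) ℚ.- q
    A′ = q ℚ.* B ℚ.- (p ℚ.- C) ℚ.* A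
    B′ = A ℚ.+ C ℚ.* B
    ι-- : ∀ a b → ι (a ℚ.- b) ≈ ι a - ι b
    ι-- a b = trans (ι.+-homo a _) (+-congˡ (ι.-‿homo b))
    R≈ : ι R ≈ (ι p - ι C) * (- ι C) - ι q
    R≈ = trans (ι-- _ q) (+-congʳ (trans (ι.*-homo _ _) (*-cong (ι-- p C) (ι.-‿homo C))))
    A′≈ : ι A′ ≈ ι q * ι B - (ι p - ι C) * ι A
    A′≈ = trans (ι-- _ _) (+-cong (ι.*-homo q B) (-‿cong (trans (ι.*-homo _ A) (*-congʳ (ι-- p C)))))
    B′≈ : ι B′ ≈ ι A + ι C * ι B
    B′≈ = trans (ι.+-homo A _) (+-congˡ (ι.*-homo C B))
    R≡0 : R ≡ 0ℚ
    R≡0 = proj₂ (proj₂ (free {A′} {B′} {R} (trans (+-cong (+-cong (trans (1*ι A′) A′≈) (*-congʳ B′≈)) (*-congʳ R≈))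
      (vanish₂ (ι p - ι C - ω) (η - ι B) (≈⇒-≈0 ωη≈) (≈⇒-≈0 ω²≈)
        (solve 7 (λ ω η p q A B C →
          (q :* B :- (p :- C) :* A) :+ (A :+ C :* B) :* ω :+ ((p :- C) :* (:- C) :- q) :* η
          := (p :- C :- ω) :* (ω :* η :- (A :+ B :* ω :+ C :* η)) :+ (η :- B) :* (ω :* ω :- (p :* ω :+ q)))
          refl ω η (ι p) (ι q) (ι A) (ι B) (ι C))))))
    ω-C≉0 : ¬ (ω - ι C ≈ 0#)
    ω-C≉0 e = contradiction (proj₁ (proj₂ (free {ℚ.- C} {1ℚ} {0ℚ} (trans (+-cong (+-congʳ (trans (1*ι _) (ι.-‿homo C))) (*-congʳ ι.0#-homo))
      (trans (+-cong (trans (+-congˡ (trans (*-congʳ ι.1#-homo) (*-identityˡ ω))) (+-comm _ _)) (zeroˡ η)) (trans (+-identityʳ _) e)))))) (λ ())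
    inv = inv-∈ (+-∈ ∈₂ (neg-∈ (ι-∈ C))) ω-C≉0
    y = proj₁ inv
    factor : (ω - (ι p - ι C)) * (ω - ι C) ≈ 0#
    factor = vanish₂ (ι 1ℚ) (ι (ℚ.- 1ℚ)) (≈⇒-≈0 ω²≈) (trans (sym R≈) (ι-0 R≡0))
      (solve 4 (λ ω p q C → (ω :- (p :- C)) :* (ω :- C) :=
          con 1ℚ :* (ω :* ω :- (p :* ω :+ q)) :+ con (ℚ.- 1ℚ) :* ((p :- C) :* (:- C) :- q)) refl ω (ι p) (ι q) (ι C))
    linear≈0 : span 1# ω η (ℚ.- (p ℚ.- C)) 1ℚ 0ℚ ≈ 0#
    linear≈0 = trans (+-cong (+-cong (trans (1*ι _) (trans (ι.-‿homo _) (-‿cong (ι-- p C))))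
        (trans (*-congʳ ι.1#-homo) (*-identityˡ ω))) (trans (*-congʳ ι.0#-homo) (zeroˡ η)))
      (trans (+-identityʳ _) (trans (+-comm _ _)
        (trans (*-inverse-cancel (proj₂ (proj₂ inv)) factor) (zeroˡ y))))
  -- t and s absorb the deviation of N(u ζ + v) from G u² (u + v); η completes 1 and ζ
  -- to a basis.
  record Approximant (η : Carrier) (ε : ℚ) : Set (c ⊔ ℓ₁ ⊔ ℓ₂ ⊔ ℓ₃) where
    field
      ζ      : Carrier
      ζ∈K    : Member ζ
      ζ-1∈±  : ζ - 1# ∈± ι ε
      free   : ∀ {a b c} → span 1# ζ η a b c ≈ 0# → a ≡ 0ℚ × b ≡ 0ℚ × c ≡ 0ℚ
      G t s  : ℚ
      G≢0    : G ≢ 0ℚ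
      ∣t∣<ε  : ℚ.∣ t ∣ ℚ.< ε
      ∣s∣<ε  : ℚ.∣ s ∣ ℚ.< ε
      norm-ζ : ∀ {x} (x∈K : Member x) u v → x ≈ ι u * ζ + ι v →
               norm x∈K ≡ G ℚ.* (u ℚ.* u ℚ.* (u ℚ.+ v) ℚ.+ (u ℚ.* v ℚ.* v ℚ.* t ℚ.+ v ℚ.* v ℚ.* v ℚ.* s))

  approximant : ∀ {ω η ε} → IsBasis 1# ω η → 0ℚ ℚ.< ε → ε ℚ.≤ ½ → Approximant η ε
  approximant {ω} {η} {ε} isBasis 0<ε ε≤½ = record
    { ζ = ζ ; ζ∈K = +-∈ (*-∈ (ι-∈ k) ∈₂) (ι-∈ l) ; ζ-1∈± = ±-resp-≈ (sym ζ-1≈) small₁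
    ; free = free′
    ; G = G₁ ℚ.* k ℚ.* k ; t = t′ ; s = s′
    ; G≢0 = λ G≡0 → k≢0 (*-cancel-0 G₁≢0 (≡.trans (ℚ.*-comm k G₁) (*-cancel-0 k≢0 G≡0)))
    ; ∣t∣<ε = ±-ι⁻¹ (±-resp-≈ (sym t′≈) small₂)
    ; ∣s∣<ε = ±-ι⁻¹ (±-resp-≈ (sym s′≈) small₃)
    ; norm-ζ = λ x∈K u v e → ≡.trans (norm-affine ∈₂ x∈K (u ℚ.* k) (u ℚ.* l ℚ.+ v) (trans e (ζ-affine u v))) (newton u v)
    }
    where
    open IsBasis isBasis
    t s n : ℚ
    t = trace (mult ∈₂)
    s = minors (mult ∈₂)
    n = det₃ (mult ∈₂)

    -- For P(X) = X³ + t X² + s X + n, which has the root - ω, these are P′(- ω) and P″(- ω) / 2.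
    -- The step `z` leads from - ω to - c₀, which explains the signs below.
    m Q : Carrier
    m = 3ᴿ * (ω * ω) - 2ᴿ * (ι t * ω) + ι s
    Q = ι t - 3ᴿ * ω

    -- If ω were a double root of its characteristic polynomial, it would be quadratic.
    m≉0 : ¬ (m ≈ 0#)
    m≉0 m≈0 = no-quadratic {p = ⅔ ℚ.* t} {q = ⅓ ℚ.* (ℚ.- s)} isBasis (trans
      (-≈0⇒≈ (vanish₂ (ι ⅓) 0# m≈0 m≈0 (trans
        (solve 3 (λ w t s → w :* w :- (con ⅔ :* t :* w :+ con ⅓ :* (:- s)) := con ⅓ :* (con 3ℚ :* (w :* w) :- con 2ℚ :* (t :* w) :+ s)) refl ω (ι t) (ι s))
        (sym (trans (+-congˡ (zeroˡ m)) (+-identityʳ _))))))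
      (+-cong (*-congʳ (sym (ι.*-homo ⅔ t))) (sym (trans (ι.*-homo ⅓ (ℚ.- s)) (*-congˡ (ι.-‿homo s))))))
      where
      ⅓ ⅔ : ℚ
      ⅓ = + 1 ℚ./ 3
      ⅔ = + 2 ℚ./ 3

    m∈K : Member m
    m∈K = +-∈ (+-∈ (*-∈ (ι-∈ 3ℚ) (*-∈ ∈₂ ∈₂)) (neg-∈ (*-∈ (ι-∈ 2ℚ) (*-∈ (ι-∈ t) ∈₂)))) (ι-∈ s)

    μ : Carrier
    μ = proj₁ (inv-∈ m∈K m≉0)
    mμ≈1 : m * μ ≈ 1#
    mμ≈1 = proj₂ (proj₂ (inv-∈ m∈K m≉0))

    K-bound = bound {m} {μ} {Q} mμ≈1

    small-δ : ∃[ δ ] 0ℚ ℚ.< δ × ι δ * K-bound < ι ε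
    small-δ = small (0≤bound mμ≈1) (ι-pos 0<ε)
    δ₀ = proj₁ small-δ

    -- `c₀` is taken below ω because `estimates` asks for a positive `z`.
    below : ∃[ c ] ω - ι δ₀ < ι c × ι c < ω
    below = ι-dense (<-by (ι-pos (proj₁ (proj₂ small-δ))) (solve 2 (λ w d → w :- (w :- d) := d) refl ω (ι δ₀)))
    c₀ = proj₁ below
    z = ω - ι c₀
    0<z : 0# < z
    0<z = <⇒0<- (proj₂ (proj₂ below))
    z<δ : z < ι δ₀
    z<δ = <-moveʳ (solve 3 (λ w d c → c :- (w :- d) := d :- (w :- c)) refl ω (ι δ₀) (ι c₀)) (proj₁ (proj₂ below))

    open Estimates (estimates {m} {μ} {Q} mμ≈1 {z} {ι ε} 0<z
      (≤-<-trans (*-monoʳ-≤ (0≤bound mμ≈1) (<⇒≤ z<δ)) (proj₂ (proj₂ small-δ))) (ι-mono-≤ ε≤½))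

    -- The values at - c₀ of the characteristic polynomial and its derivatives.
    D G₁ Q₂ : ℚ
    D  = n ℚ.- c₀ ℚ.* s ℚ.+ c₀ ℚ.* c₀ ℚ.* t ℚ.- c₀ ℚ.* c₀ ℚ.* c₀
    G₁ = s ℚ.- 2ℚ ℚ.* c₀ ℚ.* t ℚ.+ 3ℚ ℚ.* c₀ ℚ.* c₀
    Q₂ = t ℚ.- 3ℚ ℚ.* c₀

    ι-- : ∀ a b → ι (a ℚ.- b) ≈ ι a - ι b
    ι-- a b = trans (ι.+-homo a _) (+-congˡ (ι.-‿homo b))
    ι-** : ∀ a b d → ι (a ℚ.* b ℚ.* d) ≈ ι a * ι b * ι d
    ι-** a b d = trans (ι.*-homo _ d) (*-congʳ (ι.*-homo a b))

    D≈ : ι D ≈ z * (m * A)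
    D≈ = trans (trans (ι-- _ _) (+-cong (trans (ι.+-homo _ _) (+-cong (trans (ι-- _ _) (+-congˡ (-‿cong (ι.*-homo c₀ s)))) (ι-** c₀ c₀ t)))
        (-‿cong (ι-** c₀ c₀ c₀))))
      (trans (-≈0⇒≈ (vanish₂ (ι (ℚ.- 1ℚ)) 0# (norm-root ∈₂) (norm-root ∈₂) (trans
        (solve 5 (λ w c t s n →
          n :- c :* s :+ c :* c :* t :- c :* c :* c :-
            (w :- c) :* (con 3ℚ :* (w :* w) :- con 2ℚ :* (t :* w) :+ s :+ (t :- con 3ℚ :* w) :* (w :- c) :+ (w :- c) :* (w :- c))
          := con (ℚ.- 1ℚ) :* (w :* w :* w :- t :* (w :* w) :+ s :* w :- n)) refl ω (ι c₀) (ι t) (ι s) (ι n))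
        (sym (trans (+-congˡ (zeroˡ _)) (+-identityʳ _))))))
      (*-congˡ (sym mA≈)))

    G₁≈ : ι G₁ ≈ m * B
    G₁≈ = trans (trans (ι.+-homo _ _) (+-cong (trans (ι-- _ _) (+-congˡ (-‿cong (ι-** 2ℚ c₀ t)))) (ι-** 3ℚ c₀ c₀)))
      (trans (solve 4 (λ w c t s → s :- con 2ℚ :* c :* t :+ con 3ℚ :* c :* c :=
        con 3ℚ :* (w :* w) :- con 2ℚ :* (t :* w) :+ s :+ con 2ℚ :* ((t :- con 3ℚ :* w) :* (w :- c)) :+ con 3ℚ :* ((w :- c) :* (w :- c)))
        refl ω (ι c₀) (ι t) (ι s)) (sym mB≈))

    Q₂≈ : ι Q₂ ≈ Q + 3ᴿ * z
    Q₂≈ = trans (trans (ι-- _ _) (+-congˡ (-‿cong (ι.*-homo 3ℚ c₀))))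
      (solve 3 (λ w c t → t :- con 3ℚ :* c := (t :- con 3ℚ :* w) :+ con 3ℚ :* (w :- c)) refl ω (ι c₀) (ι t))

    inverses : ∀ {X X⁻¹} → X⁻¹ * X ≈ 1# → (m * X) * (μ * X⁻¹) ≈ 1#
    inverses {X} {X⁻¹} e = trans (solve 4 (λ m μ X Y → (m :* X) :* (μ :* Y) := (m :* μ) :* (Y :* X)) refl m μ X X⁻¹)
      (trans (*-cong mμ≈1 e) (*-identityˡ 1#))

    0≉1 : ∀ {x y} → x ≈ 0# → x * y ≈ 1# → ∀ {w} {W : Set w} → W
    0≉1 {x} {y} x≈0 xy≈1 = contradiction 0<1 (<-irrefl (trans (sym (zeroˡ y)) (trans (*-congʳ (sym x≈0)) xy≈1)))

    G₁≢0 : G₁ ≢ 0ℚ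
    G₁≢0 G₁≡0 = 0≉1 (trans (sym G₁≈) (ι-0 G₁≡0)) (inverses B⁻¹B≈1)

    D≢0 : D ≢ 0ℚ
    D≢0 D≡0 = 0≉1 (trans (sym D≈) (ι-0 D≡0)) (begin
      z * (m * A) * ((μ * A⁻¹) * z⁻¹)   ≈⟨ solve 4 (λ z x y i → z :* x :* (y :* i) := (x :* y) :* (i :* z)) refl z (m * A) (μ * A⁻¹) z⁻¹ ⟩
      (m * A) * (μ * A⁻¹) * (z⁻¹ * z) ≈⟨ *-cong (inverses A⁻¹A≈1) (inverse-* z 0<z) ⟩
      1# * 1# ≈⟨ *-identityˡ 1# ⟩
      1# ∎)
      where
      open SetoidReasoning setoid
      z⁻¹ = inverse z 0<z

    -- `h` and `H` invert `D` and `G₁`. The Newton approximation of ω - c₀ is `N` = D / G₁ = 1 / k,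
    -- and `l` makes ζ equal to k (ω - c₀).
    h H k l N : ℚ
    h = proj₁ (1/-cancel D≢0)
    H = proj₁ (1/-cancel G₁≢0)
    k = G₁ ℚ.* h
    l = k ℚ.* (ℚ.- c₀)
    N = D ℚ.* H

    kD≡G₁ : k ℚ.* D ≡ G₁
    kD≡G₁ = ≡.trans (ℚ.*-assoc G₁ h D) (≡.trans (≡.cong (G₁ ℚ.*_) (proj₂ (1/-cancel D≢0))) (ℚ.*-identityʳ G₁))
    kDH≡1 : k ℚ.* D ℚ.* H ≡ 1ℚ
    kDH≡1 = ≡.trans (≡.cong (ℚ._* H) kD≡G₁) (≡.trans (ℚ.*-comm G₁ H) (proj₂ (1/-cancel G₁≢0)))

    k≢0 : k ≢ 0ℚ
    k≢0 k≡0 = G₁≢0 (≡.trans (≡.sym kD≡G₁) (≡.trans (≡.cong (ℚ._* D) k≡0) (ℚ.*-zeroˡ D)))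

    ζ : Carrier
    ζ = ι k * ω + ι l

    -- `D` contains the factor `z`, which cancels against ω - c₀; what is left is a quotient of two
    -- numbers near 1.
    ζ≈ : ζ ≈ B * A⁻¹
    ζ≈ = begin
      ι k * ω + ι l ≈⟨ +-congˡ (trans (ι.*-homo k _) (*-congˡ (ι.-‿homo c₀))) ⟩
      ι k * ω + ι k * (- ι c₀) ≈⟨ distribˡ (ι k) ω (- ι c₀) ⟨
      ι k * z ≈⟨ *-inverse-cancel (inverses A⁻¹A≈1) (trans (*-assoc (ι k) z (m * A)) (trans (*-congˡ (sym D≈))
        (trans (sym (ι.*-homo k D)) (trans (reflexive (≡.cong ι kD≡G₁)) G₁≈)))) ⟩
      m * B * (μ * A⁻¹) ≈⟨ solve 4 (λ m B μ A → m :* B :* (μ :* A) := (m :* μ) :* (B :* A)) refl m B μ A⁻¹ ⟩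
      m * μ * (B * A⁻¹) ≈⟨ trans (*-congʳ mμ≈1) (*-identityˡ _) ⟩
      B * A⁻¹ ∎
      where open SetoidReasoning setoid

    ζ-1≈ : ζ - 1# ≈ z * (μ * (Q + 2ᴿ * z) * A⁻¹)
    ζ-1≈ = begin
      ζ - 1# ≈⟨ +-cong ζ≈ (-‿cong (sym A⁻¹A≈1)) ⟩
      B * A⁻¹ - A⁻¹ * A ≈⟨ solve 3 (λ A B I → B :* I :- I :* A := con 1ℚ :* ((B :- A) :* I)) refl A B A⁻¹ ⟩
      ι 1ℚ * ((B - A) * A⁻¹) ≈⟨ *-congʳ (trans ι.1#-homo (sym mμ≈1)) ⟩
      m * μ * ((B - A) * A⁻¹) ≈⟨ solve 5 (λ m μ A B I → m :* μ :* ((B :- A) :* I) := (μ :* I) :* (m :* B :- m :* A)) refl m μ A B A⁻¹ ⟩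
      μ * A⁻¹ * (m * B - m * A) ≈⟨ *-congˡ (+-cong mB≈ (-‿cong mA≈)) ⟩
      μ * A⁻¹ * (m + 2ᴿ * (Q * z) + 3ᴿ * (z * z) - (m + Q * z + z * z))
        ≈⟨ solve 5 (λ m μ I Q z → μ :* I :* (m :+ con 2ℚ :* (Q :* z) :+ con 3ℚ :* (z :* z) :- (m :+ Q :* z :+ z :* z))
          := z :* (μ :* (Q :+ con 2ℚ :* z) :* I)) refl m μ A⁻¹ Q z ⟩
      z * (μ * (Q + 2ᴿ * z) * A⁻¹) ∎
      where open SetoidReasoning setoid

    H≈ : ι H ≈ μ * B⁻¹
    H≈ = trans (*-inverse-cancel (inverses B⁻¹B≈1) (trans (*-congˡ (sym G₁≈))
      (trans (sym (ι.*-homo H G₁)) (trans (reflexive (≡.cong ι (proj₂ (1/-cancel G₁≢0)))) ι.1#-homo)))) (*-identityˡ _)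

    N≈ : ι N ≈ z * (A * B⁻¹)
    N≈ = begin
      ι N ≈⟨ trans (ι.*-homo D H) (*-cong D≈ H≈) ⟩
      z * (m * A) * (μ * B⁻¹) ≈⟨ solve 5 (λ z m A μ I → z :* (m :* A) :* (μ :* I) := (m :* μ) :* (z :* (A :* I))) refl z m A μ B⁻¹ ⟩
      m * μ * (z * (A * B⁻¹)) ≈⟨ trans (*-congʳ mμ≈1) (*-identityˡ _) ⟩
      z * (A * B⁻¹) ∎
      where open SetoidReasoning setoid

    -- The error coefficients in `newton-identity`. Each has a factor `N`, of order `z`, and so is
    -- small once `c₀` is close to ω.
    t′ s′ : ℚ
    t′ = Q₂ ℚ.* N ℚ.* H
    s′ = N ℚ.* N ℚ.* H

    t′≈ : ι t′ ≈ z * (μ * (Q + 3ᴿ * z) * (A * (B⁻¹ * B⁻¹)))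
    t′≈ = trans (ι-** Q₂ N H) (trans (*-cong (*-cong Q₂≈ N≈) H≈)
      (solve 5 (λ z μ q A I → q :* (z :* (A :* I)) :* (μ :* I) := z :* (μ :* q :* (A :* (I :* I)))) refl z μ (Q + 3ᴿ * z) A B⁻¹))

    s′≈ : ι s′ ≈ z * (z * ((A * A) * (B⁻¹ * B⁻¹ * B⁻¹)) * μ)
    s′≈ = trans (ι-** N N H) (trans (*-cong (*-cong N≈ N≈) H≈)
      (solve 4 (λ z μ A I → z :* (A :* I) :* (z :* (A :* I)) :* (μ :* I) := z :* (z :* ((A :* A) :* (I :* I :* I)) :* μ)) refl z μ A B⁻¹))

    ζ-affine : ∀ u v → ι u * ζ + ι v ≈ ι (u ℚ.* k) * ω + ι (u ℚ.* l ℚ.+ v)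
    ζ-affine u v = trans (solve 5 (λ u v k l w → u :* (k :* w :+ l) :+ v := (u :* k) :* w :+ (u :* l :+ v)) refl (ι u) (ι v) (ι k) (ι l) ω)
      (sym (+-cong (*-congʳ (ι.*-homo u k)) (trans (ι.+-homo _ v) (+-congʳ (ι.*-homo u l)))))

    newton : ∀ u v → let U = u ℚ.* k ; V = u ℚ.* l ℚ.+ v in
      U ℚ.* U ℚ.* U ℚ.* n ℚ.+ U ℚ.* U ℚ.* V ℚ.* s ℚ.+ U ℚ.* V ℚ.* V ℚ.* t ℚ.+ V ℚ.* V ℚ.* V
      ≡ G₁ ℚ.* k ℚ.* k ℚ.* (u ℚ.* u ℚ.* (u ℚ.+ v) ℚ.+ (u ℚ.* v ℚ.* v ℚ.* t′ ℚ.+ v ℚ.* v ℚ.* v ℚ.* s′))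
    newton = newton-identity n s t c₀ k H kD≡G₁ kDH≡1

    free′ : ∀ {a b c} → span 1# ζ η a b c ≈ 0# → a ≡ 0ℚ × b ≡ 0ℚ × c ≡ 0ℚ
    free′ {a} {b} {c} e = a≡0 , b≡0 , proj₂ (proj₂ zeros)
      where
      zeros : a ℚ.+ b ℚ.* l ≡ 0ℚ × b ℚ.* k ≡ 0ℚ × c ≡ 0ℚ
      zeros = free (trans (+-congʳ (+-cong (*-congʳ (trans (ι.+-homo a _) (+-congˡ (ι.*-homo b l)))) (*-congʳ (ι.*-homo b k))))
        (trans (solve 8 (λ a b c k l w y o → (a :+ b :* l) :* o :+ b :* k :* w :+ c :* y := a :* o :+ b :* (k :* w :+ l :* o) :+ c :* y)
          refl (ι a) (ι b) (ι c) (ι k) (ι l) ω η 1#)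
        (trans (+-congʳ (+-congˡ (*-congˡ (+-congˡ (*-identityʳ (ι l)))))) e)))
      b≡0 = *-cancel-0 k≢0 (proj₁ (proj₂ zeros))
      a≡0 = ≡.trans (≡.sym (≡.trans (≡.cong (λ b → a ℚ.+ b ℚ.* l) b≡0)
        (≡.trans (≡.cong (a ℚ.+_) (ℚ.*-zeroˡ l)) (ℚ.+-identityʳ a)))) (proj₁ zeros)

-- Orderings of the three indices

data Permutation : (i j h : Fin 3) → Set where
  ⟨012⟩ : Permutation 0F 1F 2F
  ⟨021⟩ : Permutation 0F 2F 1F
  ⟨102⟩ : Permutation 1F 0F 2F
  ⟨120⟩ : Permutation 1F 2F 0F
  ⟨201⟩ : Permutation 2F 0F 1F
  ⟨210⟩ : Permutation 2F 1F 0F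

permutation : ∀ i j (i≢j : i ≢ j) → Permutation i j (θ i j i≢j)
permutation 0F 1F _ = ⟨012⟩
permutation 0F 2F _ = ⟨021⟩
permutation 1F 0F _ = ⟨102⟩
permutation 1F 2F _ = ⟨120⟩
permutation 2F 0F _ = ⟨201⟩
permutation 2F 1F _ = ⟨210⟩
permutation 0F 0F i≢j = contradiction ≡.refl i≢j
permutation 1F 1F i≢j = contradiction ≡.refl i≢j
permutation 2F 2F i≢j = contradiction ≡.refl i≢j

transpose : ∀ {i j h} → Permutation i j h → Permutation j i h
transpose ⟨012⟩ = ⟨102⟩
transpose ⟨021⟩ = ⟨201⟩
transpose ⟨102⟩ = ⟨012⟩
transpose ⟨120⟩ = ⟨210⟩
transpose ⟨201⟩ = ⟨021⟩
transpose ⟨210⟩ = ⟨120⟩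

cycle : ∀ {i j h} → Permutation i j h → Permutation j h i
cycle ⟨012⟩ = ⟨120⟩
cycle ⟨021⟩ = ⟨210⟩
cycle ⟨102⟩ = ⟨021⟩
cycle ⟨120⟩ = ⟨201⟩
cycle ⟨201⟩ = ⟨012⟩
cycle ⟨210⟩ = ⟨102⟩

distinct : ∀ {i j h} → Permutation i j h → i ≢ j
distinct ⟨012⟩ = λ ()
distinct ⟨021⟩ = λ ()
distinct ⟨102⟩ = λ ()
distinct ⟨120⟩ = λ ()
distinct ⟨201⟩ = λ ()
distinct ⟨210⟩ = λ ()

cover : ∀ {i j h} → Permutation i j h → ∀ m → m ≡ i ⊎ m ≡ j ⊎ m ≡ h
cover ⟨012⟩ 0F = inj₁ ≡.refl
cover ⟨012⟩ 1F = inj₂ (inj₁ ≡.refl)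
cover ⟨012⟩ 2F = inj₂ (inj₂ ≡.refl)
cover ⟨021⟩ 0F = inj₁ ≡.refl
cover ⟨021⟩ 1F = inj₂ (inj₂ ≡.refl)
cover ⟨021⟩ 2F = inj₂ (inj₁ ≡.refl)
cover ⟨102⟩ 0F = inj₂ (inj₁ ≡.refl)
cover ⟨102⟩ 1F = inj₁ ≡.refl
cover ⟨102⟩ 2F = inj₂ (inj₂ ≡.refl)
cover ⟨120⟩ 0F = inj₂ (inj₂ ≡.refl)
cover ⟨120⟩ 1F = inj₁ ≡.refl
cover ⟨120⟩ 2F = inj₂ (inj₁ ≡.refl)
cover ⟨201⟩ 0F = inj₂ (inj₁ ≡.refl)
cover ⟨201⟩ 1F = inj₂ (inj₂ ≡.refl)
cover ⟨201⟩ 2F = inj₁ ≡.refl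
cover ⟨210⟩ 0F = inj₂ (inj₂ ≡.refl)
cover ⟨210⟩ 1F = inj₂ (inj₁ ≡.refl)
cover ⟨210⟩ 2F = inj₁ ≡.refl

-- Stated for arbitrary `Q` because it serves twice: for the pair at which `v` is maximal, and for
-- the pair excluded by the theorem.
remaining-pairs : ∀ {a i j h} → Permutation i j h → (Q : Fin 3 → Fin 3 → Set a) → Q i h → Q h i → Q j h → Q h j →
  ∀ k l → k ≢ l → (k , l) ≢ (i , j) → (k , l) ≢ (j , i) → Q k l
remaining-pairs π Q ih hi jh hj k l k≢l kl≢ij kl≢ji with cover π k | cover π l
... | inj₁ ≡.refl        | inj₁ ≡.refl        = contradiction ≡.refl k≢l
... | inj₁ ≡.refl        | inj₂ (inj₁ ≡.refl) = contradiction ≡.refl kl≢ij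
... | inj₁ ≡.refl        | inj₂ (inj₂ ≡.refl) = ih
... | inj₂ (inj₁ ≡.refl) | inj₁ ≡.refl        = contradiction ≡.refl kl≢ji
... | inj₂ (inj₁ ≡.refl) | inj₂ (inj₁ ≡.refl) = contradiction ≡.refl k≢l
... | inj₂ (inj₁ ≡.refl) | inj₂ (inj₂ ≡.refl) = jh
... | inj₂ (inj₂ ≡.refl) | inj₁ ≡.refl        = hi
... | inj₂ (inj₂ ≡.refl) | inj₂ (inj₁ ≡.refl) = hj
... | inj₂ (inj₂ ≡.refl) | inj₂ (inj₂ ≡.refl) = contradiction ≡.refl k≢l

module _ {a} {A : Set a} where
  place : ∀ {i j h} → Permutation i j h → A → A → A → Vector A 3
  place ⟨012⟩ x y z = x ∷ y ∷ z ∷ []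
  place ⟨021⟩ x y z = x ∷ z ∷ y ∷ []
  place ⟨102⟩ x y z = y ∷ x ∷ z ∷ []
  place ⟨120⟩ x y z = z ∷ x ∷ y ∷ []
  place ⟨201⟩ x y z = y ∷ z ∷ x ∷ []
  place ⟨210⟩ x y z = z ∷ y ∷ x ∷ []

  place-lookup : ∀ {i j h} (π : Permutation i j h) x y z →
    place π x y z i ≡ x × place π x y z j ≡ y × place π x y z h ≡ z
  place-lookup ⟨012⟩ x y z = ≡.refl , ≡.refl , ≡.refl
  place-lookup ⟨021⟩ x y z = ≡.refl , ≡.refl , ≡.refl
  place-lookup ⟨102⟩ x y z = ≡.refl , ≡.refl , ≡.refl
  place-lookup ⟨120⟩ x y z = ≡.refl , ≡.refl , ≡.refl
  place-lookup ⟨201⟩ x y z = ≡.refl , ≡.refl , ≡.refl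
  place-lookup ⟨210⟩ x y z = ≡.refl , ≡.refl , ≡.refl

  place-all : ∀ {p i j h} (P : A → Set p) (π : Permutation i j h) {x y z} → P x → P y → P z → ∀ m → P (place π x y z m)
  place-all P π {x} {y} {z} px py pz m with cover π m | place-lookup π x y z
  ... | inj₁ ≡.refl        | e , _ , _ = ≡.subst P (≡.sym e) px
  ... | inj₂ (inj₁ ≡.refl) | _ , e , _ = ≡.subst P (≡.sym e) py
  ... | inj₂ (inj₂ ≡.refl) | _ , _ , e = ≡.subst P (≡.sym e) pz

-- Barycentric coordinates and the effect of `T` on them

module Projective (ℝ : RealNumbers c ℓ₁ ℓ₂) where
  open RealProperties ℝ

  coordinates : Point → Vector Carrier 3
  coordinates (x , y) = (1# - x - y) ∷ x ∷ y ∷ []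

  2*≈+ : ∀ x → 2# * x ≈ x + x
  2*≈+ x = trans (distribʳ x 1# 1#) (+-cong (*-identityˡ x) (*-identityˡ x))

  half-intro : ∀ {i j h} → Permutation i j h → (i≢j : i ≢ j) → ∀ P → coordinates P j < coordinates P i → half i j i≢j P
  half-intro ⟨012⟩ _ (x , y) x<γ = <⇒≤ (<-moveʳ (trans
    (solve 3 (λ x y o → o :- x :- y :- x := :- (x :+ x :+ y :- o)) refl x y 1#)
    (sym (trans (+-identityˡ _) (-‿cong (+-congʳ (+-congʳ (2*≈+ x))))))) x<γ)
  half-intro ⟨021⟩ _ (x , y) y<γ = <⇒≤ (<-moveʳ (trans
    (solve 3 (λ x y o → o :- x :- y :- y := :- (x :+ (y :+ y) :- o)) refl x y 1#)
    (sym (trans (+-identityˡ _) (-‿cong (+-congʳ (+-congˡ (2*≈+ y))))))) y<γ)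
  half-intro ⟨102⟩ _ (x , y) γ<x = <⇒≤ (<-respʳ-≈ (trans
    (solve 3 (λ x y o → x :- (o :- x :- y) := x :+ x :+ y :- o) refl x y 1#)
    (sym (+-congʳ (+-congʳ (2*≈+ x))))) (<⇒0<- γ<x))
  half-intro ⟨120⟩ _ (x , y) y<x = <⇒≤ y<x
  half-intro ⟨201⟩ _ (x , y) γ<y = <⇒≤ (<-respʳ-≈ (trans
    (solve 3 (λ x y o → y :- (o :- x :- y) := x :+ (y :+ y) :- o) refl x y 1#)
    (sym (+-congʳ (+-congˡ (2*≈+ y))))) (<⇒0<- γ<y))
  half-intro ⟨210⟩ _ (x , y) x<y = <⇒≤ x<y

  -- Barycentric coordinates of the image before division by the common denominator.
  homogeneous : ∀ i j → i ≢ j → Point → Vector Carrier 3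
  homogeneous i j i≢j P = (denominator i j i≢j P - proj₁ n - proj₂ n) ∷ proj₁ n ∷ proj₂ n ∷ []
    where n = numerators i j i≢j P

  coordinates-T : ∀ i j i≢j P P∈△ → let d⁻¹ = inverse (denominator i j i≢j P) (denominator-pos i j i≢j P P∈△) in
    ∀ m → coordinates (T i j i≢j P P∈△) m ≈ homogeneous i j i≢j P m * d⁻¹
  coordinates-T i j i≢j P P∈△ 0F = trans (+-congʳ (+-congʳ (trans (sym (inverse-* d 0<d)) (*-comm _ d))))
    (solve 4 (λ d e m n → d :* e :- m :* e :- n :* e := (d :- m :- n) :* e) refl d (inverse d 0<d) _ _)
    where
    d = denominator i j i≢j P
    0<d = denominator-pos i j i≢j P P∈△
  coordinates-T i j i≢j P P∈△ 1F = refl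
  coordinates-T i j i≢j P P∈△ 2F = refl

  -- T (i , j) subtracts the j-th coordinate from the i-th one and rescales.
  homogeneous-subtract : ∀ {i j h} → Permutation i j h → ∀ i≢j P → let C = coordinates P ; H = homogeneous i j i≢j P in
    H i ≈ C i - C j × H j ≈ C j × H h ≈ C h
  homogeneous-subtract ⟨012⟩ _ (x , y) =
    solve 3 (λ x y o → o :- x :- x :- y := o :- x :- y :- x) refl x y 1# , refl , refl
  homogeneous-subtract ⟨021⟩ _ (x , y) =
    solve 3 (λ x y o → o :- y :- x :- y := o :- x :- y :- y) refl x y 1# , refl , refl
  homogeneous-subtract ⟨102⟩ _ (x , y) =
    trans (+-congʳ (+-congʳ (2*≈+ x))) (solve 3 (λ x y o → x :+ x :+ y :- o := x :- (o :- x :- y)) refl x y 1#) ,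
    trans (+-congʳ (+-congˡ (-‿cong (+-congʳ (+-congʳ (2*≈+ x))))))
      (solve 3 (λ x y o → (x :+ y) :- (x :+ x :+ y :- o) :- y := o :- x :- y) refl x y 1#) , refl
  homogeneous-subtract ⟨120⟩ _ (x , y) =
    refl , refl , solve 3 (λ x y o → o :- y :- (x :- y) :- y := o :- x :- y) refl x y 1#
  homogeneous-subtract ⟨201⟩ _ (x , y) =
    trans (+-congʳ (+-congˡ (2*≈+ y))) (solve 3 (λ x y o → x :+ (y :+ y) :- o := y :- (o :- x :- y)) refl x y 1#) ,
    trans (+-congˡ (-‿cong (+-congʳ (+-congˡ (2*≈+ y)))))
      (solve 3 (λ x y o → (x :+ y) :- x :- (x :+ (y :+ y) :- o) := o :- x :- y) refl x y 1#) , refl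
  homogeneous-subtract ⟨210⟩ _ (x , y) =
    refl , refl , solve 3 (λ x y o → o :- x :- x :- (y :- x) := o :- x :- y) refl x y 1#

-- Comparing weights and finding the maximal pair

module Weights (ℝ : RealNumbers c ℓ₁ ℓ₂) (K : RealCubicField ℝ ℓ₃) (p q : ℕ) .{{_ : NonZero q}} where
  open RealProperties ℝ
  open RealCubicField K
  open FieldProperties ℝ K
  open Approximation ℝ K using (inverse-∈; *-cancel-0; 1/-cancel)
  open Projective ℝ
  open RationalProperties using (∣∣-pos; reciprocal-mono; reciprocal-inverse)
  open Algorithm ℝ K p q

  -- The norms of `x` and of its inverse multiply to the norm of 1.
  norm≢0 : ∀ {x} (x∈K : Member x) → ¬ (x ≈ 0#) → norm x∈K ≢ 0ℚ
  norm≢0 {x} x∈K x≉0 N≡0 = contradiction (≡.trans (≡.sym (norm-1 1-∈))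
      (≡.trans (norm-cong 1-∈ xy∈K (sym xy≈1)) (≡.trans (norm-* x∈K y∈K xy∈K)
        (≡.trans (≡.cong (norm y∈K ℚ.*_) N≡0) (ℚ.*-zeroʳ (norm y∈K)))))) λ ()
    where
    y∈K = proj₁ (proj₂ (inv-∈ x∈K x≉0))
    xy≈1 = proj₂ (proj₂ (inv-∈ x∈K x≉0))
    xy∈K = *-∈ x∈K y∈K

  -- x ≺ y is a scale-invariant sufficient condition for x ^ r / |N x| < y ^ r / |N y|.
  record _≺_ {x y : Carrier} (x∈K : Member x) (y∈K : Member y) : Set ℓ₂ where
    constructor lighter
    field
      κ    : ℚ
      1≤κ  : 1ℚ ℚ.≤ κ
      real : x ^ p ≤ ι κ * y ^ p
      norms : κ ℚ.* ℚ.∣ norm y∈K ∣ ℚ.< ℚ.∣ norm x∈K ∣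

  -- Both conditions are homogeneous: t ^ p is a common factor of the real sizes and |N t| of the
  -- norms, and `κ` stays the same.
  ≺-scale : ∀ {t x y x′ y′} (t∈K : Member t) {x∈K : Member x} {y∈K : Member y} (x′∈K : Member x′) (y′∈K : Member y′) →
    0# < t → x′ ≈ t * x → y′ ≈ t * y → x∈K ≺ y∈K → x′∈K ≺ y′∈K
  ≺-scale {t} {x} {y} {x′} {y′} t∈K {x∈K} {y∈K} x′∈K y′∈K 0<t x′≈ y′≈ x≺y = record
    { κ = κ ; 1≤κ = 1≤κ
    ; real = ≤-respˡ-≈ (trans (sym (^-distrib-* t x p)) (^-congˡ p (sym x′≈)))
        (≤-respʳ-≈ (trans (solve 3 (λ a b c → a :* (b :* c) := b :* (a :* c)) refl (t ^ p) (ι κ) (y ^ p))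
          (*-congˡ (trans (sym (^-distrib-* t y p)) (^-congˡ p (sym y′≈)))))
          (*-monoˡ-≤ (<⇒≤ (^-pos p 0<t)) real))
    ; norms = ≡.subst₂ ℚ._<_
        (≡.trans (ℚ.*-assoc κ ℚ.∣ norm y∈K ∣ ∣t∣) (≡.cong (κ ℚ.*_) (scaled y∈K y′∈K y′≈)))
        (scaled x∈K x′∈K x′≈)
        (ℚ.*-monoˡ-<-pos ∣t∣ norms)
    }
    where
    open _≺_ x≺y
    ∣t∣ = ℚ.∣ norm t∈K ∣
    scaled : ∀ {w w′} (w∈K : Member w) (w′∈K : Member w′) → w′ ≈ t * w → ℚ.∣ norm w∈K ∣ ℚ.* ∣t∣ ≡ ℚ.∣ norm w′∈K ∣
    scaled w∈K w′∈K w′≈ = ≡.trans (≡.sym (ℚ.∣p*q∣≡∣p∣*∣q∣ (norm w∈K) (norm t∈K)))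
      (≡.cong ℚ.∣_∣ (≡.trans (≡.sym (norm-* t∈K w∈K (*-∈ t∈K w∈K))) (norm-cong (*-∈ t∈K w∈K) w′∈K (sym w′≈))))
    instance
      pos : ℚ.Positive ∣t∣
      pos = ℚ.positive (∣∣-pos (norm≢0 t∈K (λ t≈0 → <-irrefl (sym t≈0) 0<t)))

  norm-pos : ∀ {x} (x∈K : Member x) → 0# < x → norm x∈K ≢ 0ℚ
  norm-pos x∈K 0<x = norm≢0 x∈K (λ x≈0 → <-irrefl (sym x≈0) 0<x)

  -- The factor `κ` that may be lost between the powers `y` and `z` is regained between the
  -- reciprocal norms `a` and `b`.
  weigh : ∀ {x y z κ a b} → 0# < x → 0# < z → 0# ≤ ι a → y ≤ ι κ * z → κ ℚ.* a ℚ.< b → x * y * ι a < x * z * ι b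
  weigh {x} {y} {z} {κ} {a} {b} 0<x 0<z 0≤a y≤κz κa<b = ≤-<-trans
    (*-monoʳ-≤ 0≤a (*-monoˡ-≤ (<⇒≤ 0<x) y≤κz))
    (<-respˡ-≈ (trans (*-congʳ (ι.*-homo κ a)) (solve 4 (λ x z k a → k :* a :* (x :* z) := x :* (k :* z) :* a) refl x z (ι κ) (ι a)))
      (<-respʳ-≈ (*-comm (ι b) (x * z)) (*-monoʳ-< (*-pos 0<x 0<z) (ι-mono-< κa<b))))

  module _ {P : Point} (P∈Δ-K : Δ-K P) where
    open Δ-K P∈Δ-K

    private
      w : Fin 3 → Carrier
      w i = power (coordinate i) (coordinate-pos i) p q
      0<w : ∀ i → 0# < w i
      0<w i = power-pos (coordinate i) (coordinate-pos i) p q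
      N : Fin 3 → ℚ
      N i = norm (coordinate-∈ i)
      g : Fin 3 → Fin 3 → ℚ
      g i j = reciprocal ℚ.∣ N i ℚ.* N j ∣

    v-comm : ∀ i j → v i j ≈ v j i
    v-comm i j = *-cong (*-comm (w i) (w j)) (reflexive (≡.cong (λ n → ι (reciprocal ℚ.∣ n ∣)) (ℚ.*-comm (N i) (N j))))

    v-mono : ∀ i {h j} → coordinate-∈ h ≺ coordinate-∈ j → v i h < v i j
    v-mono i {h} {j} h≺j = weigh {w i} {w h} {w j} {κ} (0<w i) (0<w j) 0≤g
      (power-mono-≤ (coordinate-pos h) (coordinate-pos j) p q (≤-respˡ-≈ ι.1#-homo (ι-mono-≤ 1≤κ)) real) κg<g
      where
      open _≺_ h≺j
      nz : ∀ i → N i ≢ 0ℚ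
      nz i = norm-pos (coordinate-∈ i) (coordinate-pos i)
      κg<g : κ ℚ.* g i h ℚ.< g i j
      κg<g = reciprocal-mono {κ} (nz i) (nz h) (nz j) norms
      0≤g : 0# ≤ ι (g i h)
      0≤g = <⇒≤ (ι-pos (proj₂ (reciprocal-inverse (∣∣-pos (λ e → nz h (*-cancel-0 (nz i) (≡.trans (ℚ.*-comm (N h) (N i)) e)))))))

    v-monoˡ : ∀ {h i j} → coordinate-∈ h ≺ coordinate-∈ j → v h i < v i j
    v-monoˡ {h} {i} {j} h≺j = <-respˡ-≈ {v i j} {v i h} {v h i} (v-comm i h) (v-mono i {h} {j} h≺j)

    v-monoʳ : ∀ {h i j} → coordinate-∈ h ≺ coordinate-∈ i → v j h < v i j
    v-monoʳ {h} {i} {j} h≺i = <-respʳ-≈ {v j h} {v j i} {v i j} (v-comm j i) (v-mono j {h} {i} h≺i)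

    v-monoˡʳ : ∀ {h i j} → coordinate-∈ h ≺ coordinate-∈ i → v h j < v i j
    v-monoˡʳ {h} {i} {j} h≺i = <-respˡ-≈ {v i j} {v j h} {v h j} (v-comm j h) (v-monoʳ {h} {i} {j} h≺i)

    -- Every competing pair arises from i, j by putting `h`, the index of smallest weight, in place
    -- of one of them, which lowers `v`.
    maximum-intro : ∀ {i j h} → Permutation i j h → coordinate-∈ h ≺ coordinate-∈ i → coordinate-∈ h ≺ coordinate-∈ j →
      ∀ k l → k ≢ l → (k , l) ≢ (i , j) → (k , l) ≢ (j , i) → v k l < v i j
    maximum-intro {i} {j} {h} π h≺i h≺j = remaining-pairs π (λ k l → v k l < v i j)
      (v-mono i {h} {j} h≺j) (v-monoˡ {h} {i} {j} h≺j) (v-monoʳ {h} {i} {j} h≺i) (v-monoˡʳ {h} {i} {j} h≺i)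

    △-intro : ∀ {i j h} → Permutation i j h → (i≢j : i ≢ j) → coordinates P j < coordinates P i → △ i j i≢j P
    △-intro π i≢j cⱼ<cᵢ = (<⇒≤ α-pos , <⇒≤ β-pos , <⇒≤ α+β<1) , half-intro π i≢j P cⱼ<cᵢ

    ε-intro : ∀ {i j h} → Permutation i j h → i ≢ j →
      coordinate-∈ h ≺ coordinate-∈ i → coordinate-∈ h ≺ coordinate-∈ j → coordinates P j < coordinates P i → ε-K P ≡⟨ i , j ⟩
    ε-intro {i} {j} {h} π i≢j h≺i h≺j cⱼ<cᵢ = record
      { i≢j = i≢j ; P∈Δ-K = P∈Δ-K ; maximum = maximum-intro π h≺i h≺j ; P∈△ = △-intro π i≢j cⱼ<cᵢ }

  record Represents (P : Point) (e : Vector Carrier 3) : Set (c ⊔ ℓ₁ ⊔ ℓ₂ ⊔ ℓ₃) where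
    field
      e∈K  : ∀ m → Member (e m)
      0<e  : ∀ m → 0# < e m
      free : ∀ a → comb a e ≈ 0# → ∀ m → a m ≡ 0ℚ
      scale   : Carrier
      0<scale : 0# < scale
      coordinates≈ : ∀ m → coordinates P m ≈ scale * e m

    private
      total = e 0F + e 1F + e 2F
      0<total : 0# < total
      0<total = +-pos (+-pos (0<e 0F) (0<e 1F)) (0<e 2F)
      sum≈1 : coordinates P 0F + coordinates P 1F + coordinates P 2F ≈ 1#
      sum≈1 = solve 3 (λ o x y → o :- x :- y :+ x :+ y := o) refl 1# (proj₁ P) (proj₂ P)

    -- The coordinates of `P` sum to 1, so the scale is the inverse of the sum of `e`.
    scale∈K : Member scale
    scale∈K = ∈-resp-≈ (sym (trans (*-inverse-cancel (trans (*-comm _ _) (inverse-* total 0<total))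
      (trans (solve 4 (λ s x y z → s :* (x :+ y :+ z) := s :* x :+ s :* y :+ s :* z) refl scale (e 0F) (e 1F) (e 2F))
        (trans (+-cong (+-cong (sym (coordinates≈ 0F)) (sym (coordinates≈ 1F))) (sym (coordinates≈ 2F))) sum≈1)))
      (*-identityˡ _))) (inverse-∈ (+-∈ (+-∈ (e∈K 0F) (e∈K 1F)) (e∈K 2F)) 0<total)

    coordinates-pos : ∀ m → 0# < coordinates P m
    coordinates-pos m = <-respʳ-≈ (sym (coordinates≈ m)) (*-pos 0<scale (0<e m))

    P∈Δ-K : Δ-K P
    P∈Δ-K = record
      { α-∈ = ∈-resp-≈ (sym (coordinates≈ 1F)) (*-∈ scale∈K (e∈K 1F))
      ; β-∈ = ∈-resp-≈ (sym (coordinates≈ 2F)) (*-∈ scale∈K (e∈K 2F))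
      ; independent = independent
      ; α-pos = coordinates-pos 1F
      ; β-pos = coordinates-pos 2F
      ; α+β<1 = (<-by (coordinates-pos 0F)
          (solve 3 (λ o x y → o :- (x :+ y) := o :- x :- y) refl 1# (proj₁ P) (proj₂ P)))
      }
      where
      independent : LinearlyIndependent (1# ∷ proj₁ P ∷ proj₂ P ∷ [])
      independent a Σ≈0 = λ { 0F → a₀≡0 ; 1F → drop (a 1F) (zeros 1F) ; 2F → drop (a 2F) (zeros 2F) }
        where
        -- As 1 is the sum of the three coordinates, the coefficient of 1 is added to all of them.
        a′ : Vector ℚ 3
        a′ = a 0F ∷ (a 1F ℚ.+ a 0F) ∷ (a 2F ℚ.+ a 0F) ∷ []
        scaled : scale * comb a′ e ≈ 0#
        scaled = begin
          scale * comb a′ e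
            ≈⟨ *-congˡ (+-cong (+-congˡ (*-congʳ (ι.+-homo _ _))) (*-congʳ (ι.+-homo _ _))) ⟩
          scale * (ι (a 0F) * e 0F + (ι (a 1F) + ι (a 0F)) * e 1F + (ι (a 2F) + ι (a 0F)) * e 2F)
            ≈⟨ solve 7 (λ s x y z a b c → s :* (a :* x :+ (b :+ a) :* y :+ (c :+ a) :* z) :=
                 a :* (s :* x :+ s :* y :+ s :* z) :+ b :* (s :* y) :+ c :* (s :* z)) refl
                 scale (e 0F) (e 1F) (e 2F) (ι (a 0F)) (ι (a 1F)) (ι (a 2F)) ⟩
          ι (a 0F) * (scale * e 0F + scale * e 1F + scale * e 2F) + ι (a 1F) * (scale * e 1F) + ι (a 2F) * (scale * e 2F)
            ≈⟨ +-cong (+-cong (*-congˡ (trans (+-cong (+-cong (sym (coordinates≈ 0F)) (sym (coordinates≈ 1F))) (sym (coordinates≈ 2F))) sum≈1))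
                 (*-congˡ (sym (coordinates≈ 1F)))) (*-congˡ (sym (coordinates≈ 2F))) ⟩
          comb a (1# ∷ proj₁ P ∷ proj₂ P ∷ []) ≈⟨ sum≈comb a (1# ∷ proj₁ P ∷ proj₂ P ∷ []) ⟨
          sum (λ i → ι (a i) * (1# ∷ proj₁ P ∷ proj₂ P ∷ []) i) ≈⟨ Σ≈0 ⟩
          0# ∎
          where open SetoidReasoning setoid
        zeros : ∀ m → a′ m ≡ 0ℚ
        zeros = free a′ (trans (*-inverse-cancel (trans (*-comm _ _) (inverse-* scale 0<scale)) (trans (*-comm _ _) scaled)) (zeroˡ _))
        a₀≡0 = zeros 0F
        drop : ∀ b → b ℚ.+ a 0F ≡ 0ℚ → b ≡ 0ℚ
        drop b e = ≡.trans (≡.sym (ℚ.+-identityʳ b)) (≡.trans (≡.cong (b ℚ.+_) (≡.sym a₀≡0)) e)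

-- Reduction of two steps to a triple of field elements

module TwoSteps (ℝ : RealNumbers c ℓ₁ ℓ₂) (K : RealCubicField ℝ ℓ₃) (p q : ℕ) .{{_ : NonZero q}} where
  open RealProperties ℝ
  open RealCubicField K
  open FieldProperties ℝ K
  open Approximation ℝ K using (span)
  open Projective ℝ
  open Algorithm ℝ K p q
  open Weights ℝ K p q

  ≺-resp-≈ : ∀ {x y x′ y′} {x∈K : Member x} {y∈K : Member y} (x′∈K : Member x′) (y′∈K : Member y′) →
    x′ ≈ x → y′ ≈ y → x∈K ≺ y∈K → x′∈K ≺ y′∈K
  ≺-resp-≈ x′∈K y′∈K x′≈x y′≈y = ≺-scale 1-∈ x′∈K y′∈K 0<1
    (trans x′≈x (sym (*-identityˡ _))) (trans y′≈y (sym (*-identityˡ _)))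

  ε-represents : ∀ {P e k l m} (R : Represents P e) → let open Represents R in Permutation k l m → k ≢ l →
    e∈K m ≺ e∈K k → e∈K m ≺ e∈K l → e l < e k → ε-K P ≡⟨ k , l ⟩
  ε-represents {P} {e} {k} {l} {m} R π k≢l m≺k m≺l eₗ<eₖ = ε-intro P∈Δ-K π k≢l
    (scaled k m≺k) (scaled l m≺l)
    (<-respˡ-≈ (sym (coordinates≈ l)) (<-respʳ-≈ (sym (coordinates≈ k))
      (<-respˡ-≈ (*-comm _ _) (<-respʳ-≈ (*-comm _ _) (*-monoʳ-< 0<scale eₗ<eₖ)))))
    where
    open Represents R
    open Δ-K P∈Δ-K using (coordinate; coordinate-∈)
    coordinate≈ : ∀ m → coordinate m ≈ scale * e m
    coordinate≈ 0F = coordinates≈ 0F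
    coordinate≈ 1F = coordinates≈ 1F
    coordinate≈ 2F = coordinates≈ 2F
    scaled : ∀ k → e∈K m ≺ e∈K k → coordinate-∈ m ≺ coordinate-∈ k
    scaled k = ≺-scale scale∈K (coordinate-∈ m) (coordinate-∈ k) 0<scale (coordinate≈ m) (coordinate≈ k)

  represent : ∀ {e} → (∀ m → Member (e m)) → (∀ m → 0# < e m) → (∀ a → comb a e ≈ 0# → ∀ m → a m ≡ 0ℚ) →
    ∃[ P ] Represents P e
  represent {e} e∈K 0<e free = (scale * e 1F , scale * e 2F) , record
    { e∈K = e∈K ; 0<e = 0<e ; free = free ; scale = scale ; 0<scale = inverse-pos 0<total
    ; coordinates≈ = λ
      { 0F → trans (+-congʳ (+-congʳ (sym (inverse-* total 0<total))))
          (solve 4 (λ s x y z → s :* (x :+ y :+ z) :- s :* y :- s :* z := s :* x) refl scale (e 0F) (e 1F) (e 2F))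
      ; 1F → refl
      ; 2F → refl } }
    where
    total = e 0F + e 1F + e 2F
    0<total : 0# < total
    0<total = +-pos (+-pos (0<e 0F) (0<e 1F)) (0<e 2F)
    scale = inverse total 0<total

  comb-place : ∀ {i j h} (π : Permutation i j h) α x y z → comb α (place π x y z) ≈ span x y z (α i) (α j) (α h)
  comb-place ⟨012⟩ α x y z = refl
  comb-place ⟨021⟩ α x y z = solve 3 (λ x y z → x :+ z :+ y := x :+ y :+ z) refl (ι (α 0F) * x) (ι (α 2F) * y) (ι (α 1F) * z)
  comb-place ⟨102⟩ α x y z = solve 3 (λ x y z → y :+ x :+ z := x :+ y :+ z) refl (ι (α 1F) * x) (ι (α 0F) * y) (ι (α 2F) * z)
  comb-place ⟨120⟩ α x y z = solve 3 (λ x y z → z :+ x :+ y := x :+ y :+ z) refl (ι (α 1F) * x) (ι (α 2F) * y) (ι (α 0F) * z)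
  comb-place ⟨201⟩ α x y z = solve 3 (λ x y z → y :+ z :+ x := x :+ y :+ z) refl (ι (α 2F) * x) (ι (α 0F) * y) (ι (α 1F) * z)
  comb-place ⟨210⟩ α x y z = solve 3 (λ x y z → z :+ y :+ x := x :+ y :+ z) refl (ι (α 2F) * x) (ι (α 1F) * y) (ι (α 0F) * z)

  Free : (x y z : Carrier) → Set ℓ₁
  Free x y z = ∀ {a b c} → span x y z a b c ≈ 0# → a ≡ 0ℚ × b ≡ 0ℚ × c ≡ 0ℚ

  place-free : ∀ {i j h x y z} (π : Permutation i j h) → Free x y z → ∀ α → comb α (place π x y z) ≈ 0# → ∀ m → α m ≡ 0ℚ
  place-free {x = x} {y} {z} π free α e m with free (trans (sym (comb-place π α x y z)) e) | cover π m
  ... | αᵢ≡0 , _ , _ | inj₁ ≡.refl        = αᵢ≡0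
  ... | _ , αⱼ≡0 , _ | inj₂ (inj₁ ≡.refl) = αⱼ≡0
  ... | _ , _ , αₕ≡0 | inj₂ (inj₂ ≡.refl) = αₕ≡0

  record Triple (x y z : Carrier) : Set (c ⊔ ℓ₁ ⊔ ℓ₂ ⊔ ℓ₃) where
    field
      x∈K  : Member x
      y∈K  : Member y
      z∈K  : Member z
      0<x  : 0# < x
      0<y  : 0# < y
      0<z  : 0# < z
      free : Free x y z

  sum-triple : ∀ {x y z} → Triple x y z → Triple (x + y) y z
  sum-triple {x} {y} {z} t = record
    { x∈K = +-∈ x∈K y∈K ; y∈K = y∈K ; z∈K = z∈K ; 0<x = +-pos 0<x 0<y ; 0<y = 0<y ; 0<z = 0<z
    ; free = λ {a} {b} {c} e →
        let a≡0 , a+b≡0 , c≡0 = free {a} {b ℚ.+ a} {c} (trans (+-congʳ (+-congˡ (*-congʳ (ι.+-homo b a))))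
              (trans (solve 6 (λ a b c x y z → a :* x :+ (b :+ a) :* y :+ c :* z := a :* (x :+ y) :+ b :* y :+ c :* z)
                refl (ι a) (ι b) (ι c) x y z) e))
        in a≡0 , ≡.trans (≡.sym (ℚ.+-identityʳ b)) (≡.trans (≡.cong (b ℚ.+_) (≡.sym a≡0)) a+b≡0) , c≡0
    }
    where open Triple t

  module _ {i j h x y z} (π : Permutation i j h) (t : Triple x y z) where
    open Triple t

    represents-place : ∀ {P} s → 0# < s → (∀ m → coordinates P m ≈ s * place π x y z m) → Represents P (place π x y z)
    represents-place s 0<s e = record
      { e∈K = place-all Member π x∈K y∈K z∈K ; 0<e = place-all (0# <_) π 0<x 0<y 0<z
      ; free = place-free π free ; scale = s ; 0<scale = 0<s ; coordinates≈ = e }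

    represent-place : ∃[ P ] Represents P (place π x y z)
    represent-place = represent (place-all Member π x∈K y∈K z∈K) (place-all (0# <_) π 0<x 0<y 0<z) (place-free π free)

  represents-T : ∀ {i j h x y z} (π : Permutation i j h) (t : Triple x y z) → ∀ {P} → Represents P (place π (x + y) y z) →
    ∀ i≢j (P∈△ : △ i j i≢j P) → Represents (T i j i≢j P P∈△) (place π x y z)
  represents-T {i} {j} {h} {x} {y} {z} π t {P} R i≢j P∈△ = represents-place π t (scale * d⁻¹) (*-pos 0<scale (inverse-pos 0<d)) coords
    where
    open Represents R
    d = denominator i j i≢j P
    0<d : 0# < d
    0<d = denominator-pos i j i≢j P P∈△
    d⁻¹ = inverse d 0<d
    H = homogeneous i j i≢j P

    rescale : ∀ m {w w′} → w ≡ w′ → H m ≈ scale * w′ → H m * d⁻¹ ≈ scale * d⁻¹ * w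
    rescale m {w} ≡.refl e = trans (*-congʳ e) (solve 3 (λ s w d → s :* w :* d := s :* d :* w) refl scale w d⁻¹)

    coordinates-at : ∀ {m w} → place π (x + y) y z m ≡ w → coordinates P m ≈ scale * w
    coordinates-at {m} ≡.refl = coordinates≈ m

    subtracted = homogeneous-subtract π i≢j P
    at = place-lookup π x y z
    at′ = place-lookup π (x + y) y z

    Hᵢ : H i ≈ scale * x
    Hᵢ = trans (proj₁ subtracted) (trans (+-cong (coordinates-at (proj₁ at′)) (-‿cong (coordinates-at (proj₁ (proj₂ at′)))))
      (solve 3 (λ s x y → s :* (x :+ y) :- s :* y := s :* x) refl scale x y))

    coords : ∀ m → coordinates (T i j i≢j P P∈△) m ≈ scale * d⁻¹ * place π x y z m
    coords m = trans (coordinates-T i j i≢j P P∈△ m) (at-m (cover π m))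
      where
      at-m : m ≡ i ⊎ m ≡ j ⊎ m ≡ h → H m * d⁻¹ ≈ scale * d⁻¹ * place π x y z m
      at-m (inj₁ ≡.refl)        = rescale m (proj₁ at) Hᵢ
      at-m (inj₂ (inj₁ ≡.refl)) = rescale m (proj₁ (proj₂ at)) (trans (proj₁ (proj₂ subtracted)) (coordinates-at (proj₁ (proj₂ at′))))
      at-m (inj₂ (inj₂ ≡.refl)) = rescale m (proj₂ (proj₂ at)) (trans (proj₂ (proj₂ subtracted)) (coordinates-at (proj₂ (proj₂ at′))))

  ε-place : ∀ {i j h x y z P} (π : Permutation i j h) (t : Triple x y z) → let open Triple t in i ≢ j →
    Represents P (place π x y z) → z∈K ≺ x∈K → z∈K ≺ y∈K → y < x → ε-K P ≡⟨ i , j ⟩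
  ε-place {i} {j} {h} {x} {y} {z} π t i≢j R z≺x z≺y y<x = ε-represents R π i≢j
    (≺-resp-≈ (e∈K h) (e∈K i) eₕ eᵢ z≺x) (≺-resp-≈ (e∈K h) (e∈K j) eₕ eⱼ z≺y)
    (<-respˡ-≈ (sym eⱼ) (<-respʳ-≈ (sym eᵢ) y<x))
    where
    open Represents R
    eᵢ = reflexive (proj₁ (place-lookup π x y z))
    eⱼ = reflexive (proj₁ (proj₂ (place-lookup π x y z)))
    eₕ = reflexive (proj₂ (proj₂ (place-lookup π x y z)))

  -- The starting point is built backwards: `sum-triple` undoes the subtraction, and y < x + y,
  -- which decides for (i , j) against (j , i), is automatic. `next` ranges over all points because
  -- only proportions matter.
  two-steps : ∀ {i j h x y z k l} (π : Permutation i j h) (t : Triple x y z) → let open Triple t in i ≢ j →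
    z∈K ≺ +-∈ x∈K y∈K → z∈K ≺ y∈K → (∀ {P} → Represents P (place π x y z) → ε-K P ≡⟨ k , l ⟩) →
    ∃ λ P → Σ (ε-K P ≡⟨ i , j ⟩) λ εP → ε-K (ε-K_≡⟨_,_⟩.T-K εP) ≡⟨ k , l ⟩
  two-steps {i} {j} {h} {x} {y} {z} {k} {l} π t i≢j z≺x+y z≺y next =
    P , εP , next (represents-T π t R (ε-K_≡⟨_,_⟩.i≢j εP) (ε-K_≡⟨_,_⟩.P∈△ εP))
    where
    open Triple t
    P = proj₁ (represent-place π (sum-triple t))
    R = proj₂ (represent-place π (sum-triple t))
    y<x+y : y < x + y
    y<x+y = <-by 0<x (solve 2 (λ x y → x :+ y :- y := x) refl x y)
    εP : ε-K P ≡⟨ i , j ⟩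
    εP = ε-place π (sum-triple t) i≢j R z≺x+y z≺y y<x+y

  transpose-triple : ∀ {x y z} → Triple x y z → Triple y x z
  transpose-triple {x} {y} {z} t = record
    { x∈K = y∈K ; y∈K = x∈K ; z∈K = z∈K ; 0<x = 0<y ; 0<y = 0<x ; 0<z = 0<z
    ; free = λ e → let a , b , c = free (trans (+-congʳ (+-comm _ _)) e) in b , a , c }
    where open Triple t

  cycle-triple : ∀ {x y z} → Triple x y z → Triple y z x
  cycle-triple {x} {y} {z} t = record
    { x∈K = y∈K ; y∈K = z∈K ; z∈K = x∈K ; 0<x = 0<y ; 0<y = 0<z ; 0<z = 0<x
    ; free = λ e → let a , b , c = free (trans (trans (+-assoc _ _ _) (+-comm _ _)) e) in b , c , a }
    where open Triple t

  -- Permuting indices and elements together leaves `place` unchanged; once `π` is known the two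
  -- vectors agree by computation.
  represents-transpose : ∀ {i j h P x y z} (π : Permutation i j h) → Represents P (place π x y z) → Represents P (place (transpose π) y x z)
  represents-transpose ⟨012⟩ R = R
  represents-transpose ⟨021⟩ R = R
  represents-transpose ⟨102⟩ R = R
  represents-transpose ⟨120⟩ R = R
  represents-transpose ⟨201⟩ R = R
  represents-transpose ⟨210⟩ R = R

  represents-cycle : ∀ {i j h P x y z} (π : Permutation i j h) → Represents P (place π x y z) → Represents P (place (cycle π) y z x)
  represents-cycle ⟨012⟩ R = R
  represents-cycle ⟨021⟩ R = R
  represents-cycle ⟨102⟩ R = R
  represents-cycle ⟨120⟩ R = R
  represents-cycle ⟨201⟩ R = R
  represents-cycle ⟨210⟩ R = R

-- How close to 1 the real sizes have to be

module Margin (ℝ : RealNumbers c ℓ₁ ℓ₂) where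
  open RealProperties ℝ

  -- Any rational strictly between 1 and 99/91 would do for `κ`: the tightest gap between the norm
  -- bounds is 99 for `z` against 91 for `x + y`, in the first configuration.
  κ 8ℚ : ℚ
  κ = + 21 ℚ./ 20
  8ℚ = + 8 ℚ./ 1

  1^ : ∀ n → 1# ^ n ≈ 1#
  1^ ℕ.zero    = refl
  1^ (ℕ.suc n) = trans (*-identityˡ _) (1^ n)

  -- The bounds in `similar` are one-sided so that its second element may be `x + y`, whose size is
  -- about 2.
  record Similarity (p : ℕ) : Set (c ⊔ ℓ₁ ⊔ ℓ₂) where
    field
      ν   : ℚ
      0<ν : 0ℚ ℚ.< ν
    lo : Carrier
    lo = ι 1ℚ - ι 8ℚ * ι ν
    hi : Carrier
    hi = ι 1ℚ + ι 8ℚ * ι ν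
    field
      0<lo    : 0# < lo
      similar : ∀ {x y} → 0# ≤ x → x ≤ hi → lo ≤ y → x ^ p ≤ ι κ * y ^ p

  -- Take ρ > 1 with ρ ^ p < κ; the condition 8 ν (ρ + 1) < ρ - 1 then says that hi < ρ lo.
  similarity : ∀ p → Similarity p
  similarity p = record
    { ν = ν ; 0<ν = proj₁ (proj₂ small-ν) ; 0<lo = 0<lo
    ; similar = λ {x} {y} 0≤x x≤hi lo≤y → ≤-trans (^-mono-≤ p 0≤x (≤-trans x≤hi (≤-trans hi≤ρlo (*-monoˡ-≤ (<⇒≤ 0<ρ) lo≤y))))
        (≤-trans (≤-reflexive (^-distrib-* ρ y p)) (*-monoʳ-≤ (^-nonneg p (≤-trans (<⇒≤ 0<lo) lo≤y)) (<⇒≤ ρᵖ<κ)))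
    }
    where
    ρ-exists : ∃[ r ] 1# < ι r × ι r ^ p < ι κ
    ρ-exists = ^-increase p (<⇒≤ 0<1) (<-respˡ-≈ (trans ι.1#-homo (sym (1^ p))) (ι-mono-< (from-yes (1ℚ ℚ.<? κ))))
    ρ = ι (proj₁ ρ-exists)
    1<ρ : 1# < ρ
    1<ρ = proj₁ (proj₂ ρ-exists)
    ρᵖ<κ = proj₂ (proj₂ ρ-exists)
    0<ρ = <-trans 0<1 1<ρ
    0≤8[ρ+1] : 0# ≤ ι 8ℚ * (ρ + 1#)
    0≤8[ρ+1] = <⇒≤ (*-pos (ι-pos (from-yes (0ℚ ℚ.<? 8ℚ))) (+-pos 0<ρ 0<1))
    small-ν : ∃[ ν ] 0ℚ ℚ.< ν × ι ν * (ι 8ℚ * (ρ + 1#)) < ρ - 1#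
    small-ν = small 0≤8[ρ+1] (<⇒0<- 1<ρ)
    ν = proj₁ small-ν
    lo hi : Carrier
    lo = ι 1ℚ - ι 8ℚ * ι ν
    hi = ι 1ℚ + ι 8ℚ * ι ν
    hi<ρlo : hi < ρ * lo
    hi<ρlo = <-moveʳ (trans (+-congʳ (+-congˡ (-‿cong (sym ι.1#-homo)))) (trans (+-congˡ (-‿cong (*-congˡ (*-congˡ (+-congˡ (sym ι.1#-homo))))))
      (solve 2 (λ r n → (r :- con 1ℚ) :- n :* (con 8ℚ :* (r :+ con 1ℚ)) :=
        r :* (con 1ℚ :- con 8ℚ :* n) :- (con 1ℚ :+ con 8ℚ :* n)) refl ρ (ι ν)))) (proj₂ (proj₂ small-ν))
    hi≤ρlo = <⇒≤ hi<ρlo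
    0<hi : 0# < hi
    0<hi = +-pos (ι-pos (ℚ.positive⁻¹ 1ℚ)) (*-pos (ι-pos (from-yes (0ℚ ℚ.<? 8ℚ))) (ι-pos (proj₁ (proj₂ small-ν))))
    0<lo : 0# < lo
    0<lo = *-cancel-pos (<-respʳ-≈ (*-comm ρ lo) (<-trans 0<hi hi<ρlo)) (<⇒≤ 0<ρ)

-- Triples with prescribed real sizes and norms

module Configurations (ℝ : RealNumbers c ℓ₁ ℓ₂) (K : RealCubicField ℝ ℓ₃) (p q : ℕ) .{{_ : NonZero q}} where
  open RealProperties ℝ
  open RealCubicField K
  open FieldProperties ℝ K
  open Approximation ℝ K
  open Weights ℝ K p q using (_≺_)
  open TwoSteps ℝ K p q
  open Margin ℝ

  -- Each target pair compares `y` with either `x` or `z`, so it is enough that `y` can be made the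
  -- largest or the smallest of the three.
  Ordered : Bool → (x y z : Carrier) → Set ℓ₂
  Ordered true  x y z = x < y × z < y
  Ordered false x y z = y < x × y < z

  4ℚ 17ℚ 18ℚ 19ℚ : ℚ
  4ℚ = + 4 ℚ./ 1
  17ℚ = + 17 ℚ./ 1
  18ℚ = + 18 ℚ./ 1
  19ℚ = + 19 ℚ./ 1

  -- Up to g, the norms of x, y, z and x + y are u₁², u₂², u₃² and 2 (u₁ + u₂)², with an
  -- allowance of 1 for errors and of factors 3/2 and 5/4 for the shift separating y
  -- from x and z.
  record Configuration (u₁ u₂ u₃ : ℚ) (σ : Bool) : Set (c ⊔ ℓ₁ ⊔ ℓ₂ ⊔ ℓ₃) where
    field
      {x y z} : Carrier
      triple  : Triple x y z
    open Triple triple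
    field
      ordered : Ordered σ x y z
      x~y : x ^ p ≤ ι κ * y ^ p
      x~z : x ^ p ≤ ι κ * z ^ p
      z~x : z ^ p ≤ ι κ * x ^ p
      z~y : z ^ p ≤ ι κ * y ^ p
      z~x+y : z ^ p ≤ ι κ * (x + y) ^ p
      g : ℚ
      0<g : 0ℚ ℚ.< g
      x-lower : (ℚ.∣ u₁ ℚ.* u₁ ∣ ℚ.- 1ℚ) ℚ.* g ℚ.≤ ℚ.∣ norm x∈K ∣
      x-upper : ℚ.∣ norm x∈K ∣ ℚ.≤ (ℚ.∣ u₁ ℚ.* u₁ ∣ ℚ.+ 1ℚ) ℚ.* g
      y-upper : ℚ.∣ norm y∈K ∣ ℚ.≤ (ℚ.∣ u₂ ℚ.* u₂ ∣ ℚ.* (+ 3 ℚ./ 2) ℚ.+ 1ℚ) ℚ.* g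
      z-lower : (ℚ.∣ u₃ ℚ.* u₃ ∣ ℚ.- 1ℚ) ℚ.* g ℚ.≤ ℚ.∣ norm z∈K ∣
      z-upper : ℚ.∣ norm z∈K ∣ ℚ.≤ (ℚ.∣ u₃ ℚ.* u₃ ∣ ℚ.+ 1ℚ) ℚ.* g
      x+y-upper : ℚ.∣ norm (+-∈ x∈K y∈K) ∣ ℚ.≤ (ℚ.∣ (u₁ ℚ.+ u₂) ℚ.* (u₁ ℚ.+ u₂) ∣ ℚ.* (+ 5 ℚ./ 2) ℚ.+ 1ℚ) ℚ.* g

  -- The factor `g` is common to all norm bounds; cancelling it leaves a comparison of closed
  -- rationals, decided by evaluation.
  ≺-intro : ∀ {x y} {x∈K : Member x} {y∈K : Member y} {g lower upper} → 0ℚ ℚ.< g → x ^ p ≤ ι κ * y ^ p →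
    lower ℚ.* g ℚ.≤ ℚ.∣ norm x∈K ∣ → ℚ.∣ norm y∈K ∣ ℚ.≤ upper ℚ.* g → κ ℚ.* upper ℚ.< lower → x∈K ≺ y∈K
  ≺-intro {x∈K = x∈K} {y∈K} {g} {lower} {upper} 0<g x~y lower≤ ≤upper κu<l = record
    { κ = κ ; 1≤κ = from-yes (1ℚ ℚ.≤? κ) ; real = x~y
    ; norms = begin-strict
        κ ℚ.* ℚ.∣ norm y∈K ∣  ≤⟨ ℚ.*-monoˡ-≤-nonNeg κ ≤upper ⟩
        κ ℚ.* (upper ℚ.* g)   ≡⟨ ℚ.*-assoc κ upper g ⟨
        κ ℚ.* upper ℚ.* g     <⟨ ℚ.*-monoˡ-<-pos g {{ℚ.positive 0<g}} κu<l ⟩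
        lower ℚ.* g           ≤⟨ lower≤ ⟩
        ℚ.∣ norm x∈K ∣        ∎
    }
    where open ℚ.≤-Reasoning

  open RationalProperties
  module S = Similarity (similarity p)
  open S using (ν; 0<ν; lo; hi; 0<lo; similar)
  n = ι ν
  0<n : 0# < n
  0<n = ι-pos 0<ν

  8ν<1 : 8ℚ ℚ.* ν ℚ.< 1ℚ
  8ν<1 = ι-cancel-< (<-moveʳ (trans (+-congˡ (trans (-‿cong (sym ι.0#-homo)) (sym (ι.-‿homo 0ℚ))))
    (trans (solve 1 (λ n → con 1ℚ :- con 8ℚ :* n :+ con (ℚ.- 0ℚ) := con 1ℚ :- con 8ℚ :* n) refl n)
      (+-congˡ (-‿cong (sym (ι.*-homo 8ℚ ν)))))) 0<lo)

  -- Since 17 · 19² + 19³ = 12996 and 8 ν < 1, the error in `error-bound` stays below 12996 / 32000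
  -- < 1/2.
  ε₀ ε : ℚ
  ε₀ = + 1 ℚ./ 4000
  ε = ε₀ ℚ.* ν

  0<ε : 0ℚ ℚ.< ε
  0<ε = *-pos-pos (ℚ.positive⁻¹ ε₀) 0<ν

  ε*-bound : ∀ k l → 0ℚ ℚ.≤ k → k ℚ.* ε₀ ℚ.≤ l ℚ.* 8ℚ → 0ℚ ℚ.< l → k ℚ.* ε ℚ.< l
  ε*-bound k l 0≤k kε₀≤8l 0<l = begin-strict
    k ℚ.* (ε₀ ℚ.* ν)   ≡⟨ ℚ.*-assoc k ε₀ ν ⟨
    k ℚ.* ε₀ ℚ.* ν     ≤⟨ ℚ.*-monoʳ-≤-nonNeg ν {{ℚ.nonNegative (ℚ.<⇒≤ 0<ν)}} kε₀≤8l ⟩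
    l ℚ.* 8ℚ ℚ.* ν     ≡⟨ ℚ.*-assoc l 8ℚ ν ⟩
    l ℚ.* (8ℚ ℚ.* ν)   <⟨ ℚ.*-monoʳ-<-pos l {{ℚ.positive 0<l}} 8ν<1 ⟩
    l ℚ.* 1ℚ           ≡⟨ ℚ.*-identityʳ l ⟩
    l                  ∎
    where open ℚ.≤-Reasoning

  ε≤½ : ε ℚ.≤ ½
  ε≤½ = ℚ.<⇒≤ (≡.subst (ℚ._< ½) (ℚ.*-identityˡ ε)
    (ε*-bound 1ℚ ½ (from-yes (0ℚ ℚ.≤? 1ℚ)) (from-yes (1ℚ ℚ.* ε₀ ℚ.≤? ½ ℚ.* 8ℚ)) (ℚ.positive⁻¹ ½)))

  17ε≤ν : 17ℚ ℚ.* ε ℚ.≤ ν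
  17ε≤ν = ≡.subst₂ ℚ._≤_ (ℚ.*-assoc 17ℚ ε₀ ν) (ℚ.*-identityˡ ν)
    (ℚ.*-monoʳ-≤-nonNeg ν {{ℚ.nonNegative (ℚ.<⇒≤ 0<ν)}} (from-yes (17ℚ ℚ.* ε₀ ℚ.≤? 1ℚ)))

  error-bound : ∀ {u v t s} → ℚ.∣ u ∣ ℚ.< 17ℚ → ℚ.∣ v ∣ ℚ.< 19ℚ → ℚ.∣ t ∣ ℚ.< ε → ℚ.∣ s ∣ ℚ.< ε →
    ℚ.∣ u ℚ.* v ℚ.* v ℚ.* t ℚ.+ v ℚ.* v ℚ.* v ℚ.* s ∣ ℚ.< ½
  error-bound {u} {v} {t} {s} u< v< t< s< = ℚ.<-trans
    (∣+∣-< {u ℚ.* v ℚ.* v ℚ.* t} (∣*∣-< {u ℚ.* v ℚ.* v} (∣*∣-< {u ℚ.* v} (∣*∣-< {u} u< v<) v<) t<)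
      (∣*∣-< {v ℚ.* v ℚ.* v} (∣*∣-< {v ℚ.* v} (∣*∣-< {v} v< v<) v<) s<))
    (≡.subst (ℚ._< ½) (ℚ.*-distribʳ-+ ε k₁ k₂)
      (ε*-bound (k₁ ℚ.+ k₂) ½ (from-yes (0ℚ ℚ.≤? k₁ ℚ.+ k₂)) (from-yes ((k₁ ℚ.+ k₂) ℚ.* ε₀ ℚ.≤? ½ ℚ.* 8ℚ)) (ℚ.positive⁻¹ ½)))
    where
    k₁ = 17ℚ ℚ.* 19ℚ ℚ.* 19ℚ
    k₂ = 19ℚ ℚ.* 19ℚ ℚ.* 19ℚ

  -- Real sizes are known up to ν for `x` and `y` and up to 2 ν for `z`. A shift of `y` by 4 ν
  -- exceeds the combined uncertainty, at most 3 ν, and keeps `y` within 8 ν of 1.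
  shift : Bool → ℚ
  shift true  = 4ℚ ℚ.* ν
  shift false = ℚ.- (4ℚ ℚ.* ν)

  ∣shift∣<½ : ∀ σ → ℚ.∣ shift σ ∣ ℚ.< ½
  ∣shift∣<½ σ = ≡.subst (ℚ._< ½) (≡.sym (∣shift∣ σ)) (≡.subst (ℚ._< ½)
      (≡.trans (≡.sym (ℚ.*-assoc ½ 8ℚ ν)) ≡.refl) (ℚ.*-monoʳ-<-pos ½ 8ν<1))
    where
    ∣shift∣ : ∀ σ → ℚ.∣ shift σ ∣ ≡ 4ℚ ℚ.* ν
    ∣shift∣ true  = ℚ.0≤p⇒∣p∣≡p (ℚ.<⇒≤ (*-pos-pos (ℚ.positive⁻¹ 4ℚ) 0<ν))
    ∣shift∣ false = ≡.trans (ℚ.∣-p∣≡∣p∣ (4ℚ ℚ.* ν)) (∣shift∣ true)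

  -- The bounds 18 leave room for the shift of less than 1/2, which turns them into 19. The last two
  -- hypotheses make `x` and `y` independent.
  module Construction {η} (η∈K : Member η) (A : Approximant η ε) (u₁ u₂ u₃ : ℚ) (σ : Bool)
    (∣u₁∣<17 : ℚ.∣ u₁ ∣ ℚ.< 17ℚ) (∣u₂∣<17 : ℚ.∣ u₂ ∣ ℚ.< 17ℚ) (∣u₃∣<17 : ℚ.∣ u₃ ∣ ℚ.< 17ℚ) (∣u₁+u₂∣<17 : ℚ.∣ u₁ ℚ.+ u₂ ∣ ℚ.< 17ℚ)
    (∣1-u₁∣<19 : ℚ.∣ 1ℚ ℚ.- u₁ ∣ ℚ.< 19ℚ) (∣1-u₂∣<18 : ℚ.∣ 1ℚ ℚ.- u₂ ∣ ℚ.< 18ℚ) (∣1-u₃∣<19 : ℚ.∣ 1ℚ ℚ.- u₃ ∣ ℚ.< 19ℚ)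
    (∣2-u₁-u₂∣<18 : ℚ.∣ 1ℚ ℚ.+ 1ℚ ℚ.- (u₁ ℚ.+ u₂) ∣ ℚ.< 18ℚ)
    (0<u₁ : 0ℚ ℚ.< u₁) (u₂≤½u₁ : u₂ ℚ.≤ ½ ℚ.* u₁) where

    open Approximant A
    private
      module ℚS = ℚ-Solver.+-*-Solver

      μ : ℚ
      μ = shift σ

      -- Parametrised so that `w` is the approximate real size and G u² w the approximate norm.
      elt : ℚ → ℚ → Carrier
      elt u w = ι u * ζ + ι (w ℚ.- u)

      elt-∈ : ∀ u w → Member (elt u w)
      elt-∈ u w = +-∈ (*-∈ (ι-∈ u) ζ∈K) (ι-∈ (w ℚ.- u))

      ι-- : ∀ a b → ι (a ℚ.- b) ≈ ι a - ι b
      ι-- a b = trans (ι.+-homo a _) (+-congˡ (ι.-‿homo b))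

      elt-size : ∀ {u} w → ℚ.∣ u ∣ ℚ.< 17ℚ → elt u w - ι w ∈± n
      elt-size {u} w ∣u∣<17 = ±-weaken (≤-respˡ-≈ (ι.*-homo 17ℚ ε) (ι-mono-≤ 17ε≤ν))
        (±-resp-≈ (trans (*-congˡ (+-congˡ (-‿cong (sym ι.1#-homo))))
          (trans (solve 3 (λ u w z → u :* (z :- con 1ℚ) := u :* z :+ (w :- u) :- w) refl (ι u) (ι w) ζ)
            (+-congʳ (+-congˡ (sym (ι-- w u))))))
          (±-* (±-ι ∣u∣<17) ζ-1∈±))

      Near : (b N X : ℚ) → Set
      Near b N X = ∃[ r ] ℚ.∣ r ∣ ℚ.< b × N ≡ G ℚ.* (X ℚ.+ r)

      elt-norm : ∀ {x} (x∈K : Member x) u w → x ≈ elt u w → ℚ.∣ u ∣ ℚ.< 17ℚ → ℚ.∣ w ℚ.- u ∣ ℚ.< 19ℚ →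
        Near ½ (norm x∈K) (u ℚ.* u ℚ.* w)
      elt-norm x∈K u w x≈ ∣u∣<17 ∣w-u∣<19 =
        u ℚ.* v ℚ.* v ℚ.* t ℚ.+ v ℚ.* v ℚ.* v ℚ.* s , error-bound ∣u∣<17 ∣w-u∣<19 ∣t∣<ε ∣s∣<ε ,
        ≡.trans (norm-ζ x∈K u v x≈) (≡.cong (λ w → G ℚ.* (u ℚ.* u ℚ.* w ℚ.+ (u ℚ.* v ℚ.* v ℚ.* t ℚ.+ v ℚ.* v ℚ.* v ℚ.* s)))
          (ℚS.solve 2 (λ u w → u ℚS.:+ (w ℚS.:- u) ℚS.:= w) ≡.refl u w))
        where v = w ℚ.- u

      g : ℚ
      g = ℚ.∣ G ∣
      0<g : 0ℚ ℚ.< g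
      0<g = ∣∣-pos G≢0
      instance
        g-nonNeg : ℚ.NonNegative g
        g-nonNeg = ℚ.nonNegative (ℚ.<⇒≤ 0<g)

      ½<1 : ½ ℚ.< 1ℚ
      ½<1 = from-yes (½ ℚ.<? 1ℚ)

      lower-bound : ∀ X {N} → Near 1ℚ N X → (ℚ.∣ X ∣ ℚ.- 1ℚ) ℚ.* g ℚ.≤ ℚ.∣ N ∣
      lower-bound X (r , r<1 , ≡.refl) = ≡.subst ((ℚ.∣ X ∣ ℚ.- 1ℚ) ℚ.* g ℚ.≤_)
        (≡.trans (ℚ.*-comm _ g) (≡.sym (ℚ.∣p*q∣≡∣p∣*∣q∣ G (X ℚ.+ r))))
        (ℚ.*-monoʳ-≤-nonNeg g (∣+∣-lower X r<1))

      upper-bound : ∀ X {N} → Near 1ℚ N X → ℚ.∣ N ∣ ℚ.≤ (ℚ.∣ X ∣ ℚ.+ 1ℚ) ℚ.* g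
      upper-bound X (r , r<1 , ≡.refl) = ≡.subst (ℚ._≤ (ℚ.∣ X ∣ ℚ.+ 1ℚ) ℚ.* g)
        (≡.trans (ℚ.*-comm _ g) (≡.sym (ℚ.∣p*q∣≡∣p∣*∣q∣ G (X ℚ.+ r))))
        (ℚ.*-monoʳ-≤-nonNeg g (∣+∣-upper X r<1))

      widen : ∀ X {N} → Near ½ N X → Near 1ℚ N X
      widen X (r , r<½ , e) = r , ℚ.<-trans r<½ ½<1 , e

      weaken-upper : ∀ {N u w b} → ℚ.∣ w ∣ ℚ.≤ b → N ℚ.≤ (ℚ.∣ u ℚ.* u ℚ.* w ∣ ℚ.+ 1ℚ) ℚ.* g → N ℚ.≤ (ℚ.∣ u ℚ.* u ∣ ℚ.* b ℚ.+ 1ℚ) ℚ.* g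
      weaken-upper {u = u} {w} ∣w∣≤b N≤ = ℚ.≤-trans N≤ (ℚ.*-monoʳ-≤-nonNeg g (ℚ.+-monoˡ-≤ 1ℚ
        (ℚ.≤-trans (ℚ.≤-reflexive (ℚ.∣p*q∣≡∣p∣*∣q∣ (u ℚ.* u) w))
          (ℚ.*-monoˡ-≤-nonNeg ℚ.∣ u ℚ.* u ∣ {{ℚ.nonNegative (ℚ.0≤∣p∣ (u ℚ.* u))}} ∣w∣≤b))))

      ∣+μ∣ : ∀ a → ℚ.∣ a ℚ.+ μ ∣ ℚ.≤ ℚ.∣ a ∣ ℚ.+ ½
      ∣+μ∣ a = ℚ.≤-trans (ℚ.∣p+q∣≤∣p∣+∣q∣ a μ) (ℚ.+-monoʳ-≤ ℚ.∣ a ∣ (ℚ.<⇒≤ (∣shift∣<½ σ)))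

      w₂ w₁₂ : ℚ
      w₂  = 1ℚ ℚ.+ μ
      w₁₂ = 1ℚ ℚ.+ 1ℚ ℚ.+ μ

      x y z₀ : Carrier
      x  = elt u₁ 1ℚ
      y  = elt u₂ w₂
      z₀ = elt u₃ 1ℚ
      x∈K = elt-∈ u₁ 1ℚ
      y∈K = elt-∈ u₂ w₂
      z₀∈K = elt-∈ u₃ 1ℚ

      add-μ : ∀ a u → ℚ.∣ a ℚ.- u ∣ ℚ.< 18ℚ → ℚ.∣ a ℚ.+ μ ℚ.- u ∣ ℚ.< 19ℚ
      add-μ a u <18 = ≡.subst (λ v → ℚ.∣ v ∣ ℚ.< 19ℚ) (ℚS.solve 3 (λ a u m → (a ℚS.:- u) ℚS.:+ m ℚS.:= a ℚS.:+ m ℚS.:- u) ≡.refl a u μ)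
        (ℚ.<-trans (∣+∣-< {a ℚ.- u} <18 (∣shift∣<½ σ)) (from-yes (18ℚ ℚ.+ ½ ℚ.<? 19ℚ)))

      x+y≈ : x + y ≈ elt (u₁ ℚ.+ u₂) w₁₂
      x+y≈ = sym (trans (+-cong (*-congʳ (ι.+-homo u₁ u₂)) (trans (reflexive (≡.cong ι
          (ℚS.solve 3 (λ u v m → ℚS.con 1ℚ ℚS.:+ ℚS.con 1ℚ ℚS.:+ m ℚS.:- (u ℚS.:+ v) ℚS.:=
            (ℚS.con 1ℚ ℚS.:- u) ℚS.:+ (ℚS.con 1ℚ ℚS.:+ m ℚS.:- v)) ≡.refl u₁ u₂ μ))) (ι.+-homo _ _)))
        (solve 5 (λ u v z a b → (u :+ v) :* z :+ (a :+ b) := (u :* z :+ a) :+ (v :* z :+ b)) refl (ι u₁) (ι u₂) ζ _ _))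

      x-norm = elt-norm x∈K u₁ 1ℚ refl ∣u₁∣<17 ∣1-u₁∣<19
      y-norm = elt-norm y∈K u₂ w₂ refl ∣u₂∣<17 (add-μ 1ℚ u₂ ∣1-u₂∣<18)
      x+y-norm = elt-norm (+-∈ x∈K y∈K) (u₁ ℚ.+ u₂) w₁₂ x+y≈ ∣u₁+u₂∣<17 (add-μ (1ℚ ℚ.+ 1ℚ) (u₁ ℚ.+ u₂) ∣2-u₁-u₂∣<18)
      z₀-norm = elt-norm z₀∈K u₃ 1ℚ refl ∣u₃∣<17 ∣1-u₃∣<19

      h = proj₁ (1/-cancel G≢0)
      hG≡1 = proj₂ (1/-cancel G≢0)

      lipschitz = norm-lipschitz z₀∈K η∈K
      C Rη bound′ : ℚ
      C = proj₁ lipschitz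
      Rη = proj₁ (bounded η)
      -- The three summands make τ |C| / |G| < 1/2 for the norm of `z`, τ |η| < ν for its size, and
      -- τ ≤ 1 as the Lipschitz bound requires.
      bound′ = ℚ.∣ h ∣ ℚ.* ℚ.∣ C ∣ ℚ.+ Rη ℚ.+ 1ℚ
      0≤Rη = proj₁ (proj₂ (bounded η))
      0≤hC : 0ℚ ℚ.≤ ℚ.∣ h ∣ ℚ.* ℚ.∣ C ∣
      0≤hC = ≡.subst (0ℚ ℚ.≤_) (ℚ.∣p*q∣≡∣p∣*∣q∣ h C) (ℚ.0≤∣p∣ (h ℚ.* C))

      0≤bound′ : 0ℚ ℚ.≤ bound′
      0≤bound′ = ℚ.+-mono-≤ {0ℚ} {ℚ.∣ h ∣ ℚ.* ℚ.∣ C ∣ ℚ.+ Rη} (ℚ.+-mono-≤ 0≤hC 0≤Rη) (from-yes (0ℚ ℚ.≤? 1ℚ))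

      small-τ : ∃[ τ ] 0ℚ ℚ.< τ × ι τ * ι bound′ < n
      small-τ = small {ι bound′} {n} (≤-respˡ-≈ ι.0#-homo (ι-mono-≤ 0≤bound′)) 0<n
      τ = proj₁ small-τ
      0<τ = proj₁ (proj₂ small-τ)
      instance
        τ-nonNeg : ℚ.NonNegative τ
        τ-nonNeg = ℚ.nonNegative (ℚ.<⇒≤ 0<τ)

      τ*-small : ∀ {a} → a ℚ.≤ bound′ → τ ℚ.* a ℚ.< ν
      τ*-small a≤ = ℚ.≤-<-trans (ℚ.*-monoˡ-≤-nonNeg τ a≤) (ι-cancel-< (<-respˡ-≈ (sym (ι.*-homo τ bound′)) (proj₂ (proj₂ small-τ))))

      ν<½ : ν ℚ.< ½
      ν<½ = ℚ.*-cancelˡ-<-nonNeg 8ℚ (ℚ.<-trans 8ν<1 (from-yes (1ℚ ℚ.<? 8ℚ ℚ.* ½)))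

      1≤bound′ : 1ℚ ℚ.≤ bound′
      1≤bound′ = ℚ.≤-trans (from-yes (1ℚ ℚ.≤? 0ℚ ℚ.+ 0ℚ ℚ.+ 1ℚ)) (ℚ.+-monoˡ-≤ 1ℚ (ℚ.+-mono-≤ 0≤hC 0≤Rη))
      hC≤bound′ : ℚ.∣ h ∣ ℚ.* ℚ.∣ C ∣ ℚ.≤ bound′
      hC≤bound′ = ≡.subst (ℚ._≤ bound′) (≡.trans (ℚ.+-identityʳ _) (ℚ.+-identityʳ (ℚ.∣ h ∣ ℚ.* ℚ.∣ C ∣)))
        (ℚ.+-mono-≤ (ℚ.+-monoʳ-≤ (ℚ.∣ h ∣ ℚ.* ℚ.∣ C ∣) 0≤Rη) (from-yes (0ℚ ℚ.≤? 1ℚ)))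
      Rη≤bound′ : Rη ℚ.≤ bound′
      Rη≤bound′ = ≡.subst (ℚ._≤ bound′) (≡.trans (ℚ.+-identityʳ _) (ℚ.+-identityˡ Rη))
        (ℚ.+-mono-≤ (ℚ.+-monoˡ-≤ Rη 0≤hC) (from-yes (0ℚ ℚ.≤? 1ℚ)))

      τ≤1 : τ ℚ.≤ 1ℚ
      τ≤1 = ℚ.<⇒≤ (≡.subst (ℚ._< 1ℚ) (ℚ.*-identityʳ τ) (ℚ.<-trans (τ*-small 1≤bound′) (ℚ.<-trans ν<½ ½<1)))

      -- The multiple of η makes x, y, z linearly independent.
      z : Carrier
      z = z₀ + ι τ * η
      z∈K : Member z
      z∈K = +-∈ z₀∈K (*-∈ (ι-∈ τ) η∈K)

      perturbed = proj₂ lipschitz z∈K τ (ℚ.<⇒≤ 0<τ) τ≤1 refl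

      z-norm : Near 1ℚ (norm z∈K) (u₃ ℚ.* u₃ ℚ.* 1ℚ)
      z-norm =
        let r₀ , ∣r₀∣<½ , N₀≡ = z₀-norm
            r , N≡ , ∣r∣≤C = perturbed
            X = u₃ ℚ.* u₃ ℚ.* 1ℚ
            -- The error allowance 1 is split: one half for the Newton error of `z₀`, one half for
            -- the perturbation relative to `G`.
            hτr<½ : ℚ.∣ h ℚ.* (τ ℚ.* r) ∣ ℚ.< ½
            hτr<½ = ℚ.≤-<-trans (begin
                ℚ.∣ h ℚ.* (τ ℚ.* r) ∣                ≡⟨ ≡.cong ℚ.∣_∣ (ℚS.solve 3 (λ h t r → h ℚS.:* (t ℚS.:* r) ℚS.:= t ℚS.:* (h ℚS.:* r)) ≡.refl h τ r) ⟩
                ℚ.∣ τ ℚ.* (h ℚ.* r) ∣                ≡⟨ ℚ.∣p*q∣≡∣p∣*∣q∣ τ (h ℚ.* r) ⟩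
                ℚ.∣ τ ∣ ℚ.* ℚ.∣ h ℚ.* r ∣            ≡⟨ ≡.cong₂ ℚ._*_ (ℚ.0≤p⇒∣p∣≡p (ℚ.<⇒≤ 0<τ)) (ℚ.∣p*q∣≡∣p∣*∣q∣ h r) ⟩
                τ ℚ.* (ℚ.∣ h ∣ ℚ.* ℚ.∣ r ∣)          ≤⟨ ℚ.*-monoˡ-≤-nonNeg τ (ℚ.*-monoˡ-≤-nonNeg ℚ.∣ h ∣ {{ℚ.nonNegative (ℚ.0≤∣p∣ h)}} (ℚ.≤-trans ∣r∣≤C (p≤∣p∣ C))) ⟩
                τ ℚ.* (ℚ.∣ h ∣ ℚ.* ℚ.∣ C ∣)          ∎)
              (ℚ.<-trans (τ*-small hC≤bound′) ν<½)
        in r₀ ℚ.+ h ℚ.* (τ ℚ.* r) , ∣+∣-< {r₀} ∣r₀∣<½ hτr<½ ,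
           ≡.trans N≡ (≡.trans (≡.cong (ℚ._+ τ ℚ.* r) N₀≡) (≡.trans
             (≡.cong (λ e → G ℚ.* (X ℚ.+ r₀) ℚ.+ e) (≡.trans (≡.sym (ℚ.*-identityˡ (τ ℚ.* r))) (≡.cong (ℚ._* (τ ℚ.* r)) (≡.sym hG≡1))))
             (ℚS.solve 5 (λ G X r h e → G ℚS.:* (X ℚS.:+ r) ℚS.:+ h ℚS.:* G ℚS.:* e ℚS.:= G ℚS.:* (X ℚS.:+ (r ℚS.:+ h ℚS.:* e))) ≡.refl G X r₀ h (τ ℚ.* r))))
        where open ℚ.≤-Reasoning

      k*n≤8*n : ∀ k → k ℚ.≤ 8ℚ → ι k * n ≤ ι 8ℚ * n
      k*n≤8*n k k≤8 = *-monoʳ-≤ (<⇒≤ 0<n) (ι-mono-≤ k≤8)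

      x-1∈± : x - ι 1ℚ ∈± n
      x-1∈± = elt-size 1ℚ ∣u₁∣<17

      z-1∈± : z - ι 1ℚ ∈± n + n
      z-1∈± = ±-resp-≈ (solve 3 (λ z e o → z :- o :+ e := z :+ e :- o) refl z₀ (ι τ * η) (ι 1ℚ))
        (±-+ (elt-size 1ℚ ∣u₃∣<17) (<-trans (τ*< (proj₁ η∈±)) τRη<n ,
          <-trans (<-respˡ-≈ (solve 2 (λ t e → t :* (:- e) := :- (t :* e)) refl (ι τ) η) (τ*< (proj₂ η∈±))) τRη<n))
        where
        η∈± = proj₂ (proj₂ (bounded η))
        τ*< : ∀ {a b} → a < b → ι τ * a < ι τ * b
        τ*< {a} {b} a<b = <-respˡ-≈ (*-comm a (ι τ)) (<-respʳ-≈ (*-comm b (ι τ)) (*-monoʳ-< (ι-pos 0<τ) a<b))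
        τRη<n : ι τ * ι Rη < n
        τRη<n = <-respˡ-≈ (ι.*-homo τ Rη) (ι-mono-< (τ*-small Rη≤bound′))

      offset : Bool → Carrier
      offset true  = ι 4ℚ * n
      offset false = - (ι 4ℚ * n)

      ι-shift : ∀ σ → ι (shift σ) ≈ offset σ
      ι-shift true  = ι.*-homo 4ℚ ν
      ι-shift false = trans (ι.-‿homo _) (-‿cong (ι.*-homo 4ℚ ν))

      y-1-offset∈± : y - (ι 1ℚ + offset σ) ∈± n
      y-1-offset∈± = ±-resp-≈ (+-congˡ (-‿cong (trans (ι.+-homo 1ℚ μ) (+-congˡ (ι-shift σ))))) (elt-size w₂ ∣u₂∣<17)

      5ℚ = + 5 ℚ./ 1

      offset∈± : ∀ σ → offset σ ∈± ι 5ℚ * n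
      offset∈± true  = <-by 0<n (solve 1 (λ n → con 5ℚ :* n :- con 4ℚ :* n := n) refl n) ,
        <-by (*-pos (ι-pos (from-yes (0ℚ ℚ.<? 4ℚ ℚ.+ 5ℚ))) 0<n) (solve 1 (λ n → con 5ℚ :* n :- :- (con 4ℚ :* n) := con (4ℚ ℚ.+ 5ℚ) :* n) refl n)
      offset∈± false = <-by (*-pos (ι-pos (from-yes (0ℚ ℚ.<? 4ℚ ℚ.+ 5ℚ))) 0<n) (solve 1 (λ n → con 5ℚ :* n :- :- (con 4ℚ :* n) := con (4ℚ ℚ.+ 5ℚ) :* n) refl n) ,
        <-by 0<n (solve 1 (λ n → con 5ℚ :* n :- :- (:- (con 4ℚ :* n)) := n) refl n)

      in-range : ∀ {v} → v - ι 1ℚ ∈± ι 8ℚ * n → lo < v × v < hi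
      in-range {v} (v-1< , 1-v<) =
        <-by (<⇒0<- 1-v<) (solve 2 (λ v n → v :- (con 1ℚ :- con 8ℚ :* n) := con 8ℚ :* n :- :- (v :- con 1ℚ)) refl v n) ,
        <-by (<⇒0<- v-1<) (solve 2 (λ v n → con 1ℚ :+ con 8ℚ :* n :- v := con 8ℚ :* n :- (v :- con 1ℚ)) refl v n)

      x-range = in-range (±-weaken (≤-respˡ-≈ (trans (*-congʳ ι.1#-homo) (*-identityˡ n)) (k*n≤8*n 1ℚ (from-yes (1ℚ ℚ.≤? 8ℚ)))) x-1∈±)
      y-range = in-range (±-weaken
        (≤-respˡ-≈ (solve 1 (λ n → con (1ℚ ℚ.+ 5ℚ) :* n := n :+ con 5ℚ :* n) refl n) (k*n≤8*n (1ℚ ℚ.+ 5ℚ) (from-yes (1ℚ ℚ.+ 5ℚ ℚ.≤? 8ℚ))))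
        (±-resp-≈ (solve 3 (λ y o s → y :- (o :+ s) :+ s := y :- o) refl y (ι 1ℚ) (offset σ)) (±-+ y-1-offset∈± (offset∈± σ))))
      z-range = in-range (±-weaken
        (≤-respˡ-≈ (solve 1 (λ n → con (1ℚ ℚ.+ 1ℚ) :* n := n :+ n) refl n) (k*n≤8*n (1ℚ ℚ.+ 1ℚ) (from-yes (1ℚ ℚ.+ 1ℚ ℚ.≤? 8ℚ)))) z-1∈±)

      0<x : 0# < x
      0<x = <-trans 0<lo (proj₁ x-range)
      0<y : 0# < y
      0<y = <-trans 0<lo (proj₁ y-range)
      0<z : 0# < z
      0<z = <-trans 0<lo (proj₁ z-range)

      lo<x+y : lo < x + y
      lo<x+y = <-trans (proj₁ x-range) (<-by 0<y (solve 2 (λ x y → x :+ y :- x := y) refl x y))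

      order : ∀ σ {x y z} → x - ι 1ℚ ∈± n → y - (ι 1ℚ + offset σ) ∈± n → z - ι 1ℚ ∈± n + n → Ordered σ x y z
      order true {x} {y} {z} (x< , _) (_ , <y) (z< , _) =
        <-by (+-pos (+-pos (<⇒0<- <y) (<⇒0<- x<)) (+-pos 0<n 0<n))
          (solve 3 (λ x y n → y :- x := (n :- :- (y :- (con 1ℚ :+ con 4ℚ :* n))) :+ (n :- (x :- con 1ℚ)) :+ (n :+ n)) refl x y n) ,
        <-by (+-pos (+-pos (<⇒0<- <y) (<⇒0<- z<)) 0<n)
          (solve 3 (λ z y n → y :- z := (n :- :- (y :- (con 1ℚ :+ con 4ℚ :* n))) :+ (n :+ n :- (z :- con 1ℚ)) :+ n) refl z y n)
      order false {x} {y} {z} (_ , <x) (y< , _) (_ , <z) =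
        <-by (+-pos (+-pos (<⇒0<- y<) (<⇒0<- <x)) (+-pos 0<n 0<n))
          (solve 3 (λ x y n → x :- y := (n :- (y :- (con 1ℚ :+ (:- (con 4ℚ :* n))))) :+ (n :- :- (x :- con 1ℚ)) :+ (n :+ n)) refl x y n) ,
        <-by (+-pos (+-pos (<⇒0<- y<) (<⇒0<- <z)) 0<n)
          (solve 3 (λ z y n → z :- y := (n :- (y :- (con 1ℚ :+ (:- (con 4ℚ :* n))))) :+ (n :+ n :- :- (z :- con 1ℚ)) :+ n) refl z y n)

      -- The determinant of `x`, `y` with respect to ζ and 1. It simplifies to u₁ (1 + μ) - u₂,
      -- which is positive because |μ| < 1/2 and u₂ ≤ u₁ / 2.
      det : ℚ
      det = u₁ ℚ.* (w₂ ℚ.- u₂) ℚ.- u₂ ℚ.* (1ℚ ℚ.- u₁)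

      det≢0 : det ≢ 0ℚ
      det≢0 det≡0 = ℚ.<-irrefl (≡.sym det≡0) (begin-strict
        0ℚ ≡⟨ ℚ.+-inverseʳ (½ ℚ.* u₁) ⟨
        ½ ℚ.* u₁ ℚ.- ½ ℚ.* u₁ ≤⟨ ℚ.+-monoʳ-≤ (½ ℚ.* u₁) (ℚ.neg-antimono-≤ u₂≤½u₁) ⟩
        ½ ℚ.* u₁ ℚ.- u₂ ≡⟨ ℚS.solve 2 (λ a b → ℚS.con ½ ℚS.:* a ℚS.:- b ℚS.:= a ℚS.:- b ℚS.:+ a ℚS.:* (ℚS.con (ℚ.- ½))) ≡.refl u₁ u₂ ⟩
        u₁ ℚ.- u₂ ℚ.+ u₁ ℚ.* (ℚ.- ½) <⟨ ℚ.+-monoʳ-< (u₁ ℚ.- u₂) (ℚ.*-monoʳ-<-pos u₁ {{ℚ.positive 0<u₁}} -½<μ) ⟩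
        u₁ ℚ.- u₂ ℚ.+ u₁ ℚ.* μ ≡⟨ ℚS.solve 3 (λ a b m → a ℚS.:- b ℚS.:+ a ℚS.:* m ℚS.:=
          a ℚS.:* (ℚS.con 1ℚ ℚS.:+ m ℚS.:- b) ℚS.:- b ℚS.:* (ℚS.con 1ℚ ℚS.:- a)) ≡.refl u₁ u₂ μ ⟩
        det ∎)
        where
        open ℚ.≤-Reasoning
        -½<μ : ℚ.- ½ ℚ.< μ
        -½<μ = ≡.subst (ℚ.- ½ ℚ.<_) (ℚS.solve 1 (λ m → ℚS.:- (ℚS.:- m) ℚS.:= m) ≡.refl μ)
          (ℚ.neg-antimono-< (ℚ.≤-<-trans (p≤∣p∣ (ℚ.- μ)) (≡.subst (ℚ._< ½) (≡.sym (ℚ.∣-p∣≡∣p∣ μ)) (∣shift∣<½ σ))))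

      xyz-free : Free x y z
      xyz-free {α} {β} {γ} e = *-cancel-0 det≢0 α*det≡0 , *-cancel-0 det≢0 β*det≡0 , γ≡0
        where
        v₁ v₂ v₃ : ℚ
        v₁ = 1ℚ ℚ.- u₁
        v₂ = w₂ ℚ.- u₂
        v₃ = 1ℚ ℚ.- u₃
        ι-linear : ∀ a b → ι (α ℚ.* a ℚ.+ β ℚ.* b) ≈ ι α * ι a + ι β * ι b
        ι-linear a b = trans (ι.+-homo _ _) (+-cong (ι.*-homo α a) (ι.*-homo β b))
        ι₃ : ∀ a b → ι (α ℚ.* a ℚ.+ β ℚ.* b ℚ.+ γ ℚ.* v₃) ≈ ι α * ι a + ι β * ι b + ι γ * ι v₃
        ι₃ a b = trans (ι.+-homo _ _) (+-cong (ι-linear a b) (ι.*-homo γ v₃))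
        zeros : α ℚ.* v₁ ℚ.+ β ℚ.* v₂ ℚ.+ γ ℚ.* v₃ ≡ 0ℚ × α ℚ.* u₁ ℚ.+ β ℚ.* u₂ ℚ.+ γ ℚ.* u₃ ≡ 0ℚ × γ ℚ.* τ ≡ 0ℚ
        zeros = free (trans (+-cong (+-cong (trans (*-identityʳ _) (ι₃ v₁ v₂))
            (*-congʳ (trans (ι.+-homo _ _) (+-cong (ι-linear u₁ u₂) (ι.*-homo γ u₃))))) (*-congʳ (ι.*-homo γ τ)))
          (trans (solve 12 (λ α β γ u v w a b c z t y →
            (α :* a :+ β :* b :+ γ :* c) :+ (α :* u :+ β :* v :+ γ :* w) :* z :+ γ :* t :* y
            := α :* (u :* z :+ a) :+ β :* (v :* z :+ b) :+ γ :* (w :* z :+ c :+ t :* y))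
            refl (ι α) (ι β) (ι γ) (ι u₁) (ι u₂) (ι u₃) (ι v₁) (ι v₂) (ι v₃) ζ (ι τ) η) e))
        γ≡0 : γ ≡ 0ℚ
        γ≡0 = *-cancel-0 (λ τ≡0 → ℚ.<-irrefl (≡.sym τ≡0) 0<τ) (proj₂ (proj₂ zeros))
        drop : ∀ {a b} → a ℚ.+ γ ℚ.* b ≡ 0ℚ → a ≡ 0ℚ
        drop {a} {b} e = ≡.trans (≡.sym (≡.trans (≡.cong (λ γ → a ℚ.+ γ ℚ.* b) γ≡0)
          (≡.trans (≡.cong (a ℚ.+_) (ℚ.*-zeroˡ b)) (ℚ.+-identityʳ a)))) e
        V≡0 : α ℚ.* v₁ ℚ.+ β ℚ.* v₂ ≡ 0ℚ
        V≡0 = drop (proj₁ zeros)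
        U≡0 : α ℚ.* u₁ ℚ.+ β ℚ.* u₂ ≡ 0ℚ
        U≡0 = drop (proj₁ (proj₂ zeros))
        vanishes : ∀ a b {U V} → U ≡ 0ℚ → V ≡ 0ℚ → a ℚ.* U ℚ.- b ℚ.* V ≡ 0ℚ
        vanishes a b ≡.refl ≡.refl = ≡.cong₂ ℚ._-_ (ℚ.*-zeroʳ a) (ℚ.*-zeroʳ b)
        α*det≡0 : α ℚ.* det ≡ 0ℚ
        α*det≡0 = ≡.trans (ℚS.solve 6 (λ α β u v a b → α ℚS.:* (u ℚS.:* b ℚS.:- v ℚS.:* a) ℚS.:=
          b ℚS.:* (α ℚS.:* u ℚS.:+ β ℚS.:* v) ℚS.:- v ℚS.:* (α ℚS.:* a ℚS.:+ β ℚS.:* b)) ≡.refl α β u₁ u₂ v₁ v₂)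
          (vanishes v₂ u₂ U≡0 V≡0)
        β*det≡0 : β ℚ.* det ≡ 0ℚ
        β*det≡0 = ≡.trans (ℚS.solve 6 (λ α β u v a b → β ℚS.:* (u ℚS.:* b ℚS.:- v ℚS.:* a) ℚS.:=
          u ℚS.:* (α ℚS.:* a ℚS.:+ β ℚS.:* b) ℚS.:- a ℚS.:* (α ℚS.:* u ℚS.:+ β ℚS.:* v)) ≡.refl α β u₁ u₂ v₁ v₂)
          (vanishes u₁ v₁ V≡0 U≡0)

      ∣1∣≤1 : ∀ {N} u → (ℚ.∣ u ℚ.* u ℚ.* 1ℚ ∣ ℚ.- 1ℚ) ℚ.* g ℚ.≤ N → (ℚ.∣ u ℚ.* u ∣ ℚ.- 1ℚ) ℚ.* g ℚ.≤ N
      ∣1∣≤1 {N} u = ≡.subst (λ X → (ℚ.∣ X ∣ ℚ.- 1ℚ) ℚ.* g ℚ.≤ N) (ℚ.*-identityʳ (u ℚ.* u))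

      ∣1∣≥1 : ∀ {N} u → N ℚ.≤ (ℚ.∣ u ℚ.* u ℚ.* 1ℚ ∣ ℚ.+ 1ℚ) ℚ.* g → N ℚ.≤ (ℚ.∣ u ℚ.* u ∣ ℚ.+ 1ℚ) ℚ.* g
      ∣1∣≥1 {N} u = ≡.subst (λ X → N ℚ.≤ (ℚ.∣ X ∣ ℚ.+ 1ℚ) ℚ.* g) (ℚ.*-identityʳ (u ℚ.* u))

    configuration : Configuration u₁ u₂ u₃ σ
    configuration = record
      { triple = record { x∈K = x∈K ; y∈K = y∈K ; z∈K = z∈K ; 0<x = 0<x ; 0<y = 0<y ; 0<z = 0<z ; free = xyz-free }
      ; ordered = order σ x-1∈± y-1-offset∈± z-1∈±
      ; x~y = similar (<⇒≤ 0<x) (<⇒≤ (proj₂ x-range)) (<⇒≤ (proj₁ y-range))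
      ; x~z = similar (<⇒≤ 0<x) (<⇒≤ (proj₂ x-range)) (<⇒≤ (proj₁ z-range))
      ; z~x = similar (<⇒≤ 0<z) (<⇒≤ (proj₂ z-range)) (<⇒≤ (proj₁ x-range))
      ; z~y = similar (<⇒≤ 0<z) (<⇒≤ (proj₂ z-range)) (<⇒≤ (proj₁ y-range))
      ; z~x+y = similar (<⇒≤ 0<z) (<⇒≤ (proj₂ z-range)) (<⇒≤ lo<x+y)
      ; g = g ; 0<g = 0<g
      ; x-lower = ∣1∣≤1 u₁ (lower-bound (u₁ ℚ.* u₁ ℚ.* 1ℚ) (widen (u₁ ℚ.* u₁ ℚ.* 1ℚ) x-norm))
      ; x-upper = ∣1∣≥1 u₁ (upper-bound (u₁ ℚ.* u₁ ℚ.* 1ℚ) (widen (u₁ ℚ.* u₁ ℚ.* 1ℚ) x-norm))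
      ; y-upper = weaken-upper {u = u₂} {w₂} (∣+μ∣ 1ℚ) (upper-bound (u₂ ℚ.* u₂ ℚ.* w₂) (widen (u₂ ℚ.* u₂ ℚ.* w₂) y-norm))
      ; z-lower = ∣1∣≤1 u₃ (lower-bound (u₃ ℚ.* u₃ ℚ.* 1ℚ) z-norm)
      ; z-upper = ∣1∣≥1 u₃ (upper-bound (u₃ ℚ.* u₃ ℚ.* 1ℚ) z-norm)
      ; x+y-upper = weaken-upper {u = u₁ ℚ.+ u₂} {w₁₂} (∣+μ∣ (1ℚ ℚ.+ 1ℚ)) (upper-bound ((u₁ ℚ.+ u₂) ℚ.* (u₁ ℚ.+ u₂) ℚ.* w₁₂) (widen ((u₁ ℚ.+ u₂) ℚ.* (u₁ ℚ.+ u₂) ℚ.* w₁₂) x+y-norm))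
      }

-- Numerical choices and the four attainable pairs

module Realisation (ℝ : RealNumbers c ℓ₁ ℓ₂) (K : RealCubicField ℝ ℓ₃) (p q : ℕ) .{{_ : NonZero q}} where
  open RealProperties ℝ
  open RealCubicField K
  open Algorithm ℝ K p q
  open Approximation ℝ K
  open Weights ℝ K p q
  open TwoSteps ℝ K p q
  open Configurations ℝ K p q
  open Margin ℝ using (κ)

  module _ (u₁ u₂ u₃ : ℚ) where
    x-hi x-lo y-hi z-hi z-lo x+y-hi : ℚ
    x-hi = ℚ.∣ u₁ ℚ.* u₁ ∣ ℚ.+ 1ℚ
    x-lo = ℚ.∣ u₁ ℚ.* u₁ ∣ ℚ.- 1ℚ
    y-hi = ℚ.∣ u₂ ℚ.* u₂ ∣ ℚ.* (+ 3 ℚ./ 2) ℚ.+ 1ℚ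
    z-hi = ℚ.∣ u₃ ℚ.* u₃ ∣ ℚ.+ 1ℚ
    z-lo = ℚ.∣ u₃ ℚ.* u₃ ∣ ℚ.- 1ℚ
    x+y-hi = ℚ.∣ (u₁ ℚ.+ u₂) ℚ.* (u₁ ℚ.+ u₂) ∣ ℚ.* (+ 5 ℚ./ 2) ℚ.+ 1ℚ

  q₂ q₄ q₁₀ q₁₆ q₋₈ q₁₄ : ℚ
  q₂ = + 2 ℚ./ 1
  q₄ = + 4 ℚ./ 1
  q₁₀ = + 10 ℚ./ 1
  q₁₆ = + 16 ℚ./ 1
  q₋₈ = ℚ.- (+ 8 ℚ./ 1)
  q₁₄ = + 14 ℚ./ 1

  -- The norms of x, y, z, x + y are nearly proportional to 16, 4, 100, 72.
  configuration₁ : ∀ σ → Configuration q₄ q₂ q₁₀ σ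
  configuration₁ σ = Construction.configuration (IsBasis.∈₃ B) (approximant B 0<ε ε≤½) q₄ q₂ q₁₀ σ
    (from-yes (ℚ.∣ q₄ ∣ ℚ.<? 17ℚ)) (from-yes (ℚ.∣ q₂ ∣ ℚ.<? 17ℚ)) (from-yes (ℚ.∣ q₁₀ ∣ ℚ.<? 17ℚ)) (from-yes (ℚ.∣ q₄ ℚ.+ q₂ ∣ ℚ.<? 17ℚ))
    (from-yes (ℚ.∣ 1ℚ ℚ.- q₄ ∣ ℚ.<? 19ℚ)) (from-yes (ℚ.∣ 1ℚ ℚ.- q₂ ∣ ℚ.<? 18ℚ)) (from-yes (ℚ.∣ 1ℚ ℚ.- q₁₀ ∣ ℚ.<? 19ℚ))
    (from-yes (ℚ.∣ 1ℚ ℚ.+ 1ℚ ℚ.- (q₄ ℚ.+ q₂) ∣ ℚ.<? 18ℚ)) (from-yes (0ℚ ℚ.<? q₄)) (from-yes (q₂ ℚ.≤? ½ ℚ.* q₄))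
    where B = proj₂ (proj₂ unital-basis)

  -- The norms of x, y, z, x + y are nearly proportional to 256, 64, 196, 128.
  configuration₂ : ∀ σ → Configuration q₁₆ q₋₈ q₁₄ σ
  configuration₂ σ = Construction.configuration (IsBasis.∈₃ B) (approximant B 0<ε ε≤½) q₁₆ q₋₈ q₁₄ σ
    (from-yes (ℚ.∣ q₁₆ ∣ ℚ.<? 17ℚ)) (from-yes (ℚ.∣ q₋₈ ∣ ℚ.<? 17ℚ)) (from-yes (ℚ.∣ q₁₄ ∣ ℚ.<? 17ℚ)) (from-yes (ℚ.∣ q₁₆ ℚ.+ q₋₈ ∣ ℚ.<? 17ℚ))
    (from-yes (ℚ.∣ 1ℚ ℚ.- q₁₆ ∣ ℚ.<? 19ℚ)) (from-yes (ℚ.∣ 1ℚ ℚ.- q₋₈ ∣ ℚ.<? 18ℚ)) (from-yes (ℚ.∣ 1ℚ ℚ.- q₁₄ ∣ ℚ.<? 19ℚ))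
    (from-yes (ℚ.∣ 1ℚ ℚ.+ 1ℚ ℚ.- (q₁₆ ℚ.+ q₋₈) ∣ ℚ.<? 18ℚ)) (from-yes (0ℚ ℚ.<? q₁₆)) (from-yes (q₋₈ ℚ.≤? ½ ℚ.* q₁₆))
    where B = proj₂ (proj₂ unital-basis)

  module First {σ} (C : Configuration q₄ q₂ q₁₀ σ) where
    open Configuration C public
    open Triple triple using (x∈K; y∈K; z∈K)

    z≺x : z∈K ≺ x∈K
    z≺x = ≺-intro 0<g z~x z-lower x-upper (from-yes (κ ℚ.* x-hi q₄ q₂ q₁₀ ℚ.<? z-lo q₄ q₂ q₁₀))
    z≺y : z∈K ≺ y∈K
    z≺y = ≺-intro 0<g z~y z-lower y-upper (from-yes (κ ℚ.* y-hi q₄ q₂ q₁₀ ℚ.<? z-lo q₄ q₂ q₁₀))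
    z≺x+y : z∈K ≺ +-∈ x∈K y∈K
    z≺x+y = ≺-intro 0<g z~x+y z-lower x+y-upper (from-yes (κ ℚ.* x+y-hi q₄ q₂ q₁₀ ℚ.<? z-lo q₄ q₂ q₁₀))

  module Second {σ} (C : Configuration q₁₆ q₋₈ q₁₄ σ) where
    open Configuration C public
    open Triple triple using (x∈K; y∈K; z∈K)

    x≺y : x∈K ≺ y∈K
    x≺y = ≺-intro 0<g x~y x-lower y-upper (from-yes (κ ℚ.* y-hi q₁₆ q₋₈ q₁₄ ℚ.<? x-lo q₁₆ q₋₈ q₁₄))
    x≺z : x∈K ≺ z∈K
    x≺z = ≺-intro 0<g x~z x-lower z-upper (from-yes (κ ℚ.* z-hi q₁₆ q₋₈ q₁₄ ℚ.<? x-lo q₁₆ q₋₈ q₁₄))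
    z≺y : z∈K ≺ y∈K
    z≺y = ≺-intro 0<g z~y z-lower y-upper (from-yes (κ ℚ.* y-hi q₁₆ q₋₈ q₁₄ ℚ.<? z-lo q₁₆ q₋₈ q₁₄))
    z≺x+y : z∈K ≺ +-∈ x∈K y∈K
    z≺x+y = ≺-intro 0<g z~x+y z-lower x+y-upper (from-yes (κ ℚ.* x+y-hi q₁₆ q₋₈ q₁₄ ℚ.<? z-lo q₁₆ q₋₈ q₁₄))

  Realised : (i j k l : Fin 3) → Set (c ⊔ ℓ₁ ⊔ ℓ₂ ⊔ ℓ₃)
  Realised i j k l = ∃ λ P → Σ (ε-K P ≡⟨ i , j ⟩) λ εP → ε-K (ε-K_≡⟨_,_⟩.T-K εP) ≡⟨ k , l ⟩

  module _ {i j h} (π : Permutation i j h) where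
    private
      i≢j = distinct π

    realised-ij : Realised i j i j
    realised-ij = two-steps π triple i≢j z≺x+y z≺y λ R → ε-place π triple i≢j R z≺x z≺y (proj₁ ordered)
      where open First (configuration₁ false)

    realised-ji : Realised i j j i
    realised-ji = two-steps π triple i≢j z≺x+y z≺y λ R →
      ε-place (transpose π) (transpose-triple triple) (distinct (transpose π)) (represents-transpose π R) z≺y z≺x (proj₁ ordered)
      where open First (configuration₁ true)

    -- Cycling moves `x`, lightest after the step, to the third place; `y` is made the largest, so
    -- that `j` precedes `h`.
    realised-jh : Realised i j j h
    realised-jh = two-steps π triple i≢j z≺x+y z≺y λ R →
      ε-place (cycle π) (cycle-triple triple) (distinct (cycle π)) (represents-cycle π R) x≺y x≺z (proj₂ ordered)
      where open Second (configuration₂ true)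

    realised-hj : Realised i j h j
    realised-hj = two-steps π triple i≢j z≺x+y z≺y λ R →
      ε-place (transpose (cycle π)) (transpose-triple (cycle-triple triple)) (distinct (transpose (cycle π)))
        (represents-transpose (cycle π) (represents-cycle π R)) x≺z x≺y (proj₂ ordered)
      where open Second (configuration₂ false)

theorem2p7 : ∀ {c ℓ₁ ℓ₂ ℓ₃} (ℝ : RealNumbers c ℓ₁ ℓ₂) (K : RealCubicField ℝ ℓ₃)
    (p q : ℕ) .{{_ : NonZero p}} .{{_ : NonZero q}} → Coprime p q → ¬ (3 ∣ p) →
    let open Algorithm ℝ K p q in
    (i j : Fin 3) (i≢j : i ≢ j) (k l : Fin 3) → k ≢ l →
    (k , l) ≢ (i , θ i j i≢j) → (k , l) ≢ (θ i j i≢j , i) →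
    ∃ λ P → Σ (ε-K P ≡⟨ i , j ⟩) λ εP → ε-K (ε-K_≡⟨_,_⟩.T-K εP) ≡⟨ k , l ⟩
theorem2p7 ℝ K p q _ _ i j i≢j k l k≢l kl≢ih kl≢hi =
  -- This permutation is (i , h , j), so the excluded pair consists of `i` and h = θ (i , j), and
  -- `j` is the third index.
  remaining-pairs (transpose (cycle (cycle π))) (Realised i j)
    (realised-ij π) (realised-ji π) (realised-hj π) (realised-jh π) k l k≢l kl≢ih kl≢hi
  where
  open Realisation ℝ K p q
  π = permutation i j i≢j
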